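{- For every $n\ge 1$ and every pair of partitions $\lambda,\mu$, the function $\mathbb{F}_{\lambda/\mu}(\kappa_1,\dots,\kappa_n\mid\Xi,\mathsf{S})$ is a symmetric polynomial in $\kappa_1,\dots,\kappa_n$.
   Context: Fix a generic parameter $q$, and write $(x;q)_n:=\prod_{i=1}^n(1-xq^{i-1})$, $(x;q)_0:=1$. A partition is a weakly decreasing sequence $\lambda=(\lambda_1\ge\lambda_2\ge\dots\ge0)$ of nonnegative integers with finitely many nonzero entries; $l(\lambda)$ is the number of nonzero parts and $\lambda'$ is the conjugate partition, so the number of parts of $\lambda'$ equal to $j$ is $m_j(\lambda')=\lambda_j-\lambda_{j+1}$. Let $\Xi=(\xi_0,\xi_1,\dots)$ and $\mathsf{S}=(s_0,s_1,\dots)$ be sequences of generic parameters, with fixed square roots $\sqrt{\xi_i},\sqrt{s_i}$. For $k\ge0$ put $\xi_i^{(k)}:=\sqrt{\xi_{i+k}s_{i+k}\xi_i/s_i}$, $s_i^{(k)}:=\sqrt{s_{i+k}\xi_{i+k}s_i/\xi_i}$ (with these roots formed from the fixed ones), and $\tau^k_{\mathsf{S}}\Xi:=(\xi^{(k)}_0,\xi^{(k)}_1,\dots)$, $\tau^k_{\Xi}\mathsf{S}:=(s^{(k)}_0,s^{(k)}_1,\dots)$. Vertex weights: for $i,j,k,l\in\mathbb{Z}_{\ge0}$ (labels of the bottom, left, top, right edge), $$W_{t,s}(i,j;k,l):=\mathbf{1}_{i+j=k+l}\,\mathbf{1}_{i\ge l}\,(s^2/t^2)^{l}\frac{(s^2/t^2;q)_{i-l}(t^2;q)_l}{(s^2;q)_i}\frac{(q;q)_i}{(q;q)_{i-l}(q;q)_l},$$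 which depends only on $t^2,s^2$. Partition function: for $a_1,\dots,a_n\in\mathbb{Z}_{\ge0}$ and $L>l(\lambda),l(\mu)$, $$ZW^{(a_1,\dots,a_n)}_{\lambda/\mu}(\kappa_1,\dots,\kappa_n\mid\Xi,\mathsf{S}):=\sum\prod_{r=1}^n\prod_{c=1}^L W_{t_{r,c},\,s^{(r)}_c}(v_{r,c},h_{r,c-1};v_{r-1,c},h_{r,c}),\qquad t_{r,c}^2=\frac{\xi_{r+c}s_{r+c}}{\kappa_r},$$ where the sum is over all nonnegative integers $v_{r,c}$ ($0\le r\le n$, $1\le c\le L$) and $h_{r,c}$ ($1\le r\le n$, $0\le c\le L$) subject to $v_{0,c}=m_c(\lambda')$, $v_{n,c}=m_c(\mu')$, $h_{r,0}=a_r$, $h_{r,L}=0$; the result does not depend on $L$. Set $$\mathbb{F}^{\mathsf s}_{\lambda/\mu}(\kappa_1,\dots,\kappa_n\mid\Xi,\mathsf{S}):=\sum_{a_1+\dots+a_n=\lambda_1-\mu_1}\Bigl(\prod_{i=1}^n(\kappa_is_0/\xi_0)^{a_i}\frac{(\kappa_i^{ -1}s_i\xi_i;q)_{a_i}}{(q;q)_{a_i}}\Bigr)ZW^{(a_1,\dots,a_n)}_{\lambda/\mu}(\kappa_1,\dots,\kappa_n\mid\Xi,\mathsf{S}),$$ $$\mathbb{F}_{\lambda/\mu}(\kappa_1,\dots,\kappa_n\mid\Xi,\mathsf{S}):=\frac{(-\tau^n_\Xi\mathsf{S})^{\mu}}{(-\mathsf{S})^{\lambda}}\frac{\mathsf{c}_{\tau^n_\Xi\mathsf{S}}(\mu)}{\mathsf{c}_{\mathsf{S}}(\lambda)}\,\mathbb{F}^{\mathsf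 s}_{\lambda/\mu}(\kappa_1,\dots,\kappa_n\mid\Xi,\mathsf{S}),$$ where $\mathsf{c}_{\mathsf{S}}(\lambda):=\prod_{i\ge1}\frac{(s_i^2;q)_{\lambda_i-\lambda_{i+1}}}{(q;q)_{\lambda_i-\lambda_{i+1}}}$ and $(-\mathsf{S})^\lambda:=\prod_{i\ge1}(-s_{i-1})^{\lambda_i}$ (and likewise with $\mathsf S$ replaced by $\tau^n_\Xi\mathsf S$). -}

module Defs where

open import Algebra.Apartness.Bundles using (HeytingField; module HeytingCommutativeRing)
import Algebra.Apartness.Properties.HeytingCommutativeRing as HeytingProperties
open import Algebra.Bundles using (CommutativeRing; Semiring)
import Algebra.Definitions.RawSemiring as RawSemiringDefinitions
import Algebra.Properties.Ring as RingProperties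
import Algebra.Properties.Semiring.Sum as SemiringSum
open import Data.Fin.Base using (Fin; zero; suc; toℕ; fromℕ; inject₁)
open import Data.Fin.Permutation using (Permutation′; _⟨$⟩ʳ_)
open import Data.Fin.Properties using (all?)
open import Data.List.Base using (List; foldr)
open import Data.Nat.Base as ℕ using (ℕ; zero; suc; _∸_; _≤_; _<_)
open import Data.Nat.Properties using (_≟_; _≤?_)
open import Data.Product.Base using (_×_; _,_; proj₁; proj₂; ∃-syntax)
open import Data.Vec.Base as Vec using (Vec; []; _∷_; lookup; tabulate)
open import Data.Vec.Functional using (Vector)
open import Data.Vec.Properties using (≡-dec)
open import Level using (_⊔_)
open import Relation.Binary.PropositionalEquality.Core using (_≡_)
open import Relation.Nullary.Decidable using (Dec; yes; no; _×-dec_)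

-- Sequences are indexed from 0:  part i  is λ_{i+1}.
record Partition : Set where
  field
    part       : ℕ → ℕ
    decreasing : ∀ i → part (suc i) ≤ part i
    length     : ℕ
    positive   : ∀ {i} → i < length → 0 < part i
    vanishing  : ∀ {i} → length ≤ i → part i ≡ 0

  -- λ_{i+1} − λ_{i+2} = m_{i+1}(λ′); no truncation occurs, by `decreasing`.
  step : ℕ → ℕ
  step i = part i ∸ part (suc i)

-- Σ over vectors of length m, given Σ over the entry type.
ΣVec : ∀ {a c} {A : Set a} {C : Set c} →
       ((A → C) → C) → (m : ℕ) → (Vec A m → C) → C
ΣVec Σ zero    f = f []
ΣVec Σ (suc m) f = Σ λ x → ΣVec Σ m λ xs → f (x ∷ xs)

module FieldNotation {c ℓ₁ ℓ₂} (K : HeytingField c ℓ₁ ℓ₂) where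

  open HeytingField K public hiding (zero)
  open HeytingProperties heytingCommutativeRing public
    using (x#0y#0→xy#0; 1#0)

  commutativeRing : CommutativeRing c ℓ₁
  commutativeRing = HeytingCommutativeRing.commutativeRing heytingCommutativeRing

  open CommutativeRing commutativeRing using (semiring; ring)

  open RawSemiringDefinitions (Semiring.rawSemiring semiring) public
    using (_^_; product)
  open SemiringSum semiring public using (sum-syntax)

  product-syntax : ∀ n → Vector Carrier n → Carrier
  product-syntax _ = product

  infixl 10 product-syntax
  syntax product-syntax n (λ i → x) = ∏[ i < n ] x

  inverse : ∀ x → x # 0# → Carrier
  inverse x x#0 = proj₁ (#⇒invertible x#0)

  infixl 7 _/_[_]
  _/_[_] : ∀ x y → y # 0# → Carrier
  x / y [ y#0 ] = x * inverse y y#0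

  𝟙 : ∀ {p} {P : Set p} → Dec P → Carrier
  𝟙 (yes _) = 1#
  𝟙 (no  _) = 0#

  -- Σ_{j=0}^{B} f j
  Σ≤ : ℕ → (ℕ → Carrier) → Carrier
  Σ≤ B f = ∑[ j < suc B ] f (toℕ j)

  inverseˡ : ∀ {x} (x#0 : x # 0#) → inverse x x#0 * x ≈ 1#
  inverseˡ {x} x#0 =
    trans (*-congˡ (sym (HeytingProperties.x-0≈x heytingCommutativeRing x)))
          (proj₁ (proj₂ (#⇒invertible x#0)))

  leftInverse⇒#0 : ∀ {x} y → y * x ≈ 1# → x # 0#
  leftInverse⇒#0 {x} y yx≈1 =
    HeytingProperties.invertibleˡ⇒# heytingCommutativeRing
      (y , trans (*-congˡ (HeytingProperties.x-0≈x heytingCommutativeRing x)) yx≈1)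

  inverse#0 : ∀ {x} (x#0 : x # 0#) → inverse x x#0 # 0#
  inverse#0 {x} x#0 = leftInverse⇒#0 x (trans (*-comm _ _) (inverseˡ x#0))

  quotient#0 : ∀ {x y} → x # 0# → (y#0 : y # 0#) → x / y [ y#0 ] # 0#
  quotient#0 x#0 y#0 = x#0y#0→xy#0 x#0 (inverse#0 y#0)

  -‿#0 : ∀ {x} → x # 0# → - x # 0#
  -‿#0 {x} x#0 = leftInverse⇒#0 (- inverse x x#0)
    (trans (sym (-‿distribˡ-* _ _))
    (trans (-‿cong (sym (-‿distribʳ-* _ _)))
    (trans (-‿involutive _) (inverseˡ x#0))))
    where open RingProperties ring

  ^-#0 : ∀ {x} n → x # 0# → x ^ n # 0#
  ^-#0 zero    x#0 = 1#0
  ^-#0 (suc n) x#0 = x#0y#0→xy#0 x#0 (^-#0 n x#0)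

  product#0 : ∀ {n} {x : Vector Carrier n} → (∀ i → x i # 0#) → product x # 0#
  product#0 {zero}  x#0 = 1#0
  product#0 {suc n} x#0 = x#0y#0→xy#0 (x#0 zero) (product#0 λ i → x#0 (suc i))

-- Formal polynomials in n variables over K, as lists of terms  a · x₁^e₁ ⋯ xₙ^eₙ.
module Polynomials {c ℓ₁ ℓ₂} (K : HeytingField c ℓ₁ ℓ₂) where

  open FieldNotation K

  Polynomial : ℕ → Set c
  Polynomial n = List (Carrier × Vec ℕ n)

  -- The same exponent vector may occur in several terms.
  coefficient : ∀ {n} → Polynomial n → Vec ℕ n → Carrier
  coefficient P e = foldr (λ (a , e′) r → 𝟙 (≡-dec _≟_ e e′) * a + r) 0# P

  ⟦_⟧ : ∀ {n} → Polynomial n → Vector Carrier n → Carrier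
  ⟦_⟧ {n} P x = foldr (λ (a , e) r → a * ∏[ i < n ] (x i ^ lookup e i) + r) 0# P

  Symmetric : ∀ {n} → Polynomial n → Set ℓ₁
  Symmetric {n} P = ∀ (π : Permutation′ n) (e : Vec ℕ n) →
    coefficient P (tabulate λ i → lookup e (π ⟨$⟩ʳ i)) ≈ coefficient P e

  -- For functions defined at points all of whose coordinates are nonzero.
  IsSymmetricPolynomial : ∀ {n} →
    ((x : Vector Carrier n) → (∀ i → x i # 0#) → Carrier) → Set (c ⊔ ℓ₁ ⊔ ℓ₂)
  IsSymmetricPolynomial {n} f =
    ∃[ P ] Symmetric {n} P × (∀ x (x#0 : ∀ i → x i # 0#) → f x x#0 ≈ ⟦ P ⟧ x)

-- (x ; q)ₙ
pochhammer : ∀ {c ℓ₁ ℓ₂} (K : HeytingField c ℓ₁ ℓ₂) →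
             let open HeytingField K in Carrier → Carrier → ℕ → Carrier
pochhammer K q x n = ∏[ i < n ] (1# - x * q ^ toℕ i)
  where open FieldNotation K

-- Genericity is the nonvanishing of everything that occurs in a denominator,
-- together with q ≠ 0.  Since also (q ; q)ₙ ≠ 0 for all n, the powers of q are
-- pairwise distinct, so K is infinite and a polynomial over K is determined by
-- its values at points with nonzero coordinates.
record Parameters {c ℓ₁ ℓ₂} (K : HeytingField c ℓ₁ ℓ₂) : Set (c ⊔ ℓ₂) where

  open FieldNotation K

  field
    q     : Carrier
    √ξ √s : ℕ → Carrier
    q#0   : q # 0#
    √ξ#0  : ∀ i → √ξ i # 0#
    √s#0  : ∀ i → √s i # 0#

  ξ : ℕ → Carrier
  ξ i = √ξ i * √ξ i

  s : ℕ → Carrier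
  s i = √s i * √s i

  -- s^{(k)}_i = √(s_{i+k} ξ_{i+k} s_i / ξ_i), the i-th entry of τ^k_Ξ S.
  τs : ℕ → ℕ → Carrier
  τs k i = (√s (i ℕ.+ k) * √ξ (i ℕ.+ k) * √s i) / √ξ i [ √ξ#0 i ]

  poch : Carrier → ℕ → Carrier
  poch = pochhammer K q

  field
    poch-q#0  : ∀ n → poch q n # 0#
    -- τs 0 i ≈ s i, so this is the case k = 0 of the next field.
    poch-s#0  : ∀ i n → poch (s i * s i) n # 0#
    poch-τs#0 : ∀ k i n → poch (τs k i * τs k i) n # 0#

  ξ#0 : ∀ i → ξ i # 0#
  ξ#0 i = x#0y#0→xy#0 (√ξ#0 i) (√ξ#0 i)

  s#0 : ∀ i → s i # 0#
  s#0 i = x#0y#0→xy#0 (√s#0 i) (√s#0 i)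

module Functions {c ℓ₁ ℓ₂} (K : HeytingField c ℓ₁ ℓ₂) (Θ : Parameters K) where

  open FieldNotation K
  open Parameters Θ
  open Partition

  -- The weight W_{t,s}(i,j;k,l) as a function of T = t² and S = s².
  W : (T S : Carrier) → T # 0# → (∀ n → poch S n # 0#) →
      (i j k l : ℕ) → Carrier
  W T S T#0 S#0 i j k l =
      𝟙 (i ℕ.+ j ≟ k ℕ.+ l)
    * 𝟙 (l ≤? i)
    * ρ ^ l
    * (poch ρ (i ∸ l) * poch T l) / poch S i [ S#0 i ]
    * poch q i / (poch q (i ∸ l) * poch q l)
        [ x#0y#0→xy#0 (poch-q#0 (i ∸ l)) (poch-q#0 l) ]
    where ρ = S / T [ T#0 ]

  -- c_S(λ), its numerator and denominator depending on the sequence S.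
  𝖼 : (ℕ → Carrier) → Partition → Carrier
  𝖼 S ν = ∏[ i < length ν ]
    (poch (S (suc (toℕ i)) * S (suc (toℕ i))) (step ν (toℕ i))
      / poch q (step ν (toℕ i)) [ poch-q#0 (step ν (toℕ i)) ])

  𝖼#0 : ∀ S → (∀ i n → poch (S i * S i) n # 0#) → ∀ ν → 𝖼 S ν # 0#
  𝖼#0 S S#0 ν = product#0 {length ν} λ i →
    quotient#0 (S#0 (suc (toℕ i)) (step ν (toℕ i))) (poch-q#0 (step ν (toℕ i)))

  -- (−S)^ν
  [-_]^_ : (ℕ → Carrier) → Partition → Carrier
  [- S ]^ ν = ∏[ i < length ν ] ((- S (toℕ i)) ^ part ν (toℕ i))

  [-]^-#0 : ∀ S → (∀ i → S i # 0#) → ∀ ν → [- S ]^ ν # 0#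
  [-]^-#0 S S#0 ν = product#0 {length ν} λ i →
    ^-#0 (part ν (toℕ i)) (-‿#0 (S#0 (toℕ i)))

  module _ {n : ℕ} (κ : Vector Carrier n) (κ#0 : ∀ r → κ r # 0#) (L : ℕ) where

    -- t²_{r,c}
    t² : ∀ (r : Fin n) (c : ℕ) → Carrier
    t² r c = (ξ (suc (toℕ r) ℕ.+ c) * s (suc (toℕ r) ℕ.+ c)) / κ r [ κ#0 r ]

    t²#0 : ∀ r c → t² r c # 0#
    t²#0 r c = quotient#0 (x#0y#0→xy#0 (ξ#0 _) (s#0 _)) (κ#0 r)

    -- Row r and column c of the lattice are numbered from 1, so the indices
    -- r : Fin n and c : Fin L stand for row  suc (toℕ r)  and column
    -- suc (toℕ c).  Entry (r , c) of v is v_{r,c+1}; entry (r , c) of h is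
    -- h_{r+1,c}.
    vertexWeight : Vec (Vec ℕ L) (suc n) → Vec (Vec ℕ (suc L)) n →
                   Fin n → Fin L → Carrier
    vertexWeight v h r c =
      W (t² r (suc (toℕ c)))
        (τs (suc (toℕ r)) (suc (toℕ c)) * τs (suc (toℕ r)) (suc (toℕ c)))
        (t²#0 r (suc (toℕ c)))
        (poch-τs#0 (suc (toℕ r)) (suc (toℕ c)))
        (lookup (lookup v (suc r)) c)
        (lookup (lookup h r) (inject₁ c))
        (lookup (lookup v (inject₁ r)) c)
        (lookup (lookup h r) (suc c))

    boundary? : (ν μ : Partition) (a : Vec ℕ n)
                (v : Vec (Vec ℕ L) (suc n)) (h : Vec (Vec ℕ (suc L)) n) →
                Dec (((∀ c → lookup (lookup v zero) c ≡ step ν (toℕ c))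
                    × (∀ c → lookup (lookup v (fromℕ n)) c ≡ step μ (toℕ c)))
                    × ((∀ r → lookup (lookup h r) zero ≡ lookup a r)
                    × (∀ r → lookup (lookup h r) (fromℕ L) ≡ 0)))
    boundary? ν μ a v h =
      (all? (λ c → lookup (lookup v zero) c ≟ step ν (toℕ c))
        ×-dec all? (λ c → lookup (lookup v (fromℕ n)) c ≟ step μ (toℕ c)))
      ×-dec
      (all? (λ r → lookup (lookup h r) zero ≟ lookup a r)
        ×-dec all? (λ r → lookup (lookup h r) (fromℕ L) ≟ 0))

    -- ZW^{(a₁,…,aₙ)}_{ν/μ}, with ν the outer partition.  Restricting the edge
    -- labels to {0,…,ν₁} loses nothing: in a configuration of nonzero weight
    -- conservation i + j = k + l gives Σ_c v_{r,c} + a_r = Σ_c v_{r-1,c}, where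
    -- Σ_c v_{0,c} = ν₁ as L > l(ν); so a_r ≤ ν₁ and v_{r,c} ≤ ν₁, and l ≤ i
    -- gives h_{r,c} ≤ v_{r,c} for c ≥ 1.
    ZW : (ν μ : Partition) → Vec ℕ n → Carrier
    ZW ν μ a =
      ΣVec (ΣVec (Σ≤ (part ν 0)) L) (suc n) λ v →
      ΣVec (ΣVec (Σ≤ (part ν 0)) (suc L)) n λ h →
        𝟙 (boundary? ν μ a v h)
          * ∏[ r < n ] ∏[ c < L ] vertexWeight v h r c

    -- The condition Σ aᵢ = ν₁ − μ₁ is an equation in ℤ (unsolvable if ν₁ < μ₁)
    -- and forces aᵢ ≤ ν₁.
    𝔽ˢ : (ν μ : Partition) → Carrier
    𝔽ˢ ν μ =
      ΣVec (Σ≤ (part ν 0)) n λ a →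
        𝟙 (Vec.sum a ℕ.+ part μ 0 ≟ part ν 0)
          * ∏[ i < n ]
              ((κ i * s 0 / ξ 0 [ ξ#0 0 ]) ^ lookup a i
                * poch (s (suc (toℕ i)) * ξ (suc (toℕ i)) / κ i [ κ#0 i ]) (lookup a i)
                  / poch q (lookup a i) [ poch-q#0 (lookup a i) ])
          * ZW ν μ a

    𝔽 : (ν μ : Partition) → Carrier
    𝔽 ν μ =
      ([- τs n ]^ μ) / ([- s ]^ ν) [ [-]^-#0 s s#0 ν ]
        * (𝖼 (τs n) μ / 𝖼 s ν [ 𝖼#0 s poch-s#0 ν ])
        * 𝔽ˢ ν μ

-- Up to factors free of κ, a vertex of row r and column c from whose bottom edge l of i
-- particles leave to the right has the q-Hahn weight
--   u^l [κ,p]_l/(q;q)_l · [1,κu]_{i−l}/(q;q)_{i−l},   [x,y]_n = ∏_{m<n} (x − y q^m),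
-- with u = s_c/ξ_c and p = ξ_{r+c}s_{r+c}, and the left boundary factor is u₀^a [κ,p_r]_a/(q;q)_a.
-- So 𝔽 is a polynomial in κ, and symmetry is the exchange of the parameters κ, κ′ of two
-- consecutive rows.  The operator that lifts d units from the lower to the upper of two
-- horizontal edges with weight [κ′,κ]_d/(q;q)_d can be pulled through a column and is absorbed
-- by the left boundary (q-Vandermonde).  Once the factor [κ′,p]_j of each column is moved to
-- the next one, the column relation is free of denominators in κ; it is Sears' transformation
-- of terminating balanced ₄φ₃ series, that is, q-Saalschütz applied twice, first in base 1/q
-- to the q-factorials and then in base q.  Finally, as q is not a root of unity, a polynomial
-- function determines its coefficients, so symmetric values give symmetric coefficients.

module Submission where

open import Defs
open import Algebra.Apartness.Bundles using (HeytingField)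
open import Data.Nat.Base using (ℕ; _≤_; _<_)

open import Algebra.Bundles using (CommutativeRing; Semiring)
import Algebra.Definitions.RawSemiring as RawSemiringDefinitions
import Algebra.Properties.CommutativeMonoid.Sum as CommutativeMonoidSum
import Algebra.Properties.CommutativeSemigroup as CommutativeSemigroupProperties
import Algebra.Properties.CommutativeSemiring.Exp as CommutativeSemiringExp
import Algebra.Properties.Ring as RingProperties
import Algebra.Properties.Semiring.Exp as SemiringExp
import Algebra.Properties.Semiring.Mult.TCOptimised as Multiples
import Algebra.Solver.Ring
import Algebra.Solver.Ring.AlmostCommutativeRing as ACR
open import Data.Fin.Base using (Fin; zero; suc; toℕ; fromℕ; inject₁; punchIn)
open import Data.Fin.Permutation as Permutation using (Permutation′; _⟨$⟩ʳ_; _⟨$⟩ˡ_)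
open import Data.Fin.Properties using (all?)
open import Data.Integer.Base as ℤ using (ℤ; +_; -[1+_])
import Data.Integer.Properties as ℤ
open import Data.List.Base as List using (List; []; _∷_; _++_)
import Data.List.Properties as List
open import Data.List.Relation.Binary.Permutation.Propositional using (_↭_; prep; swap; ↭-sym; ↭-reflexive) renaming (refl to ↭-refl; trans to ↭-trans)
import Data.List.Relation.Unary.All as ListAll
import Data.List.Relation.Unary.All.Properties as ListAll
open import Data.Maybe.Base using (Maybe; just; nothing)
open import Data.Nat.Base as ℕ using (zero; suc; _∸_)
import Data.Nat.Properties as ℕ
open import Data.Nat.Solver using (module +-*-Solver)
open import Data.Product.Base using (_×_; _,_; proj₁; proj₂; ∃-syntax)
open import Data.Sum.Base using (inj₁; inj₂)
open import Data.Vec.Base as Vec using (Vec; []; _∷_; lookup; tabulate)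
open import Data.Vec.Functional as Vector using (Vector)
import Data.Vec.Properties as Vec
open import Data.Vec.Relation.Unary.All using (All; []; _∷_)
import Data.Vec.Relation.Unary.All.Properties as All
open import Function.Base using (_∘_; flip)
open import Level using (_⊔_)
open import Relation.Binary.PropositionalEquality.Core as ≡ using (_≡_)
import Relation.Binary.Reasoning.Setoid as SetoidReasoning
open import Relation.Nullary.Decidable using (Dec; yes; no; _×-dec_)
open import Relation.Nullary.Negation.Core using (¬_; contradiction)

open +-*-Solver using () renaming (solve to solve′; _:+_ to _:+′_; _:=_ to _:=′_)

-- The parameter p depends on r + c only, so the lower vertex of a column and the upper vertex of
-- the next column share it. Lending [κ′,p]_j to the next column thus leaves both vertices of a
-- column with the same p, and the sums over the number d of lifted units on the two sides become
-- ₄φ₃ series of one shape. Otherwise quotients by [κ′,p]_j would occur.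
--
-- Such quotients are a real obstacle: equality in a Heyting field is not decidable, so the points
-- with κ = 0, κ = κ′ or a vanishing factor cannot be split off. The identities are therefore
-- homogeneous and divide only by q, (q;q)_n and (s²;q)_n. As a result the chain of rows is a
-- function on all points, while 𝔽 requires nonzero κ; symmetry and coefficients are read off from
-- the chain.
--
-- For the same reason q-Saalschütz rests on a certificate with polynomial terms instead of ratios
-- of consecutive terms, and coefficients are isolated by the dilation x ↦ qx, which only asks that
-- the 1 - q^d be invertible.

-- A ring solver with integer coefficients.

module IntegerSolver {c ℓ} (R : CommutativeRing c ℓ) where

  open CommutativeRing R
  open RingProperties ring
  open Multiples semiring using (1+×; ×-homo-+; ×1-homo-*) renaming (_×_ to infixl 8 _·_)
  open SetoidReasoning setoid

  private
    ⟦_⟧ℤ : ℤ → Carrier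
    ⟦ + n ⟧ℤ      = n · 1#
    ⟦ -[1+ n ] ⟧ℤ = - (suc n · 1#)

    neg-homo : ∀ i → ⟦ ℤ.- i ⟧ℤ ≈ - ⟦ i ⟧ℤ
    neg-homo (+ zero)   = sym -0#≈0#
    neg-homo (+ suc n)  = refl
    neg-homo (-[1+ n ]) = sym (-‿involutive _)

    cancel-one : ∀ x y → (1# + x) - (1# + y) ≈ x - y
    cancel-one x y = begin
      (1# + x) - (1# + y)        ≈⟨ +-congˡ (-‿+-comm 1# y) ⟨
      (1# + x) + (- 1# + - y)    ≈⟨ +-congʳ (+-comm 1# x) ⟩
      (x + 1#) + (- 1# + - y)    ≈⟨ +-assoc x 1# _ ⟩
      x + (1# + (- 1# + - y))    ≈⟨ +-congˡ (+-assoc 1# (- 1#) (- y)) ⟨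
      x + ((1# + - 1#) + - y)    ≈⟨ +-congˡ (+-congʳ (-‿inverseʳ 1#)) ⟩
      x + (0# + - y)             ≈⟨ +-congˡ (+-identityˡ (- y)) ⟩
      x - y                      ∎

    ⊖-homo : ∀ m n → ⟦ m ℤ.⊖ n ⟧ℤ ≈ m · 1# - n · 1#
    ⊖-homo m zero = sym (trans (+-congˡ -0#≈0#) (+-identityʳ _))
    ⊖-homo zero (suc n) = sym (+-identityˡ _)
    ⊖-homo (suc m) (suc n) = begin
      ⟦ suc m ℤ.⊖ suc n ⟧ℤ            ≡⟨ ≡.cong ⟦_⟧ℤ (ℤ.[1+m]⊖[1+n]≡m⊖n m n) ⟩
      ⟦ m ℤ.⊖ n ⟧ℤ                    ≈⟨ ⊖-homo m n ⟩
      m · 1# - n · 1#                 ≈⟨ cancel-one _ _ ⟨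
      (1# + m · 1#) - (1# + n · 1#)   ≈⟨ +-cong (1+× m 1#) (-‿cong (1+× n 1#)) ⟨
      suc m · 1# - suc n · 1#         ∎

    +-homo : ∀ i j → ⟦ i ℤ.+ j ⟧ℤ ≈ ⟦ i ⟧ℤ + ⟦ j ⟧ℤ
    +-homo (+ m)      (+ n)      = ×-homo-+ 1# m n
    +-homo (+ m)      (-[1+ n ]) = ⊖-homo m (suc n)
    +-homo (-[1+ m ]) (+ n)      = trans (⊖-homo n (suc m)) (+-comm _ _)
    +-homo (-[1+ m ]) (-[1+ n ]) = begin
      - (suc (suc (m ℕ.+ n)) · 1#)    ≡⟨ ≡.cong (λ k → - (suc k · 1#)) (ℕ.+-suc m n) ⟨
      - ((suc m ℕ.+ suc n) · 1#)      ≈⟨ -‿cong (×-homo-+ 1# (suc m) (suc n)) ⟩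
      - (suc m · 1# + suc n · 1#)     ≈⟨ -‿+-comm _ _ ⟨
      - (suc m · 1#) - (suc n · 1#)   ∎

    *-homo : ∀ i j → ⟦ i ℤ.* j ⟧ℤ ≈ ⟦ i ⟧ℤ * ⟦ j ⟧ℤ
    *-homo (+ m)      (+ n)      = trans (reflexive (≡.cong ⟦_⟧ℤ (ℤ.+◃n≡+n (m ℕ.* n)))) (×1-homo-* m n)
    *-homo (+ m)      (-[1+ n ]) = begin
      ⟦ (+ m) ℤ.* -[1+ n ] ⟧ℤ     ≡⟨ ≡.cong ⟦_⟧ℤ (ℤ.-◃n≡-n (m ℕ.* suc n)) ⟩
      ⟦ ℤ.- (+ (m ℕ.* suc n)) ⟧ℤ  ≈⟨ neg-homo (+ (m ℕ.* suc n)) ⟩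
      - ((m ℕ.* suc n) · 1#)      ≈⟨ -‿cong (×1-homo-* m (suc n)) ⟩
      - (m · 1# * suc n · 1#)     ≈⟨ -‿distribʳ-* _ _ ⟩
      m · 1# * - (suc n · 1#)     ∎
    *-homo (-[1+ m ]) (+ n)      = begin
      ⟦ -[1+ m ] ℤ.* (+ n) ⟧ℤ     ≡⟨ ≡.cong ⟦_⟧ℤ (ℤ.-◃n≡-n (suc m ℕ.* n)) ⟩
      ⟦ ℤ.- (+ (suc m ℕ.* n)) ⟧ℤ  ≈⟨ neg-homo (+ (suc m ℕ.* n)) ⟩
      - ((suc m ℕ.* n) · 1#)      ≈⟨ -‿cong (×1-homo-* (suc m) n) ⟩
      - (suc m · 1# * n · 1#)     ≈⟨ -‿distribˡ-* _ _ ⟩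
      - (suc m · 1#) * n · 1#     ∎
    *-homo (-[1+ m ]) (-[1+ n ]) = begin
      (suc m ℕ.* suc n) · 1#             ≈⟨ ×1-homo-* (suc m) (suc n) ⟩
      suc m · 1# * suc n · 1#            ≈⟨ -‿involutive _ ⟨
      - - (suc m · 1# * suc n · 1#)      ≈⟨ -‿cong (-‿distribʳ-* _ _) ⟩
      - (suc m · 1# * - (suc n · 1#))    ≈⟨ -‿distribˡ-* _ _ ⟩
      - (suc m · 1#) * - (suc n · 1#)    ∎

    morphism : ℤ.+-*-rawRing ACR.-Raw-AlmostCommutative⟶ ACR.fromCommutativeRing R
    morphism = record
      { ⟦_⟧    = ⟦_⟧ℤ
      ; +-homo = +-homo
      ; *-homo = *-homo
      ; -‿homo = neg-homo
      ; 0-homo = refl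
      ; 1-homo = refl
      }

    -- Coefficients are compared in ℤ, where equality is decidable; nothing of the kind is assumed
    -- of the ring.
    _≈?_ : ∀ i j → Maybe (⟦ i ⟧ℤ ≈ ⟦ j ⟧ℤ)
    i ≈? j with i ℤ.≟ j
    ... | yes ≡.refl = just refl
    ... | no  _      = nothing

  open Algebra.Solver.Ring ℤ.+-*-rawRing (ACR.fromCommutativeRing R) morphism _≈?_ public
    using (solve; _:=_; _:+_; _:*_; _:-_; :-_; con; Polynomial)

  :1 : ∀ {n} → Polynomial n
  :1 = con (+ 1)

  :0 : ∀ {n} → Polynomial n
  :0 = con (+ 0)

-- Pochhammer symbols, q-binomial sums and the q-Saalschütz sum.

module QBinomial {c ℓ} (R : CommutativeRing c ℓ) where

  open CommutativeRing R
  open RawSemiringDefinitions (Semiring.rawSemiring semiring) using (_^_)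
  open SemiringExp semiring using (^-homo-*)
  open RingProperties ring using (+-cancelʳ)
  open IntegerSolver R
  open SetoidReasoning setoid

  -- x^n (y/x;q)_n, without the division by x
  shifted : (q x y : Carrier) → ℕ → Carrier
  shifted q x y zero    = 1#
  shifted q x y (suc n) = shifted q x y n * (x - y * q ^ n)

  shifted-cong : ∀ q {x x′ y y′} n → x ≈ x′ → y ≈ y′ → shifted q x y n ≈ shifted q x′ y′ n
  shifted-cong q zero    x≈x′ y≈y′ = refl
  shifted-cong q (suc n) x≈x′ y≈y′ =
    *-cong (shifted-cong q n x≈x′ y≈y′) (+-cong x≈x′ (-‿cong (*-congʳ y≈y′)))

  shifted-+ : ∀ q x y m n → shifted q x y (m ℕ.+ n) ≈ shifted q x y m * shifted q x (y * q ^ m) n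
  shifted-+ q x y m zero    = trans (reflexive (≡.cong (shifted q x y) (ℕ.+-identityʳ m))) (sym (*-identityʳ _))
  shifted-+ q x y m (suc n) = begin
    shifted q x y (m ℕ.+ suc n)                                  ≡⟨ ≡.cong (shifted q x y) (ℕ.+-suc m n) ⟩
    shifted q x y (m ℕ.+ n) * (x - y * q ^ (m ℕ.+ n))
      ≈⟨ *-cong (shifted-+ q x y m n) (+-congˡ (-‿cong (trans (*-congˡ (^-homo-* q m n)) (sym (*-assoc _ _ _))))) ⟩
    shifted q x y m * shifted q x (y * q ^ m) n * (x - y * q ^ m * q ^ n)
      ≈⟨ *-assoc _ _ _ ⟩
    shifted q x y m * shifted q x (y * q ^ m) (suc n)            ∎

  shifted-head : ∀ q x y n → shifted q x y (suc n) ≈ (x - y) * shifted q x (y * q) n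
  shifted-head q x y n = begin
    shifted q x y (suc n)                                ≈⟨ shifted-+ q x y 1 n ⟩
    1# * (x - y * 1#) * shifted q x (y * (q * 1#)) n
      ≈⟨ *-cong (trans (*-identityˡ _) (+-congˡ (-‿cong (*-identityʳ y))))
                (shifted-cong q n refl (*-congˡ (*-identityʳ q))) ⟩
    (x - y) * shifted q x (y * q) n                      ∎

  -- Homogeneity is the tool for clearing denominators: a prefactor a^n is pushed into both
  -- arguments.
  shifted-scale : ∀ q a x y n → shifted q (a * x) (a * y) n ≈ a ^ n * shifted q x y n
  shifted-scale q a x y zero    = sym (*-identityˡ 1#)
  shifted-scale q a x y (suc n) = trans (*-congʳ (shifted-scale q a x y n))
    (solve 6 (λ a aⁿ s x y qⁿ → aⁿ :* s :* (a :* x :- a :* y :* qⁿ) := a :* aⁿ :* (s :* (x :- y :* qⁿ)))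
      refl a (a ^ n) (shifted q x y n) x y (q ^ n))

  -- Σ over g + e = k of the q-binomial coefficient times F g e.
  Bin : Carrier → ℕ → (ℕ → ℕ → Carrier) → Carrier
  Bin q zero    F = F 0 0
  Bin q (suc k) F = Bin q k λ g e → F (suc g) e + q ^ g * F g (suc e)

  Bin-cong : ∀ q k {F G} → (∀ g e → g ℕ.+ e ≡ k → F g e ≈ G g e) → Bin q k F ≈ Bin q k G
  Bin-cong q zero    F≈G = F≈G 0 0 ≡.refl
  Bin-cong q (suc k) F≈G = Bin-cong q k λ g e g+e≡k →
    +-cong (F≈G (suc g) e (≡.cong suc g+e≡k))
           (*-congˡ (F≈G g (suc e) (≡.trans (ℕ.+-suc g e) (≡.cong suc g+e≡k))))

  Bin-+ : ∀ q k F G → Bin q k (λ g e → F g e + G g e) ≈ Bin q k F + Bin q k G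
  Bin-+ q zero    F G = refl
  Bin-+ q (suc k) F G = trans
    (Bin-cong q k λ g e _ →
      solve 5 (λ a b c d x → (a :+ b) :+ x :* (c :+ d) := (a :+ x :* c) :+ (b :+ x :* d))
        refl (F (suc g) e) (G (suc g) e) (F g (suc e)) (G g (suc e)) (q ^ g))
    (Bin-+ q k _ _)

  Bin-* : ∀ q k a F → Bin q k (λ g e → a * F g e) ≈ a * Bin q k F
  Bin-* q zero    a F = refl
  Bin-* q (suc k) a F = trans
    (Bin-cong q k λ g e _ →
      solve 4 (λ a b c x → a :* b :+ x :* (a :* c) := a :* (b :+ x :* c))
        refl a (F (suc g) e) (F g (suc e)) (q ^ g))
    (Bin-* q k a _)

  -- The other q-Pascal rule, reflecting the symmetry of the q-binomial coefficient in g and e. With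
  -- both rules at hand one sum has two expansions, whose difference vanishes; this is what a
  -- certificate exploits.
  Bin-suc′ : ∀ q k F → Bin q (suc k) F ≈ Bin q k (λ g e → q ^ e * F (suc g) e + F g (suc e))
  Bin-suc′ q zero    F = +-cong (sym (*-identityˡ _)) (*-identityˡ _)
  Bin-suc′ q (suc k) F = begin
    Bin q (suc k) (λ g e → F (suc g) e + q ^ g * F g (suc e))
      ≈⟨ Bin-suc′ q k (λ g e → F (suc g) e + q ^ g * F g (suc e)) ⟩
    Bin q k (λ g e → q ^ e * (F (suc (suc g)) e + q ^ suc g * F (suc g) (suc e))
                     + (F (suc g) (suc e) + q ^ g * F g (suc (suc e))))
      ≈⟨ (Bin-cong q k λ g e _ →
          solve 6 (λ q qᵉ qᵍ a b c → qᵉ :* (a :+ q :* qᵍ :* b) :+ (b :+ qᵍ :* c)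
                                  := (qᵉ :* a :+ b) :+ qᵍ :* (q :* qᵉ :* b :+ c))
            refl q (q ^ e) (q ^ g) (F (suc (suc g)) e) (F (suc g) (suc e)) (F g (suc (suc e)))) ⟩
    Bin q (suc k) (λ g e → q ^ e * F (suc g) e + F g (suc e)) ∎

  module _ (q x y z v : Carrier) where

    private
      term : ℕ → ℕ → Carrier
      term g e = shifted q x y g * shifted q y z e
               * (shifted q 1# (x * v) e * shifted q 1# (z * v * q ^ e) g)

      -- The q-Zeilberger certificate of the sum: adding the two sides of `Bin-suc′` for
      -- this function makes the recursion in k hold term by term.
      certificate : ℕ → ℕ → ℕ → Carrier
      certificate k zero    e = 0#
      certificate k (suc g) e = - (z * v * q ^ k) *
        (shifted q x y (suc g) * shifted q y z e
          * (shifted q 1# (x * v) e * shifted q 1# (z * v * q ^ e) g))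

      -- Peeling first factors with `shifted-head` turns the symbols of length g, g + 1 and g + 2 in
      -- z v into multiples of the single `Z`; what remains is a polynomial identity in q^g and q^e.
      -- The certificate is defined by cases on g, hence the separate case g = 0.
      pointwise : ∀ k g e → g ℕ.+ e ≡ k →
        (term (suc g) e + q ^ g * term g (suc e))
          + (q ^ e * certificate k (suc g) e + certificate k g (suc e))
        ≈ (x - z * q ^ k) * (1# - y * v * q ^ k) * term g e
          + (certificate k (suc g) e + q ^ g * certificate k g (suc e))
      pointwise _ zero e ≡.refl = 
        solve 7 (λ x y z v b Y V →
           let T = λ X W → (X :* Y :* (V :* W)) in
           ((:1 :* (x :- y :* :1)) :* Y :* (V :* (:1 :* (:1 :- z :* v :* b :* :1)))
             :+ :1 :* (:1 :* (Y :* (y :- z :* b)) :* (V :* (:1 :- x :* v :* b) :* :1)))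
           :+ (b :* ((:- (z :* v :* b)) :* ((:1 :* (x :- y :* :1)) :* Y :* (V :* :1))) :+ con (ℤ.+ 0))
           := (x :- z :* b) :* (:1 :- y :* v :* b) :* (:1 :* Y :* (V :* :1))
           :+ ((:- (z :* v :* b)) :* ((:1 :* (x :- y :* :1)) :* Y :* (V :* :1)) :+ :1 :* con (ℤ.+ 0)))
          refl x y z v (q ^ e) (shifted q y z e) (shifted q 1# (x * v) e)
      pointwise _ (suc g) e ≡.refl = begin
        S″ * Y * (V * T (suc (suc g))) + q ^ suc g * (S * Y′ * (V′ * T′ (suc g)))
          + (q ^ e * (- (z * v * q ^ k) * (S″ * Y * (V * T (suc g))))
            + - (z * v * q ^ k) * (S * Y′ * (V′ * T′ g)))
          ≈⟨ +-cong (+-cong (*-congˡ (*-congˡ T-ssg)) (*-congˡ (*-congˡ (*-congˡ T′-sg))))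
                    (+-cong (*-congˡ (*-cong c≈ (*-congˡ (*-congˡ T-sg))))
                            (*-cong c≈ (*-congˡ (*-congˡ T′-g)))) ⟩
        _ ≈⟨ solve 11 (λ x y z v q a b S Y V Z →
               let w = z :* v :* b ; qk = q :* a :* b ; cc = :- (z :* v :* qk)
                   S″ = S :* (x :- y :* (q :* a))
                   Y′ = Y :* (y :- z :* b) ; V′ = V :* (:1 :- x :* v :* b)
               in
               (S″ :* Y :* (V :* ((:1 :- w) :* (Z :* (:1 :- w :* q :* a))))
                 :+ (q :* a) :* (S :* Y′ :* (V′ :* (Z :* (:1 :- w :* q :* a)))))
               :+ (b :* (cc :* (S″ :* Y :* (V :* ((:1 :- w) :* Z)))) :+ cc :* (S :* Y′ :* (V′ :* Z)))
               := (x :- z :* qk) :* (:1 :- y :* v :* qk) :* (S :* Y :* (V :* ((:1 :- w) :* Z)))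
               :+ (cc :* (S″ :* Y :* (V :* ((:1 :- w) :* Z))) :+ (q :* a) :* (cc :* (S :* Y′ :* (V′ :* Z)))))
               refl x y z v q (q ^ g) (q ^ e) S Y V Z ⟩
        _ ≈⟨ +-cong (*-cong (*-cong (+-congˡ (-‿cong (*-congˡ qᵏ))) (+-congˡ (-‿cong (*-congˡ qᵏ))))
                            (*-congˡ (*-congˡ T-sg)))
                    (+-cong (*-cong c≈ (*-congˡ (*-congˡ T-sg)))
                            (*-congˡ (*-cong c≈ (*-congˡ (*-congˡ T′-g))))) ⟨
        (x - z * q ^ k) * (1# - y * v * q ^ k) * (S * Y * (V * T (suc g)))
          + (- (z * v * q ^ k) * (S″ * Y * (V * T (suc g)))
            + q ^ suc g * (- (z * v * q ^ k) * (S * Y′ * (V′ * T′ g)))) ∎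
        where
        k  = suc g ℕ.+ e
        w  = z * v * q ^ e
        S  = shifted q x y (suc g)
        S″ = shifted q x y (suc (suc g))
        Y  = shifted q y z e
        Y′ = shifted q y z (suc e)
        V  = shifted q 1# (x * v) e
        V′ = shifted q 1# (x * v) (suc e)
        T  = shifted q 1# w
        T′ = shifted q 1# (z * v * q ^ suc e)
        Z  = shifted q 1# (w * q) g
        T-sg  = shifted-head q 1# w g
        T-ssg = shifted-head q 1# w (suc g)
        zvqe≈ : z * v * (q * q ^ e) ≈ w * q
        zvqe≈ = trans (*-congˡ (*-comm _ _)) (sym (*-assoc _ _ _))
        T′-g  = shifted-cong q g refl zvqe≈
        T′-sg = shifted-cong q (suc g) refl zvqe≈
        qᵏ : q ^ k ≈ q * q ^ g * q ^ e
        qᵏ = trans (*-congˡ (^-homo-* q g e)) (sym (*-assoc _ _ _))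
        c≈ : - (z * v * q ^ k) ≈ - (z * v * (q * q ^ g * q ^ e))
        c≈ = -‿cong (*-congˡ qᵏ)

    -- The q-Pfaff-Saalschütz sum in homogeneous form, valid also where x or y vanishes. At v = 0 it
    -- becomes q-Vandermonde.
    saalschütz : ∀ k → Bin q k term ≈ shifted q x z k * shifted q 1# (y * v) k
    saalschütz zero    = *-cong (*-identityˡ 1#) (*-identityˡ 1#)
    saalschütz (suc k) = begin
      Bin q k (λ g e → term (suc g) e + q ^ g * term g (suc e))
        ≈⟨ +-cancelʳ (Bin q (suc k) (certificate k)) _ _ (begin
             _ ≈⟨ +-congˡ (Bin-suc′ q k (certificate k)) ⟩
             _ ≈⟨ Bin-+ q k _ _ ⟨
             _ ≈⟨ Bin-cong q k (pointwise k) ⟩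
             _ ≈⟨ Bin-+ q k _ _ ⟩
             _ ∎) ⟩
      Bin q k (λ g e → (x - z * q ^ k) * (1# - y * v * q ^ k) * term g e)
        ≈⟨ Bin-* q k _ _ ⟩
      (x - z * q ^ k) * (1# - y * v * q ^ k) * Bin q k term
        ≈⟨ *-congˡ (saalschütz k) ⟩
      (x - z * q ^ k) * (1# - y * v * q ^ k) * (shifted q x z k * shifted q 1# (y * v) k)
        ≈⟨ solve 4 (λ a b c d → a :* b :* (c :* d) := c :* a :* (d :* b)) refl _ _ _ _ ⟩
      shifted q x z (suc k) * shifted q 1# (y * v) (suc k) ∎

-- Finite sums with conserved totals, and subtraction that vanishes below zero.

-- The indices carry the difference, so that matching replaces n by d + m, or d by n + k + 1, and
-- `⊖-within` or `⊖-beyond` applies directly.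
data Comparison : ℕ → ℕ → Set where
  within : ∀ d m → Comparison d (d ℕ.+ m)
  beyond : ∀ n k → Comparison (suc (n ℕ.+ k)) n

compare : ∀ d n → Comparison d n
compare zero    n       = within zero n
compare (suc d) zero    = beyond zero d
compare (suc d) (suc n) with compare d n
... | within .d m = within (suc d) m
... | beyond .n k = beyond (suc n) k

module FiniteSums {c ℓ} (R : CommutativeRing c ℓ) where

  open CommutativeRing R
  open CommutativeSemigroupProperties +-commutativeSemigroup using (interchange)
  open SetoidReasoning setoid

  -- Summing over pairs with a fixed total, instead of over one index, keeps both parts available as
  -- natural numbers without subtraction.
  Σ+ : ℕ → (ℕ → ℕ → Carrier) → Carrier
  Σ+ zero    F = F 0 0
  Σ+ (suc k) F = F 0 (suc k) + Σ+ k λ d m → F (suc d) m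

  Σ+-cong : ∀ k {F G} → (∀ d m → d ℕ.+ m ≡ k → F d m ≈ G d m) → Σ+ k F ≈ Σ+ k G
  Σ+-cong zero    F≈G = F≈G 0 0 ≡.refl
  Σ+-cong (suc k) F≈G = +-cong (F≈G 0 (suc k) ≡.refl)
    (Σ+-cong k λ d m d+m≡k → F≈G (suc d) m (≡.cong suc d+m≡k))

  Σ+-0 : ∀ k → Σ+ k (λ _ _ → 0#) ≈ 0#
  Σ+-0 zero    = refl
  Σ+-0 (suc k) = trans (+-identityˡ _) (Σ+-0 k)

  Σ+-distrib : ∀ k F G → Σ+ k (λ d m → F d m + G d m) ≈ Σ+ k F + Σ+ k G
  Σ+-distrib zero    F G = refl
  Σ+-distrib (suc k) F G = trans (+-congˡ (Σ+-distrib k _ _)) (interchange _ _ _ _)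

  *-distribˡ-Σ+ : ∀ k a F → a * Σ+ k F ≈ Σ+ k (λ d m → a * F d m)
  *-distribˡ-Σ+ zero    a F = refl
  *-distribˡ-Σ+ (suc k) a F = trans (distribˡ a _ _) (+-congˡ (*-distribˡ-Σ+ k a _))

  Σ+-last : ∀ k F → Σ+ (suc k) F ≈ Σ+ k (λ d m → F d (suc m)) + F (suc k) 0
  Σ+-last zero    F = refl
  Σ+-last (suc k) F = trans (+-congˡ (Σ+-last k λ d m → F (suc d) m)) (sym (+-assoc _ _ _))

  Σ+-flip : ∀ k F → Σ+ k F ≈ Σ+ k (flip F)
  Σ+-flip zero    F = refl
  Σ+-flip (suc k) F = begin
    Σ+ (suc k) F                                   ≈⟨ Σ+-last k F ⟩
    Σ+ k (λ d m → F d (suc m)) + F (suc k) 0       ≈⟨ +-congʳ (Σ+-flip k λ d m → F d (suc m)) ⟩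
    Σ+ k (λ d m → F m (suc d)) + F (suc k) 0       ≈⟨ +-comm _ _ ⟩
    Σ+ (suc k) (flip F)                            ∎

  Σ+-assoc : ∀ k (F : ℕ → ℕ → ℕ → Carrier) →
             Σ+ k (λ f m → Σ+ f λ d g → F d g m) ≈ Σ+ k (λ d f → Σ+ f λ g m → F d g m)
  Σ+-assoc zero    F = refl
  Σ+-assoc (suc k) F = begin
    F 0 0 (suc k) + Σ+ k (λ f m → F 0 (suc f) m + Σ+ f λ d g → F (suc d) g m)
      ≈⟨ +-congˡ (Σ+-distrib k _ _) ⟩
    F 0 0 (suc k) + (Σ+ k (λ f m → F 0 (suc f) m) + Σ+ k (λ f m → Σ+ f λ d g → F (suc d) g m))
      ≈⟨ +-assoc _ _ _ ⟨
    Σ+ (suc k) (F 0) + Σ+ k (λ f m → Σ+ f λ d g → F (suc d) g m)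
      ≈⟨ +-congˡ (Σ+-assoc k λ d g m → F (suc d) g m) ⟩
    Σ+ (suc k) (F 0) + Σ+ k (λ d f → Σ+ f λ g m → F (suc d) g m) ∎

  Σ+-comm : ∀ k l (F : ℕ → ℕ → ℕ → ℕ → Carrier) →
            Σ+ k (λ a b → Σ+ l (F a b)) ≈ Σ+ l (λ c d → Σ+ k λ a b → F a b c d)
  Σ+-comm zero    l F = refl
  Σ+-comm (suc k) l F = trans (+-congˡ (Σ+-comm k l _)) (sym (Σ+-distrib l _ _))

  infixl 8 _⟨_⊖_⟩
  _⟨_⊖_⟩ : (ℕ → Carrier) → ℕ → ℕ → Carrier
  f ⟨ n     ⊖ zero  ⟩ = f n
  f ⟨ zero  ⊖ suc d ⟩ = 0#
  f ⟨ suc n ⊖ suc d ⟩ = f ⟨ n ⊖ d ⟩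

  ⊖-cong : ∀ n d {f g} → (∀ m → d ℕ.+ m ≡ n → f m ≈ g m) → f ⟨ n ⊖ d ⟩ ≈ g ⟨ n ⊖ d ⟩
  ⊖-cong n       zero    f≈g = f≈g n ≡.refl
  ⊖-cong zero    (suc d) f≈g = refl
  ⊖-cong (suc n) (suc d) f≈g = ⊖-cong n d λ m d+m≡n → f≈g m (≡.cong suc d+m≡n)

  ⊖-within : ∀ (f : ℕ → Carrier) d m → f ⟨ d ℕ.+ m ⊖ d ⟩ ≡ f m
  ⊖-within f zero    m = ≡.refl
  ⊖-within f (suc d) m = ⊖-within f d m

  ⊖-beyond : ∀ (f : ℕ → Carrier) n k → f ⟨ n ⊖ suc (n ℕ.+ k) ⟩ ≡ 0#
  ⊖-beyond f zero    k = ≡.refl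
  ⊖-beyond f (suc n) k = ⊖-beyond f n k

  ⊖-0 : ∀ n d → (λ _ → 0#) ⟨ n ⊖ d ⟩ ≈ 0#
  ⊖-0 n       zero    = refl
  ⊖-0 zero    (suc d) = refl
  ⊖-0 (suc n) (suc d) = ⊖-0 n d

  ⊖-* : ∀ (f g : ℕ → Carrier) n d → (λ i → f i * g i) ⟨ n ⊖ d ⟩ ≈ f ⟨ n ⊖ d ⟩ * g (n ∸ d)
  ⊖-* f g n       zero    = refl
  ⊖-* f g zero    (suc d) = sym (zeroˡ _)
  ⊖-* f g (suc n) (suc d) = ⊖-* f g n d

  *-distribˡ-⊖ : ∀ a (f : ℕ → Carrier) n d → a * f ⟨ n ⊖ d ⟩ ≈ (λ i → a * f i) ⟨ n ⊖ d ⟩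
  *-distribˡ-⊖ a f n       zero    = refl
  *-distribˡ-⊖ a f zero    (suc d) = zeroʳ a
  *-distribˡ-⊖ a f (suc n) (suc d) = *-distribˡ-⊖ a f n d

  ⊖-⊖ : ∀ (f : ℕ → Carrier) n d e → f ⟨ n ⊖ d ℕ.+ e ⟩ ≈ (λ i → f ⟨ i ⊖ e ⟩) ⟨ n ⊖ d ⟩
  ⊖-⊖ f n       zero    e = refl
  ⊖-⊖ f zero    (suc d) e = refl
  ⊖-⊖ f (suc n) (suc d) e = ⊖-⊖ f n d e

  Σ+-⊖ : ∀ k n d (F : ℕ → ℕ → ℕ → Carrier) →
         Σ+ k (λ a b → F a b ⟨ n ⊖ d ⟩) ≈ (λ i → Σ+ k λ a b → F a b i) ⟨ n ⊖ d ⟩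
  Σ+-⊖ k n       zero    F = refl
  Σ+-⊖ k zero    (suc d) F = Σ+-0 k
  Σ+-⊖ k (suc n) (suc d) F = Σ+-⊖ k n d F

  -- Only g ≤ δ contributes; there the second index is e + x with g + e = δ. This adjusts the total
  -- of a sum to the range on which it is supported.
  Σ+-truncate : ∀ δ x (h : ℕ → Carrier) (F : ℕ → ℕ → Carrier) →
                Σ+ (δ ℕ.+ x) (λ g m → h ⟨ δ ⊖ g ⟩ * F g m) ≈ Σ+ δ (λ g e → h e * F g (e ℕ.+ x))
  Σ+-truncate zero    zero    h F = refl
  Σ+-truncate zero    (suc x) h F = begin
    h 0 * F 0 (suc x) + Σ+ x (λ g m → 0# * F (suc g) m)
      ≈⟨ +-congˡ (trans (Σ+-cong x λ g m _ → zeroˡ _) (Σ+-0 x)) ⟩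
    h 0 * F 0 (suc x) + 0#   ≈⟨ +-identityʳ _ ⟩
    h 0 * F 0 (suc x)        ∎
  Σ+-truncate (suc δ) x h F = +-congˡ (Σ+-truncate δ x h λ g m → F (suc g) m)

  ⊖-exceeds : ∀ n d → n ℕ.< d → ∀ (f : ℕ → Carrier) → f ⟨ n ⊖ d ⟩ ≡ 0#
  ⊖-exceeds zero    (suc d) _           f = ≡.refl
  ⊖-exceeds (suc n) (suc d) (ℕ.s≤s n<d) f = ⊖-exceeds n d n<d f

  -- Both are the value at the integer x - b = a - d, and both vanish when it is negative.
  ⊖-complement : ∀ (f : ℕ → Carrier) d x b a → d ℕ.+ x ≡ b ℕ.+ a → f ⟨ x ⊖ b ⟩ ≡ f ⟨ a ⊖ d ⟩
  ⊖-complement f d x       zero    a ≡.refl = ≡.sym (⊖-within f d x)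
  ⊖-complement f d zero    (suc b) a d+0≡   = ≡.sym (⊖-exceeds a d
    (ℕ.≤-trans (ℕ.s≤s (ℕ.m≤n+m a b)) (ℕ.≤-reflexive (≡.trans (≡.sym d+0≡) (ℕ.+-identityʳ d)))) f)
  ⊖-complement f d (suc x) (suc b) a d+x≡   =
    ⊖-complement f d x b a (ℕ.suc-injective (≡.trans (≡.sym (ℕ.+-suc d x)) d+x≡))

  -- At a vertex with labels m below, j on the left, k above and l on the right, the number b = m -
  -- l of particles that go straight up equals k - j. Trading l for b makes the summation variable
  -- independent of m.
  ⊖-twist : ∀ (f g : ℕ → Carrier) m j k →
    (λ l → g ⟨ m ⊖ l ⟩ * f l) ⟨ m ℕ.+ j ⊖ k ⟩ ≈ (λ b → g b * f ⟨ m ⊖ b ⟩) ⟨ k ⊖ j ⟩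
  ⊖-twist f g m zero k rewrite ℕ.+-identityʳ m with compare k m
  ... | within .k l = begin
    (λ x → g ⟨ k ℕ.+ l ⊖ x ⟩ * f x) ⟨ k ℕ.+ l ⊖ k ⟩   ≡⟨ ⊖-within _ k l ⟩
    g ⟨ k ℕ.+ l ⊖ l ⟩ * f l                           ≡⟨ ≡.cong (λ i → g ⟨ i ⊖ l ⟩ * f l) (ℕ.+-comm k l) ⟩
    g ⟨ l ℕ.+ k ⊖ l ⟩ * f l                           ≡⟨ ≡.cong₂ _*_ (⊖-within g l k) (≡.sym (⊖-within f k l)) ⟩
    g k * f ⟨ k ℕ.+ l ⊖ k ⟩                           ∎
  ... | beyond .m i = trans (reflexive (⊖-beyond _ m i))
                            (sym (trans (*-congˡ (reflexive (⊖-beyond f m i))) (zeroʳ _)))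
  ⊖-twist f g m (suc j) zero    = trans
    (*-congʳ (reflexive (⊖-exceeds m (m ℕ.+ suc j) (ℕ.m<m+n m (ℕ.s≤s ℕ.z≤n)) g))) (zeroˡ _)
  ⊖-twist f g m (suc j) (suc k) rewrite ℕ.+-suc m j = ⊖-twist f g m j k

  Σ< : ℕ → (ℕ → Carrier) → Carrier
  Σ< zero    f = 0#
  Σ< (suc n) f = f 0 + Σ< n λ m → f (suc m)

  Σ<-cong : ∀ n {f g} → (∀ m → m ℕ.< n → f m ≈ g m) → Σ< n f ≈ Σ< n g
  Σ<-cong zero    f≈g = refl
  Σ<-cong (suc n) f≈g = +-cong (f≈g 0 (ℕ.s≤s ℕ.z≤n)) (Σ<-cong n λ m m<n → f≈g (suc m) (ℕ.s≤s m<n))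

  Σ<-0 : ∀ n → Σ< n (λ _ → 0#) ≈ 0#
  Σ<-0 zero    = refl
  Σ<-0 (suc n) = trans (+-identityˡ _) (Σ<-0 n)

  Σ<-distrib : ∀ n f g → Σ< n (λ m → f m + g m) ≈ Σ< n f + Σ< n g
  Σ<-distrib zero    f g = sym (+-identityˡ _)
  Σ<-distrib (suc n) f g = trans (+-congˡ (Σ<-distrib n _ _)) (interchange _ _ _ _)

  *-distribˡ-Σ< : ∀ n a f → a * Σ< n f ≈ Σ< n (λ m → a * f m)
  *-distribˡ-Σ< zero    a f = zeroʳ a
  *-distribˡ-Σ< (suc n) a f = trans (distribˡ a _ _) (+-congˡ (*-distribˡ-Σ< n a _))

  Σ<-comm : ∀ n k (F : ℕ → ℕ → Carrier) → Σ< n (λ a → Σ< k (F a)) ≈ Σ< k (λ b → Σ< n λ a → F a b)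
  Σ<-comm zero    k F = sym (Σ<-0 k)
  Σ<-comm (suc n) k F = trans (+-congˡ (Σ<-comm n k _)) (sym (Σ<-distrib k _ _))

  Σ<-extend : ∀ n k f → (∀ m → n ℕ.≤ m → f m ≈ 0#) → Σ< (n ℕ.+ k) f ≈ Σ< n f
  Σ<-extend zero    k f f≈0 = trans (Σ<-cong k λ m _ → f≈0 m ℕ.z≤n) (Σ<-0 k)
  Σ<-extend (suc n) k f f≈0 = +-congˡ (Σ<-extend n k _ λ m n≤m → f≈0 (suc m) (ℕ.s≤s n≤m))

  Σ<-⊖ : ∀ a n (F : ℕ → ℕ → Carrier) → Σ< (a ℕ.+ n) (λ m → F m ⟨ m ⊖ a ⟩) ≈ Σ< n (λ i → F (a ℕ.+ i) i)
  Σ<-⊖ zero    n F = refl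
  Σ<-⊖ (suc a) n F = trans (+-identityˡ _) (Σ<-⊖ a n λ m → F (suc m))

  Σ<⇒Σ+ : ∀ k (F : ℕ → ℕ → Carrier) → Σ< (suc k) (λ d → F d ⟨ k ⊖ d ⟩) ≈ Σ+ k F
  Σ<⇒Σ+ zero    F = +-identityʳ _
  Σ<⇒Σ+ (suc k) F = +-congˡ (Σ<⇒Σ+ k λ d → F (suc d))

  Σ<-single : ∀ n x f → x ℕ.< n → (∀ m → ¬ m ≡ x → f m ≈ 0#) → Σ< n f ≈ f x
  Σ<-single (suc n) zero    f _           f≈0 = trans
    (+-congˡ (trans (Σ<-cong n λ m _ → f≈0 (suc m) λ ()) (Σ<-0 n))) (+-identityʳ _)
  Σ<-single (suc n) (suc x) f (ℕ.s≤s x<n) f≈0 = trans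
    (+-cong (f≈0 0 λ ()) (Σ<-single n x _ x<n λ m m≢x → f≈0 (suc m) λ eq → m≢x (ℕ.suc-injective eq)))
    (+-identityˡ _)

  -- At a vertex with i below and a on the left, i splits into l moving right and i′ going up, and
  -- the top label is m = i′ + a. The sum over m thus becomes one over the splittings of i; the
  -- hypothesis on `F` makes the cut-off N harmless.
  Σ<-column : ∀ N i a (g : ℕ → Carrier) (F : ℕ → ℕ → Carrier) →
    (∀ m l → N ℕ.≤ m → l ℕ.+ m ≡ i ℕ.+ a → F m l ≈ 0#) →
    Σ< N (λ m → (λ l → g ⟨ i ⊖ l ⟩ * F m l) ⟨ i ℕ.+ a ⊖ m ⟩) ≈ Σ+ i (λ l i′ → g i′ * F (i′ ℕ.+ a) l)
  Σ<-column N i a g F F≈0 = begin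
    Σ< N (λ m → (λ l → g ⟨ i ⊖ l ⟩ * F m l) ⟨ i ℕ.+ a ⊖ m ⟩)
      -- The range is enlarged to N + a + i + 1, which covers the cut-off as well as every m up to a
      -- + i; afterwards a is removed from below and the surplus N from above.
      ≈⟨ Σ<-extend N (a ℕ.+ suc i) _ (λ m N≤m → trans (⊖-cong (i ℕ.+ a) m λ l m+l≡ →
           trans (*-congˡ (F≈0 m l N≤m (≡.trans (ℕ.+-comm l m) m+l≡))) (zeroʳ (g ⟨ i ⊖ l ⟩))) (⊖-0 (i ℕ.+ a) m)) ⟨
    Σ< (N ℕ.+ (a ℕ.+ suc i)) (λ m → (λ l → g ⟨ i ⊖ l ⟩ * F m l) ⟨ i ℕ.+ a ⊖ m ⟩)
      ≡⟨ ≡.cong (λ n → Σ< n λ m → (λ l → g ⟨ i ⊖ l ⟩ * F m l) ⟨ i ℕ.+ a ⊖ m ⟩)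
           (≡.trans (ℕ.+-comm N _) (ℕ.+-assoc a (suc i) N)) ⟩
    Σ< (a ℕ.+ (suc i ℕ.+ N)) (λ m → (λ l → g ⟨ i ⊖ l ⟩ * F m l) ⟨ i ℕ.+ a ⊖ m ⟩)
      ≈⟨ Σ<-cong (a ℕ.+ (suc i ℕ.+ N)) (λ m _ → ⊖-twist (F m) g i a m) ⟩
    Σ< (a ℕ.+ (suc i ℕ.+ N)) (λ m → (λ i′ → g i′ * F m ⟨ i ⊖ i′ ⟩) ⟨ m ⊖ a ⟩)
      ≈⟨ Σ<-⊖ a _ _ ⟩
    Σ< (suc i ℕ.+ N) (λ i′ → g i′ * F (a ℕ.+ i′) ⟨ i ⊖ i′ ⟩)
      ≈⟨ Σ<-extend (suc i) N _ (λ i′ i<i′ → trans (*-congˡ (reflexive (⊖-exceeds i i′ i<i′ (F (a ℕ.+ i′))))) (zeroʳ (g i′))) ⟩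
    Σ< (suc i) (λ i′ → g i′ * F (a ℕ.+ i′) ⟨ i ⊖ i′ ⟩)
      ≈⟨ Σ<-cong (suc i) (λ i′ _ → *-distribˡ-⊖ (g i′) (F (a ℕ.+ i′)) i i′) ⟩
    Σ< (suc i) (λ i′ → (λ l → g i′ * F (a ℕ.+ i′) l) ⟨ i ⊖ i′ ⟩)
      ≈⟨ Σ<⇒Σ+ i (λ i′ l → g i′ * F (a ℕ.+ i′) l) ⟩
    Σ+ i (λ i′ l → g i′ * F (a ℕ.+ i′) l)
      ≈⟨ Σ+-flip i _ ⟩
    Σ+ i (λ l i′ → g i′ * F (a ℕ.+ i′) l)
      ≈⟨ (Σ+-cong i λ l i′ _ → reflexive (≡.cong (λ n → g i′ * F n l) (ℕ.+-comm a i′))) ⟩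
    Σ+ i (λ l i′ → g i′ * F (i′ ℕ.+ a) l) ∎

  Σ<-square : ∀ N J (F : ℕ → ℕ → Carrier) → J ℕ.< N → (∀ a b → ¬ a ℕ.+ b ≡ J → F a b ≈ 0#) →
              Σ< N (λ a → Σ< N (F a)) ≈ Σ+ J F
  Σ<-square N J F J<N F≈0 with k , ≡.refl ← ℕ.m≤n⇒∃[o]m+o≡n J<N = begin
    Σ< N (λ a → Σ< N (F a))           ≈⟨ Σ<-cong N (λ a _ → line a) ⟩
    Σ< N (λ a → F a ⟨ J ⊖ a ⟩)
      ≈⟨ Σ<-extend (suc J) k _ (λ a J<a → reflexive (⊖-exceeds J a J<a (F a))) ⟩
    Σ< (suc J) (λ a → F a ⟨ J ⊖ a ⟩)              ≈⟨ Σ<⇒Σ+ J F ⟩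
    Σ+ J F                                        ∎
    where
    line : ∀ a → Σ< N (F a) ≈ F a ⟨ J ⊖ a ⟩
    line a with compare a J
    ... | within .a m = trans
      (Σ<-single N m (F a) (ℕ.≤-<-trans (ℕ.m≤n+m m a) J<N)
        λ b b≢m → F≈0 a b λ a+b≡ → b≢m (ℕ.+-cancelˡ-≡ a b m a+b≡))
      (sym (reflexive (⊖-within (F a) a m)))
    ... | beyond .J i = trans
      (trans (Σ<-cong N λ b _ → F≈0 (suc (J ℕ.+ i)) b λ eq →
         ℕ.<-irrefl (≡.sym eq) (ℕ.s≤s (ℕ.≤-trans (ℕ.m≤m+n J i) (ℕ.m≤m+n (J ℕ.+ i) b)))) (Σ<-0 N))
      (sym (reflexive (⊖-beyond (F (suc (J ℕ.+ i))) J i)))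

-- Sears' transformation and the exchange relation of one column.

module QFactorials {c ℓ} (R : CommutativeRing c ℓ) where

  open CommutativeRing R
  open QBinomial R
  open FiniteSums R
  open RawSemiringDefinitions (Semiring.rawSemiring semiring) using (_^_)
  open SemiringExp semiring using (^-homo-*; ^-assocʳ)
  open IntegerSolver R
  open SetoidReasoning setoid

  module Reciprocals
    (q r : Carrier) (rq≈1 : r * q ≈ 1#)
    (q!⁻¹ : ℕ → Carrier) (q!-inverse : ∀ n → shifted q 1# q n * q!⁻¹ n ≈ 1#) where

    q! : ℕ → Carrier
    q! = shifted q 1# q

    q!⁻¹-suc : ∀ n → (1# - q ^ suc n) * q!⁻¹ (suc n) ≈ q!⁻¹ n
    q!⁻¹-suc n = begin
      (1# - q ^ suc n) * q!⁻¹ (suc n)                       ≈⟨ *-identityˡ _ ⟨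
      1# * ((1# - q ^ suc n) * q!⁻¹ (suc n))                ≈⟨ *-congʳ (q!-inverse n) ⟨
      q! n * q!⁻¹ n * ((1# - q ^ suc n) * q!⁻¹ (suc n))
        ≈⟨ solve 4 (λ a b c d → a :* b :* (c :* d) := b :* (a :* c :* d)) refl _ _ _ _ ⟩
      q!⁻¹ n * (q! (suc n) * q!⁻¹ (suc n))                  ≈⟨ *-congˡ (q!-inverse (suc n)) ⟩
      q!⁻¹ n * 1#                                           ≈⟨ *-identityʳ _ ⟩
      q!⁻¹ n                                                ∎

    private
      divided : ℕ → (ℕ → ℕ → Carrier) → Carrier
      divided k F = Σ+ k λ g e → q!⁻¹ g * q!⁻¹ e * F g e

    -- 1 − q^{g+e} = (1 − q^g) + q^g (1 − q^e)
    divided-suc : ∀ k F → (1# - q ^ suc k) * divided (suc k) F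
                        ≈ divided k (λ g e → F (suc g) e + q ^ g * F g (suc e))
    divided-suc k F = begin
      (1# - q ^ suc k) * divided (suc k) F
        ≈⟨ *-distribˡ-Σ+ (suc k) _ (λ g e → q!⁻¹ g * q!⁻¹ e * F g e) ⟩
      Σ+ (suc k) (λ g e → (1# - q ^ suc k) * (q!⁻¹ g * q!⁻¹ e * F g e))
        ≈⟨ (Σ+-cong (suc k) λ g e g+e≡ → trans
             (*-congʳ (+-congˡ (-‿cong (trans (reflexive (≡.cong (q ^_) (≡.sym g+e≡))) (^-homo-* q g e)))))
             (solve 5 (λ a b c d f → (:1 :- a :* b) :* (c :* d :* f)
                := ((:1 :- a) :* c) :* d :* f :+ a :* (c :* ((:1 :- b) :* d) :* f)) refl
                (q ^ g) (q ^ e) (q!⁻¹ g) (q!⁻¹ e) (F g e))) ⟩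
      Σ+ (suc k) (λ g e → A g e + B g e)
        ≈⟨ Σ+-distrib (suc k) A B ⟩
      Σ+ (suc k) A + Σ+ (suc k) B
        ≈⟨ +-congˡ (Σ+-last k B) ⟩
      (A 0 (suc k) + Σ+ k (λ g e → A (suc g) e)) + (Σ+ k (λ g e → B g (suc e)) + B (suc k) 0)
        ≈⟨ +-cong (trans (+-congʳ (solve 3 (λ a b c → (:1 :- :1) :* a :* b :* c := :0) refl _ _ _)) (+-identityˡ _))
                  (trans (+-congˡ (solve 4 (λ x a b c → x :* (a :* ((:1 :- :1) :* b) :* c) := :0) refl _ _ _ _)) (+-identityʳ _)) ⟩
      Σ+ k (λ g e → A (suc g) e) + Σ+ k (λ g e → B g (suc e))
        ≈⟨ Σ+-distrib k _ _ ⟨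
      Σ+ k (λ g e → A (suc g) e + B g (suc e))
        ≈⟨ (Σ+-cong k λ g e _ → trans
             (+-cong (*-congʳ (*-congʳ (q!⁻¹-suc g))) (*-congˡ (*-congʳ (*-congˡ (q!⁻¹-suc e)))))
             (solve 5 (λ a b x y z → a :* b :* x :+ z :* (a :* b :* y) := a :* b :* (x :+ z :* y))
               refl (q!⁻¹ g) (q!⁻¹ e) (F (suc g) e) (F g (suc e)) (q ^ g))) ⟩
      divided k (λ g e → F (suc g) e + q ^ g * F g (suc e)) ∎
      where
      A B : ℕ → ℕ → Carrier
      A g e = ((1# - q ^ g) * q!⁻¹ g) * q!⁻¹ e * F g e
      B g e = q ^ g * (q!⁻¹ g * ((1# - q ^ e) * q!⁻¹ e) * F g e)

    -- By `divided-suc` the divided sum obeys the q-Pascal recursion up to 1 - q^{k+1}, which is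
    -- exactly what `q!` gains from k to k + 1.
    Bin≈Σ+ : ∀ k F → Bin q k F ≈ q! k * Σ+ k (λ g e → q!⁻¹ g * q!⁻¹ e * F g e)
    Bin≈Σ+ zero F = sym (begin
      1# * (q!⁻¹ 0 * q!⁻¹ 0 * F 0 0)   ≈⟨ *-congˡ (*-congʳ (*-cong q!⁻¹0≈1 q!⁻¹0≈1)) ⟩
      1# * (1# * 1# * F 0 0)           ≈⟨ solve 1 (λ f → :1 :* (:1 :* :1 :* f) := f) refl _ ⟩
      F 0 0                            ∎)
      where q!⁻¹0≈1 = trans (sym (*-identityˡ _)) (q!-inverse 0)
    Bin≈Σ+ (suc k) F = begin
      Bin q (suc k) F                                ≈⟨ Bin≈Σ+ k _ ⟩
      q! k * divided k (λ g e → F (suc g) e + q ^ g * F g (suc e))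
                                                     ≈⟨ *-congˡ (divided-suc k F) ⟨
      q! k * ((1# - q ^ suc k) * divided (suc k) F)  ≈⟨ *-assoc _ _ _ ⟨
      q! (suc k) * divided (suc k) F                 ∎

    rᵍqᵍ≈1 : ∀ g → r ^ g * q ^ g ≈ 1#
    rᵍqᵍ≈1 zero    = *-identityˡ 1#
    rᵍqᵍ≈1 (suc g) = begin
      r * r ^ g * (q * q ^ g)     ≈⟨ solve 4 (λ a b c d → a :* b :* (c :* d) := (a :* c) :* (b :* d)) refl _ _ _ _ ⟩
      (r * q) * (r ^ g * q ^ g)   ≈⟨ *-cong rq≈1 (rᵍqᵍ≈1 g) ⟩
      1# * 1#                     ≈⟨ *-identityˡ 1# ⟩
      1#                          ∎

    -- The factor r^{ge} turns the rule of `Bin-suc′` in base r into the defining rule of `Bin` in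
    -- base q.
    Bin-base-inverse : ∀ k F → Bin r k F ≈ Bin q k (λ g e → r ^ (g ℕ.* e) * F g e)
    Bin-base-inverse zero    F = sym (*-identityˡ _)
    Bin-base-inverse (suc k) F = begin
      Bin r (suc k) F
        ≈⟨ Bin-suc′ r k F ⟩
      Bin r k (λ g e → r ^ e * F (suc g) e + F g (suc e))
        ≈⟨ Bin-base-inverse k _ ⟩
      Bin q k (λ g e → r ^ (g ℕ.* e) * (r ^ e * F (suc g) e + F g (suc e)))
        ≈⟨ (Bin-cong q k λ g e _ → begin
             r ^ (g ℕ.* e) * (r ^ e * F (suc g) e + F g (suc e))
               ≈⟨ *-congˡ (+-congˡ (trans (sym (*-identityˡ _)) (*-congʳ (sym (rᵍqᵍ≈1 g))))) ⟩
             r ^ (g ℕ.* e) * (r ^ e * F (suc g) e + r ^ g * q ^ g * F g (suc e))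
               ≈⟨ solve 6 (λ a b c d x y → a :* (b :* x :+ c :* d :* y)
                          := (b :* a) :* x :+ d :* ((c :* a) :* y))
                    refl (r ^ (g ℕ.* e)) (r ^ e) (r ^ g) (q ^ g) _ _ ⟩
             (r ^ e * r ^ (g ℕ.* e)) * F (suc g) e + q ^ g * ((r ^ g * r ^ (g ℕ.* e)) * F g (suc e))
               ≈⟨ +-cong (*-congʳ (sym (^-homo-* r e (g ℕ.* e))))
                         (*-congˡ (*-congʳ (trans (sym (^-homo-* r g (g ℕ.* e)))
                            (reflexive (≡.cong (r ^_) (≡.sym (ℕ.*-suc g e))))))) ⟩
             r ^ (suc g ℕ.* e) * F (suc g) e + q ^ g * (r ^ (g ℕ.* suc e) * F g (suc e)) ∎) ⟩
      Bin q (suc k) (λ g e → r ^ (g ℕ.* e) * F g e) ∎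

    -- (q;q)_b/(q;q)_{b−f}, and 0 if f > b
    falling : ℕ → ℕ → Carrier
    falling b f = q! b * q!⁻¹ ⟨ b ⊖ f ⟩

    -- The factors 1 - q^b, 1 - q^{b-1}, ... descend, so base 1/q is the natural one for falling
    -- q-factorials. For f > b a factor 1 - 1 occurs, in agreement with the zero of `falling`.
    falling≈shifted : ∀ b f → falling b f ≈ shifted r 1# (q ^ b) f
    falling≈shifted b       zero    = q!-inverse b
    falling≈shifted zero    (suc f) = begin
      1# * 0#                                     ≈⟨ zeroʳ 1# ⟩
      0#                                          ≈⟨ zeroˡ _ ⟨
      0# * shifted r 1# (1# * r) f                ≈⟨ *-congʳ (-‿inverseʳ 1#) ⟨
      (1# - 1#) * shifted r 1# (1# * r) f         ≈⟨ shifted-head r 1# 1# f ⟨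
      shifted r 1# 1# (suc f)                     ∎
    falling≈shifted (suc b) (suc f) = begin
      q! b * (1# - q ^ suc b) * q!⁻¹ ⟨ b ⊖ f ⟩
        ≈⟨ solve 3 (λ a b c → a :* b :* c := b :* (a :* c)) refl _ _ _ ⟩
      (1# - q ^ suc b) * falling b f
        ≈⟨ *-congˡ (falling≈shifted b f) ⟩
      (1# - q ^ suc b) * shifted r 1# (q ^ b) f
        ≈⟨ *-congˡ (shifted-cong r f refl (sym (begin
             q * q ^ b * r      ≈⟨ solve 3 (λ a b c → a :* b :* c := c :* a :* b) refl _ _ _ ⟩
             r * q * q ^ b      ≈⟨ *-congʳ rq≈1 ⟩
             1# * q ^ b         ≈⟨ *-identityˡ _ ⟩
             q ^ b              ∎))) ⟩
      (1# - q ^ suc b) * shifted r 1# (q ^ suc b * r) f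
        ≈⟨ shifted-head r 1# (q ^ suc b) f ⟨
      shifted r 1# (q ^ suc b) (suc f) ∎

    q!-+ : ∀ d m → q! m * shifted r 1# (q ^ (d ℕ.+ m)) d ≈ q! (d ℕ.+ m)
    q!-+ d m = begin
      q! m * shifted r 1# (q ^ (d ℕ.+ m)) d            ≈⟨ *-congˡ (falling≈shifted (d ℕ.+ m) d) ⟨
      q! m * (q! (d ℕ.+ m) * q!⁻¹ ⟨ d ℕ.+ m ⊖ d ⟩)     ≡⟨ ≡.cong (λ x → q! m * (q! (d ℕ.+ m) * x)) (⊖-within q!⁻¹ d m) ⟩
      q! m * (q! (d ℕ.+ m) * q!⁻¹ m)                   ≈⟨ solve 3 (λ a b c → a :* (b :* c) := b :* (a :* c)) refl _ _ _ ⟩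
      q! (d ℕ.+ m) * (q! m * q!⁻¹ m)                   ≈⟨ *-congˡ (q!-inverse m) ⟩
      q! (d ℕ.+ m) * 1#                                ≈⟨ *-identityʳ _ ⟩
      q! (d ℕ.+ m)                                     ∎

    -- Saalschütz in base 1/q with x = 1, y = q^δ, z = q^{n+δ}, v = q^a. Because f + m = n + a + δ,
    -- the last Pochhammer symbol of each term is (q;q)_{g+m}/(q;q)_m. The expansion lowers n + δ
    -- and a + δ to n and a at the price of the sum over g.
    falling-expansion : ∀ n a δ f m → f ℕ.+ m ≡ n ℕ.+ a ℕ.+ δ →
      q! m * q!⁻¹ f * (falling (n ℕ.+ δ) f * falling (a ℕ.+ δ) f)
      ≈ Σ+ f (λ d g → q!⁻¹ d * falling n d * falling a d * q! (g ℕ.+ m)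
                      * (q!⁻¹ g * falling δ g * (r ^ (g ℕ.* d) * (q ^ δ) ^ d)))
    falling-expansion n a δ f m f+m≡ = begin
      q! m * q!⁻¹ f * (falling (n ℕ.+ δ) f * falling (a ℕ.+ δ) f)
        ≈⟨ *-congˡ (*-cong (falling≈shifted (n ℕ.+ δ) f)
             (trans (falling≈shifted (a ℕ.+ δ) f)
                    (shifted-cong r f refl (trans (^-homo-* q a δ) (*-comm _ _))))) ⟩
      q! m * q!⁻¹ f * (shifted r 1# (q ^ (n ℕ.+ δ)) f * shifted r 1# (q ^ δ * q ^ a) f)
        ≈⟨ *-congˡ (saalschütz r 1# (q ^ δ) (q ^ (n ℕ.+ δ)) (q ^ a) f) ⟨
      q! m * q!⁻¹ f * Bin r f T
        ≈⟨ *-congˡ (trans (Bin-base-inverse f T) (Bin≈Σ+ f _)) ⟩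
      q! m * q!⁻¹ f * (q! f * Σ+ f U)
        ≈⟨ solve 4 (λ a b c d → a :* b :* (c :* d) := (c :* b) :* (a :* d)) refl _ _ _ _ ⟩
      (q! f * q!⁻¹ f) * (q! m * Σ+ f U)
        ≈⟨ trans (*-congʳ (q!-inverse f)) (*-identityˡ _) ⟩
      q! m * Σ+ f U
        ≈⟨ *-distribˡ-Σ+ f _ U ⟩
      Σ+ f (λ g d → q! m * U g d)
        ≈⟨ Σ+-flip f _ ⟩
      Σ+ f (λ d g → q! m * U g d)
        ≈⟨ Σ+-cong f summand ⟩
      _ ∎
      where
      T U : ℕ → ℕ → Carrier
      T g d = shifted r 1# (q ^ δ) g * shifted r (q ^ δ) (q ^ (n ℕ.+ δ)) d
            * (shifted r 1# (1# * q ^ a) d * shifted r 1# (q ^ (n ℕ.+ δ) * q ^ a * r ^ d) g)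
      U g d = q!⁻¹ g * q!⁻¹ d * (r ^ (g ℕ.* d) * T g d)

      cancel : ∀ d x → x * q ^ d * r ^ d ≈ x
      cancel zero    x = trans (*-identityʳ _) (*-identityʳ _)
      cancel (suc d) x = begin
        x * (q * q ^ d) * (r * r ^ d)   ≈⟨ solve 5 (λ x a b c d → x :* (a :* b) :* (c :* d) := (c :* a) :* (x :* b :* d)) refl _ _ _ _ _ ⟩
        (r * q) * (x * q ^ d * r ^ d)   ≈⟨ *-cong rq≈1 (cancel d x) ⟩
        1# * x                          ≈⟨ *-identityˡ x ⟩
        x                               ∎

      summand : ∀ d g → d ℕ.+ g ≡ f → q! m * U g d ≈
        q!⁻¹ d * falling n d * falling a d * q! (g ℕ.+ m) * (q!⁻¹ g * falling δ g * (r ^ (g ℕ.* d) * (q ^ δ) ^ d))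
      summand d g d+g≡f = begin
        q! m * U g d
          ≈⟨ *-congˡ (*-congˡ (*-congˡ (*-cong (*-cong (sym (falling≈shifted δ g)) t₁) (*-cong t₂ t₃)))) ⟩
        q! m * (q!⁻¹ g * q!⁻¹ d * (r ^ (g ℕ.* d) * (falling δ g * ((q ^ δ) ^ d * falling n d)
               * (falling a d * shifted r 1# (q ^ (g ℕ.+ m)) g))))
          ≈⟨ solve 9 (λ qm ig id rgd fδ qδ fn fa s →
               qm :* (ig :* id :* (rgd :* (fδ :* (qδ :* fn) :* (fa :* s))))
               := id :* fn :* fa :* (qm :* s) :* (ig :* fδ :* (rgd :* qδ))) refl _ _ _ _ _ _ _ _ _ ⟩
        q!⁻¹ d * falling n d * falling a d * (q! m * shifted r 1# (q ^ (g ℕ.+ m)) g)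
          * (q!⁻¹ g * falling δ g * (r ^ (g ℕ.* d) * (q ^ δ) ^ d))
          ≈⟨ *-congʳ (*-congˡ (q!-+ g m)) ⟩
        _ ∎
        where
        t₁ : shifted r (q ^ δ) (q ^ (n ℕ.+ δ)) d ≈ (q ^ δ) ^ d * falling n d
        t₁ = begin
          shifted r (q ^ δ) (q ^ (n ℕ.+ δ)) d
            ≈⟨ shifted-cong r d (sym (*-identityʳ _)) (trans (^-homo-* q n δ) (*-comm _ _)) ⟩
          shifted r (q ^ δ * 1#) (q ^ δ * q ^ n) d
            ≈⟨ shifted-scale r (q ^ δ) 1# (q ^ n) d ⟩
          (q ^ δ) ^ d * shifted r 1# (q ^ n) d
            ≈⟨ *-congˡ (falling≈shifted n d) ⟨
          (q ^ δ) ^ d * falling n d ∎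
        t₂ = trans (shifted-cong r d refl (*-identityˡ _)) (sym (falling≈shifted a d))
        exponents : n ℕ.+ δ ℕ.+ a ≡ g ℕ.+ m ℕ.+ d
        exponents = ≡.trans (ℕ.+-assoc n δ a) (≡.trans (≡.cong (n ℕ.+_) (ℕ.+-comm δ a))
          (≡.trans (≡.sym (ℕ.+-assoc n a δ)) (≡.trans (≡.sym f+m≡) (≡.trans (≡.cong (ℕ._+ m) (≡.sym d+g≡f))
          (≡.trans (ℕ.+-assoc d g m) (ℕ.+-comm d (g ℕ.+ m)))))))
        t₃ : shifted r 1# (q ^ (n ℕ.+ δ) * q ^ a * r ^ d) g ≈ shifted r 1# (q ^ (g ℕ.+ m)) g
        t₃ = shifted-cong r g refl (begin
          q ^ (n ℕ.+ δ) * q ^ a * r ^ d     ≈⟨ *-congʳ (^-homo-* q (n ℕ.+ δ) a) ⟨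
          q ^ (n ℕ.+ δ ℕ.+ a) * r ^ d       ≡⟨ ≡.cong (λ i → q ^ i * r ^ d) exponents ⟩
          q ^ (g ℕ.+ m ℕ.+ d) * r ^ d       ≈⟨ *-congʳ (^-homo-* q (g ℕ.+ m) d) ⟩
          q ^ (g ℕ.+ m) * q ^ d * r ^ d     ≈⟨ cancel d _ ⟩
          q ^ (g ℕ.+ m)                     ∎)

    -- (κu;q)_i/(q;q)_i,  κ^l (p/κ;q)_l/(q;q)_l  and  κ′^d (κ/κ′;q)_d/(q;q)_d
    stay jump transfer : Carrier → Carrier → ℕ → Carrier
    stay u κ i        = q!⁻¹ i * shifted q 1# (κ * u) i
    jump p κ l        = q!⁻¹ l * shifted q κ p l
    transfer κ κ′ d   = q!⁻¹ d * shifted q κ′ κ d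

    -- The factor of a vertex weight that depends on the bottom label m alone: (q;q)_m/(s²;q)_m,
    -- with `D⁻¹` in the role of 1/(s²;q)_m.
    weight : (ℕ → Carrier) → ℕ → Carrier
    weight D⁻¹ m = q! m * D⁻¹ m

    module Vertex (p u : Carrier) (D⁻¹ : ℕ → Carrier)
                  (D-inverse : ∀ n → shifted q 1# (p * u) n * D⁻¹ n ≈ 1#) where

      module _ (κ κ′ : Carrier) where

        exchangeSum : (N n a : ℕ) → Carrier
        exchangeSum N n a = Σ+ N λ d m →
          transfer κ κ′ d * weight D⁻¹ m * (stay u κ′ ⟨ n ⊖ d ⟩ * jump p κ ⟨ a ⊖ d ⟩)

        private
          S X Y : ℕ → Carrier
          S = shifted q κ′ κ
          X = shifted q 1# (κ′ * u)
          Y = shifted q κ p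

        D⁻¹-+ : ∀ x e g → D⁻¹ (e ℕ.+ x) ≈ D⁻¹ (g ℕ.+ (e ℕ.+ x)) * shifted q 1# (p * u * q ^ (e ℕ.+ x)) g
        D⁻¹-+ x e g = begin
          D⁻¹ (e ℕ.+ x)
            ≈⟨ trans (sym (*-identityʳ _)) (*-congˡ (sym (D-inverse (g ℕ.+ (e ℕ.+ x))))) ⟩
          D⁻¹ (e ℕ.+ x) * (D (g ℕ.+ (e ℕ.+ x)) * D⁻¹ (g ℕ.+ (e ℕ.+ x)))
            ≈⟨ *-congˡ (*-congʳ (trans (reflexive (≡.cong D (ℕ.+-comm g (e ℕ.+ x)))) (shifted-+ q 1# (p * u) (e ℕ.+ x) g))) ⟩
          D⁻¹ (e ℕ.+ x) * (D (e ℕ.+ x) * shifted q 1# (p * u * q ^ (e ℕ.+ x)) g * D⁻¹ (g ℕ.+ (e ℕ.+ x)))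
            ≈⟨ solve 4 (λ a b c d → a :* (b :* c :* d) := (b :* a) :* (d :* c)) refl _ _ _ _ ⟩
          D (e ℕ.+ x) * D⁻¹ (e ℕ.+ x) * (D⁻¹ (g ℕ.+ (e ℕ.+ x)) * shifted q 1# (p * u * q ^ (e ℕ.+ x)) g)
            ≈⟨ trans (*-congʳ (D-inverse _)) (*-identityˡ _) ⟩
          _ ∎
          where D = shifted q 1# (p * u)

        r-q-power : ∀ d g e → r ^ (g ℕ.* d) * (q ^ (g ℕ.+ e)) ^ d ≈ (q ^ d) ^ e
        r-q-power d g e = begin
          r ^ (g ℕ.* d) * (q ^ (g ℕ.+ e)) ^ d          ≈⟨ *-congˡ (^-assocʳ q (g ℕ.+ e) d) ⟩
          r ^ (g ℕ.* d) * q ^ ((g ℕ.+ e) ℕ.* d)        ≡⟨ ≡.cong (λ i → r ^ (g ℕ.* d) * q ^ i) (ℕ.*-distribʳ-+ d g e) ⟩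
          r ^ (g ℕ.* d) * q ^ (g ℕ.* d ℕ.+ e ℕ.* d)    ≈⟨ *-congˡ (^-homo-* q (g ℕ.* d) (e ℕ.* d)) ⟩
          r ^ (g ℕ.* d) * (q ^ (g ℕ.* d) * q ^ (e ℕ.* d))  ≈⟨ *-assoc _ _ _ ⟨
          r ^ (g ℕ.* d) * q ^ (g ℕ.* d) * q ^ (e ℕ.* d)    ≈⟨ trans (*-congʳ (rᵍqᵍ≈1 (g ℕ.* d))) (*-identityˡ _) ⟩
          q ^ (e ℕ.* d)                                ≡⟨ ≡.cong (q ^_) (ℕ.*-comm e d) ⟩
          q ^ (d ℕ.* e)                                ≈⟨ ^-assocʳ q d e ⟨
          (q ^ d) ^ e                                  ∎

        -- After `falling-expansion` with f = d + g this is the sum over g for fixed d.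
        inner : ∀ δ d n′ a′ → let x = n′ ℕ.+ a′ ℕ.+ d in
          Σ+ (δ ℕ.+ x) (λ g m → falling δ g * (q!⁻¹ g * (r ^ (g ℕ.* d) * (q ^ δ) ^ d)
             * (D⁻¹ m * S (d ℕ.+ g) * (X (d ℕ.+ n′ ℕ.+ δ ∸ (d ℕ.+ g)) * Y (d ℕ.+ a′ ℕ.+ δ ∸ (d ℕ.+ g))))))
          ≈ D⁻¹ (δ ℕ.+ x) * S d * (X n′ * Y a′)
            * (shifted q κ′ (p * q ^ (d ℕ.+ a′)) δ * shifted q 1# (κ * u * q ^ (d ℕ.+ n′)) δ)
        inner δ d n′ a′ = begin
          Σ+ (δ ℕ.+ x) (λ g m → falling δ g * K g m)
            ≈⟨ (Σ+-cong (δ ℕ.+ x) λ g m _ → solve 3 (λ a b c → a :* b :* c := b :* (a :* c)) refl _ _ _) ⟩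
          Σ+ (δ ℕ.+ x) (λ g m → q!⁻¹ ⟨ δ ⊖ g ⟩ * (q! δ * K g m))
            ≈⟨ Σ+-truncate δ x q!⁻¹ (λ g m → q! δ * K g m) ⟩
          Σ+ δ (λ g e → q!⁻¹ e * (q! δ * K g (e ℕ.+ x)))
            ≈⟨ Σ+-cong δ summand ⟩
          Σ+ δ (λ g e → C * q! δ * (q!⁻¹ g * q!⁻¹ e * T g e))
            ≈⟨ *-distribˡ-Σ+ δ _ (λ g e → q!⁻¹ g * q!⁻¹ e * T g e) ⟨
          C * q! δ * Σ+ δ (λ g e → q!⁻¹ g * q!⁻¹ e * T g e)
            ≈⟨ *-assoc _ _ _ ⟩
          C * (q! δ * Σ+ δ (λ g e → q!⁻¹ g * q!⁻¹ e * T g e))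
            ≈⟨ *-congˡ (Bin≈Σ+ δ T) ⟨
          C * Bin q δ T
            -- The second argument carries q^d and z carries q^{d+a′}: this absorbs the power
            -- (q^d)^e that the change of base leaves behind.
            ≈⟨ *-congˡ (saalschütz q κ′ (κ * q ^ d) z v δ) ⟩
          C * (shifted q κ′ z δ * shifted q 1# (κ * q ^ d * v) δ)
            ≈⟨ *-congˡ (*-congˡ (shifted-cong q δ refl (trans
                 (solve 4 (λ a b c e → a :* b :* (c :* e) := a :* c :* (b :* e)) refl κ (q ^ d) u (q ^ n′))
                 (*-congˡ (sym (^-homo-* q d n′)))))) ⟩
          C * (shifted q κ′ z δ * shifted q 1# (κ * u * q ^ (d ℕ.+ n′)) δ) ∎
          where
          x = n′ ℕ.+ a′ ℕ.+ d
          z = p * q ^ (d ℕ.+ a′)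
          v = u * q ^ n′
          C = D⁻¹ (δ ℕ.+ x) * S d * (X n′ * Y a′)
          K : ℕ → ℕ → Carrier
          K g m = q!⁻¹ g * (r ^ (g ℕ.* d) * (q ^ δ) ^ d)
             * (D⁻¹ m * S (d ℕ.+ g) * (X (d ℕ.+ n′ ℕ.+ δ ∸ (d ℕ.+ g)) * Y (d ℕ.+ a′ ℕ.+ δ ∸ (d ℕ.+ g))))
          T : ℕ → ℕ → Carrier
          T g e = shifted q κ′ (κ * q ^ d) g * shifted q (κ * q ^ d) z e
                * (shifted q 1# (κ′ * v) e * shifted q 1# (z * v * q ^ e) g)

          ∸-lemma : ∀ i g e → d ℕ.+ i ℕ.+ (g ℕ.+ e) ∸ (d ℕ.+ g) ≡ i ℕ.+ e
          ∸-lemma i g e = ≡.trans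
            (≡.cong (_∸ (d ℕ.+ g)) (solve′ 4 (λ d i g e → d :+′ i :+′ (g :+′ e) :=′ d :+′ g :+′ (i :+′ e)) ≡.refl d i g e))
            (ℕ.m+n∸m≡n (d ℕ.+ g) (i ℕ.+ e))

          summand : ∀ g e → g ℕ.+ e ≡ δ →
            q!⁻¹ e * (q! δ * K g (e ℕ.+ x)) ≈ C * q! δ * (q!⁻¹ g * q!⁻¹ e * T g e)
          summand g e ≡.refl = begin
            q!⁻¹ e * (q! δ * K g (e ℕ.+ x))
              ≈⟨ *-congˡ (*-congˡ (*-cong (*-congˡ (r-q-power d g e))
                   (*-cong (*-cong (D⁻¹-+ x e g) (shifted-+ q κ′ κ d g))
                           (*-cong (trans (reflexive (≡.cong X (∸-lemma n′ g e))) (shifted-+ q 1# (κ′ * u) n′ e))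
                                   (trans (reflexive (≡.cong Y (∸-lemma a′ g e))) (shifted-+ q κ p a′ e)))))) ⟩
            q!⁻¹ e * (q! δ * (q!⁻¹ g * (q ^ d) ^ e
              * (D⁻¹ (g ℕ.+ (e ℕ.+ x)) * Tz * (S d * Ty) * (X n′ * Tx * (Y a′ * Tp)))))
              ≈⟨ solve 12 (λ ie qδ ig qde D Tz S Ty X Tx Y Tp →
                   ie :* (qδ :* (ig :* qde :* (D :* Tz :* (S :* Ty) :* (X :* Tx :* (Y :* Tp)))))
                   := D :* S :* (X :* Y) :* qδ :* (ig :* ie :* (Ty :* (qde :* Tp) :* (Tx :* Tz))))
                   refl _ _ _ _ _ _ _ _ _ _ _ _ ⟩
            D⁻¹ (g ℕ.+ (e ℕ.+ x)) * S d * (X n′ * Y a′) * q! δ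
              * (q!⁻¹ g * q!⁻¹ e * (Ty * ((q ^ d) ^ e * Tp) * (Tx * Tz)))
              ≈⟨ *-cong (*-congʳ (*-congʳ (*-congʳ (reflexive (≡.cong D⁻¹ (≡.sym (ℕ.+-assoc g e x)))))))
                   (*-congˡ (*-cong (*-congˡ Tp≈) (*-cong Tx≈ Tz≈))) ⟩
            C * q! δ * (q!⁻¹ g * q!⁻¹ e * T g e) ∎
            where
            Tz = shifted q 1# (p * u * q ^ (e ℕ.+ x)) g
            Ty = shifted q κ′ (κ * q ^ d) g
            Tx = shifted q 1# (κ′ * u * q ^ n′) e
            Tp = shifted q κ (p * q ^ a′) e
            Tp≈ : (q ^ d) ^ e * Tp ≈ shifted q (κ * q ^ d) z e
            Tp≈ = trans (sym (shifted-scale q (q ^ d) κ (p * q ^ a′) e))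
              (shifted-cong q e (*-comm _ _) (trans (solve 3 (λ a b c → a :* (b :* c) := b :* (a :* c)) refl _ _ _)
                (*-congˡ (sym (^-homo-* q d a′)))))
            Tx≈ : Tx ≈ shifted q 1# (κ′ * v) e
            Tx≈ = shifted-cong q e refl (*-assoc _ _ _)
            Tz≈ : Tz ≈ shifted q 1# (z * v * q ^ e) g
            Tz≈ = shifted-cong q g refl (begin
              p * u * q ^ (e ℕ.+ (n′ ℕ.+ a′ ℕ.+ d))
                ≈⟨ *-congˡ (trans (^-homo-* q e _) (*-congˡ (trans (^-homo-* q (n′ ℕ.+ a′) d) (*-congʳ (^-homo-* q n′ a′))))) ⟩
              p * u * (q ^ e * (q ^ n′ * q ^ a′ * q ^ d))
                ≈⟨ solve 6 (λ p u e n a d → p :* u :* (e :* (n :* a :* d)) := p :* (d :* a) :* (u :* n) :* e) refl _ _ _ _ _ _ ⟩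
              p * (q ^ d * q ^ a′) * (u * q ^ n′) * q ^ e
                ≈⟨ *-congʳ (*-congʳ (*-congˡ (^-homo-* q d a′))) ⟨
              z * v * q ^ e ∎)

        private
          module _ (δ : ℕ) where

            Inner : ℕ → ℕ → ℕ → ℕ → Carrier
            Inner n a d f = Σ+ f λ g m → falling δ g * (q!⁻¹ g * (r ^ (g ℕ.* d) * (q ^ δ) ^ d)
              * (D⁻¹ m * S (d ℕ.+ g) * (X (n ℕ.+ δ ∸ (d ℕ.+ g)) * Y (a ℕ.+ δ ∸ (d ℕ.+ g)))))

            ratio : ℕ → ℕ → Carrier
            ratio n a = shifted q κ′ (p * q ^ a) δ * shifted q 1# (κ * u * q ^ n) δ

            complement : ∀ d n′ a′ {f} → d ℕ.+ f ≡ d ℕ.+ n′ ℕ.+ (d ℕ.+ a′) ℕ.+ δ → f ≡ δ ℕ.+ (n′ ℕ.+ a′ ℕ.+ d)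
            complement d n′ a′ eq = ℕ.+-cancelˡ-≡ d _ _ (≡.trans eq (solve′ 4 (λ d n a δ →
              d :+′ n :+′ (d :+′ a) :+′ δ :=′ d :+′ (δ :+′ (n :+′ a :+′ d))) ≡.refl d n′ a′ δ))

            -- `inner` presupposes d ≤ n and d ≤ a; otherwise both sides vanish, the left through
            -- `falling` and the right through `_⟨_⊖_⟩`.
            Inner-closed : ∀ n a d f → d ℕ.+ f ≡ n ℕ.+ a ℕ.+ δ →
              q!⁻¹ d * falling n d * falling a d * q! f * Inner n a d f
              ≈ q! n * q! a * ratio n a
                * (transfer κ κ′ d * weight D⁻¹ f * (stay u κ′ ⟨ n ⊖ d ⟩ * jump p κ ⟨ a ⊖ d ⟩))
            Inner-closed n a d f d+f≡ with compare d n | compare d a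
            ... | beyond .n k | _ = begin
              q!⁻¹ d * (q! n * q!⁻¹ ⟨ n ⊖ d ⟩) * falling a d * q! f * Inner n a d f
                ≡⟨ ≡.cong (λ t → q!⁻¹ d * (q! n * t) * falling a d * q! f * Inner n a d f) (⊖-beyond q!⁻¹ n k) ⟩
              q!⁻¹ d * (q! n * 0#) * falling a d * q! f * Inner n a d f
                ≈⟨ solve 10 (λ x₁ x₂ x₃ x₄ x₅ y₁ y₂ y₃ y₄ y₅ →
                     x₁ :* (x₂ :* :0) :* x₃ :* x₄ :* x₅ := y₁ :* y₂ :* y₃ :* (y₄ :* y₅ :* (:0 :* x₁)))
                     refl _ _ _ _ _ (q! n) (q! a) (ratio n a) (transfer κ κ′ d) (weight D⁻¹ f) ⟩
              q! n * q! a * ratio n a * (transfer κ κ′ d * weight D⁻¹ f * (0# * q!⁻¹ d))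
                ≈⟨ *-congˡ (*-congˡ (solve 2 (λ x y → :0 :* x := :0 :* y) refl _ (jump p κ ⟨ a ⊖ d ⟩))) ⟩
              q! n * q! a * ratio n a * (transfer κ κ′ d * weight D⁻¹ f * (0# * jump p κ ⟨ a ⊖ d ⟩))
                ≡⟨ ≡.cong (λ t → q! n * q! a * ratio n a * (transfer κ κ′ d * weight D⁻¹ f * (t * jump p κ ⟨ a ⊖ d ⟩)))
                          (⊖-beyond (stay u κ′) n k) ⟨
              _ ∎
            ... | within .d n′ | beyond .a k = begin
              q!⁻¹ d * falling n d * (q! a * q!⁻¹ ⟨ a ⊖ d ⟩) * q! f * Inner n a d f
                ≡⟨ ≡.cong (λ t → q!⁻¹ d * falling n d * (q! a * t) * q! f * Inner n a d f) (⊖-beyond q!⁻¹ a k) ⟩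
              q!⁻¹ d * falling n d * (q! a * 0#) * q! f * Inner n a d f
                ≈⟨ solve 11 (λ x₁ x₂ x₃ x₄ x₅ y₁ y₂ y₃ y₄ y₅ y₆ →
                     x₁ :* x₂ :* (x₃ :* :0) :* x₄ :* x₅ := y₁ :* y₂ :* y₃ :* (y₄ :* y₅ :* (y₆ :* :0)))
                     refl _ _ _ _ _ _ _ _ _ _ _ ⟩
              q! n * q! a * ratio n a * (transfer κ κ′ d * weight D⁻¹ f * (stay u κ′ ⟨ n ⊖ d ⟩ * 0#))
                ≡⟨ ≡.cong (λ t → q! n * q! a * ratio n a * (transfer κ κ′ d * weight D⁻¹ f * (stay u κ′ ⟨ n ⊖ d ⟩ * t)))
                          (⊖-beyond (jump p κ) a k) ⟨
              _ ∎
            ... | within .d n′ | within .d a′ with ≡.refl ← complement d n′ a′ d+f≡ = begin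
              q!⁻¹ d * (q! n * q!⁻¹ ⟨ n ⊖ d ⟩) * (q! a * q!⁻¹ ⟨ a ⊖ d ⟩) * q! f * Inner n a d f
                ≈⟨ *-cong (*-congʳ (*-cong (*-congˡ (*-congˡ (reflexive (⊖-within q!⁻¹ d n′))))
                                           (*-congˡ (reflexive (⊖-within q!⁻¹ d a′)))))
                          (inner δ d n′ a′) ⟩
              q!⁻¹ d * (q! n * q!⁻¹ n′) * (q! a * q!⁻¹ a′) * q! f
                * (D⁻¹ f * S d * (X n′ * Y a′) * ratio n a)
                ≈⟨ solve 11 (λ d n n′ a a′ f D S X Y P →
                     d :* (n :* n′) :* (a :* a′) :* f :* (D :* S :* (X :* Y) :* P)
                     := n :* a :* P :* (d :* S :* (f :* D) :* ((n′ :* X) :* (a′ :* Y))))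
                     refl _ _ _ _ _ _ _ _ _ _ _ ⟩
              q! n * q! a * ratio n a * (transfer κ κ′ d * weight D⁻¹ f * (stay u κ′ n′ * jump p κ a′))
                ≈⟨ *-congˡ (*-congˡ (*-cong (reflexive (⊖-within (stay u κ′) d n′))
                                            (reflexive (⊖-within (jump p κ) d a′)))) ⟨
              _ ∎

        -- Sears' transformation. `falling-expansion` makes the left side a double sum over f = d +
        -- g; after the sums are interchanged, the sum over g closes up and leaves for each d one
        -- term of the right side.
        exchangeSum-shift : ∀ n a δ → let N = n ℕ.+ a ℕ.+ δ in
          q! (n ℕ.+ δ) * q! (a ℕ.+ δ) * exchangeSum N (n ℕ.+ δ) (a ℕ.+ δ)
          ≈ q! n * q! a * (shifted q κ′ (p * q ^ a) δ * shifted q 1# (κ * u * q ^ n) δ) * exchangeSum N n a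
        exchangeSum-shift n a δ = begin
          q! b * q! j * exchangeSum N b j
            ≈⟨ *-distribˡ-Σ+ N _ (λ f m →
                 transfer κ κ′ f * weight D⁻¹ m * (stay u κ′ ⟨ b ⊖ f ⟩ * jump p κ ⟨ j ⊖ f ⟩)) ⟩
          Σ+ N (λ f m → q! b * q! j *
                 (transfer κ κ′ f * weight D⁻¹ m * (stay u κ′ ⟨ b ⊖ f ⟩ * jump p κ ⟨ j ⊖ f ⟩)))
            ≈⟨ (Σ+-cong N λ f m f+m≡N → trans
                 (*-congˡ (*-congˡ (*-cong (⊖-* q!⁻¹ X b f) (⊖-* q!⁻¹ Y j f))))
                 (solve 10 (λ b j f S m D ib X ij Y →
                    b :* j :* (f :* S :* (m :* D) :* (ib :* X :* (ij :* Y)))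
                    := D :* S :* (X :* Y) :* (m :* f :* ((b :* ib) :* (j :* ij)))) refl _ _ _ _ _ _ _ _ _ _)) ⟩
          Σ+ N (λ f m → D⁻¹ m * S f * (X (b ∸ f) * Y (j ∸ f)) * (q! m * q!⁻¹ f * (falling b f * falling j f)))
            ≈⟨ (Σ+-cong N λ f m f+m≡N → trans
                 (*-congˡ (falling-expansion n a δ f m f+m≡N))
                 (trans (*-distribˡ-Σ+ f _ (λ d g → q!⁻¹ d * falling n d * falling a d * q! (g ℕ.+ m)
                          * (q!⁻¹ g * falling δ g * (r ^ (g ℕ.* d) * (q ^ δ) ^ d))))
                        (Σ+-cong f λ d g d+g≡f → *-congʳ (reflexive
                          (≡.cong (λ f → D⁻¹ m * S f * (X (b ∸ f) * Y (j ∸ f))) (≡.sym d+g≡f)))))) ⟩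
          Σ+ N (λ f m → Σ+ f λ d g → G d g m)
            ≈⟨ Σ+-assoc N G ⟩
          Σ+ N (λ d f → Σ+ f λ g m → G d g m)
            ≈⟨ (Σ+-cong N λ d f d+f≡N → trans (trans
                 (Σ+-cong f λ g m g+m≡f → trans
                   (*-congˡ (*-congʳ (*-congˡ (reflexive (≡.cong q! g+m≡f)))))
                   (solve 5 (λ A B g δ r → A :* (B :* (g :* δ :* r)) := B :* (δ :* (g :* r :* A))) refl _ _ _ _ _))
                 (sym (*-distribˡ-Σ+ f _ _)))
                 (Inner-closed δ n a d f d+f≡N)) ⟩
          Σ+ N (λ d f → q! n * q! a * ratio δ n a
                * (transfer κ κ′ d * weight D⁻¹ f * (stay u κ′ ⟨ n ⊖ d ⟩ * jump p κ ⟨ a ⊖ d ⟩)))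
            ≈⟨ *-distribˡ-Σ+ N _ (λ d f →
                 transfer κ κ′ d * weight D⁻¹ f * (stay u κ′ ⟨ n ⊖ d ⟩ * jump p κ ⟨ a ⊖ d ⟩)) ⟨
          q! n * q! a * ratio δ n a * exchangeSum N n a ∎
          where
          N = n ℕ.+ a ℕ.+ δ
          b = n ℕ.+ δ
          j = a ℕ.+ δ
          G : ℕ → ℕ → ℕ → Carrier
          G d g m = D⁻¹ m * S (d ℕ.+ g) * (X (b ∸ (d ℕ.+ g)) * Y (j ∸ (d ℕ.+ g)))
            * (q!⁻¹ d * falling n d * falling a d * q! (g ℕ.+ m)
               * (q!⁻¹ g * falling δ g * (r ^ (g ℕ.* d) * (q ^ δ) ^ d)))

        private
          exchange-δ : ∀ n a δ → let N = n ℕ.+ a ℕ.+ δ ; b = n ℕ.+ δ ; j = a ℕ.+ δ in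
            stay u κ b * jump p κ′ j * exchangeSum N n a ≈ stay u κ n * jump p κ′ a * exchangeSum N b j
          exchange-δ n a δ = begin
            q!⁻¹ b * shifted q 1# (κ * u) b * (q!⁻¹ j * shifted q κ′ p j) * E
              ≈⟨ *-congʳ (*-cong (*-congˡ (shifted-+ q 1# (κ * u) n δ)) (*-congˡ (shifted-+ q κ′ p a δ))) ⟩
            q!⁻¹ b * (s * s′) * (q!⁻¹ j * (t * t′)) * E
              ≈⟨ solve 9 (λ ib ij s s′ t t′ E x y → ib :* (s :* s′) :* (ij :* (t :* t′)) :* E
                   := :1 :* :1 :* (ib :* (s :* s′) :* (ij :* (t :* t′)) :* E)) refl _ _ _ _ _ _ _ 1# 1# ⟩
            1# * 1# * (q!⁻¹ b * (s * s′) * (q!⁻¹ j * (t * t′)) * E)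
              ≈⟨ *-congʳ (*-cong (q!-inverse n) (q!-inverse a)) ⟨
            q! n * q!⁻¹ n * (q! a * q!⁻¹ a) * (q!⁻¹ b * (s * s′) * (q!⁻¹ j * (t * t′)) * E)
              ≈⟨ solve 11 (λ n n⁻ a a⁻ ib ij s s′ t t′ E →
                   n :* n⁻ :* (a :* a⁻) :* (ib :* (s :* s′) :* (ij :* (t :* t′)) :* E)
                   := n⁻ :* s :* (a⁻ :* t) :* (ib :* ij :* (n :* a :* (t′ :* s′) :* E)))
                   refl _ _ _ _ _ _ _ _ _ _ _ ⟩
            stay u κ n * jump p κ′ a * (q!⁻¹ b * q!⁻¹ j * (q! n * q! a * (t′ * s′) * E))
              ≈⟨ *-congˡ (*-congˡ (exchangeSum-shift n a δ)) ⟨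
            stay u κ n * jump p κ′ a * (q!⁻¹ b * q!⁻¹ j * (q! b * q! j * E′))
              ≈⟨ *-congˡ (trans (solve 5 (λ ib ij b j E → ib :* ij :* (b :* j :* E) := (b :* ib) :* (j :* ij) :* E) refl _ _ _ _ _)
                   (trans (*-congʳ (trans (*-cong (q!-inverse b) (q!-inverse j)) (*-identityˡ _))) (*-identityˡ _))) ⟩
            stay u κ n * jump p κ′ a * E′ ∎
            where
            b = n ℕ.+ δ
            j = a ℕ.+ δ
            E  = exchangeSum (n ℕ.+ a ℕ.+ δ) n a
            E′ = exchangeSum (n ℕ.+ a ℕ.+ δ) b j
            s  = shifted q 1# (κ * u) n
            s′ = shifted q 1# (κ * u * q ^ n) δ
            t  = shifted q κ′ p a
            t′ = shifted q κ′ (p * q ^ a) δ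

        -- From n + j = b + a the differences b - n and j - a coincide, so `exchangeSum-shift`
        -- relates the two series. The relation is invariant under exchanging (n, a) with (b, j);
        -- only the sign of the difference has to be distinguished.
        exchange : ∀ n j a b → n ℕ.+ j ≡ b ℕ.+ a →
          stay u κ b * jump p κ′ j * exchangeSum (n ℕ.+ j) n a ≈ stay u κ n * jump p κ′ a * exchangeSum (n ℕ.+ j) b j
        exchange n j a b n+j≡b+a with ℕ.≤-total n b
        ... | inj₁ n≤b with δ , ≡.refl ← ℕ.m≤n⇒∃[o]m+o≡n n≤b
                       with ≡.refl ← ℕ.+-cancelˡ-≡ n j (a ℕ.+ δ) (≡.trans n+j≡b+a (≡.trans (ℕ.+-assoc n δ a) (≡.cong (n ℕ.+_) (ℕ.+-comm δ a))))
          = ≡.subst (λ N → stay u κ b * jump p κ′ j * exchangeSum N n a ≈ stay u κ n * jump p κ′ a * exchangeSum N b j)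
              (ℕ.+-assoc n a δ) (exchange-δ n a δ)
        ... | inj₂ b≤n with δ , ≡.refl ← ℕ.m≤n⇒∃[o]m+o≡n b≤n
                       with ≡.refl ← ℕ.+-cancelˡ-≡ b a (j ℕ.+ δ) (≡.trans (≡.sym n+j≡b+a) (≡.trans (ℕ.+-assoc b δ j) (≡.cong (b ℕ.+_) (ℕ.+-comm δ j))))
          = ≡.subst (λ N → stay u κ b * jump p κ′ j * exchangeSum N n a ≈ stay u κ n * jump p κ′ a * exchangeSum N b j)
              (≡.trans (ℕ.+-assoc b j δ) (≡.trans (≡.cong (b ℕ.+_) (ℕ.+-comm j δ)) (≡.sym (ℕ.+-assoc b δ j)))) (sym (exchange-δ b j δ))

        -- Two vertices on top of each other, with k above, i below, and j₁, j₂ entering from the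
        -- left; `V` stands for the columns to the right. The middle edge carries i′ + j₂, of which
        -- b = k - j₁ go straight up. The lower vertex keeps only its `stay`: its jump factor is
        -- left to `V`, and `jump p κ′ j₂` comes from the preceding column.
        column : (ℕ → ℕ → Carrier) → (k i j₁ j₂ : ℕ) → Carrier
        column V k i j₁ j₂ =
          (λ b → stay u κ b * jump p κ′ j₂ * Σ+ i λ l₂ i′ →
            stay u κ′ i′ * (λ l₁ → weight D⁻¹ (i′ ℕ.+ j₂) * jump p κ l₁ * V l₁ l₂) ⟨ i′ ℕ.+ j₂ ⊖ b ⟩) ⟨ k ⊖ j₁ ⟩

      -- The hypothesis lifts d units to the right of the column, the conclusion to its left. With
      -- the outermost labels held fixed, each side is a single sum over d, and the two sums are
      -- those of `exchange`.
      column-exchange : ∀ κ κ′ {V V′ : ℕ → ℕ → Carrier} →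
        (∀ l₁ l₂ → V l₁ l₂ ≈ Σ+ l₂ λ d l → transfer κ κ′ d * V′ (l₁ ℕ.+ d) l) →
        ∀ k i j₁ j₂ → column κ κ′ V k i j₁ j₂ ≈ Σ+ j₂ λ d j → transfer κ κ′ d * column κ′ κ V′ k i (j₁ ℕ.+ d) j
      column-exchange κ κ′ {V} {V′} V≈ k i j₁ j = begin
        column κ κ′ V k i j₁ j
          ≈⟨ ⊖-cong k j₁ (λ b _ → slice b) ⟩
        (λ b → Σ+ j λ d j′ → (λ b′ → A d * Row j′ b′) ⟨ b ⊖ d ⟩) ⟨ k ⊖ j₁ ⟩
          ≈⟨ Σ+-⊖ j k j₁ (λ d j′ b → (λ b′ → A d * Row j′ b′) ⟨ b ⊖ d ⟩) ⟨
        Σ+ j (λ d j′ → (λ b → (λ b′ → A d * Row j′ b′) ⟨ b ⊖ d ⟩) ⟨ k ⊖ j₁ ⟩)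
          ≈⟨ (Σ+-cong j λ d j′ _ → trans (*-distribˡ-⊖ (A d) (Row j′) k (j₁ ℕ.+ d)) (⊖-⊖ _ k j₁ d)) ⟨
        Σ+ j (λ d j′ → A d * column κ′ κ V′ k i (j₁ ℕ.+ d) j′) ∎
        where
        A = transfer κ κ′
        Row : ℕ → ℕ → Carrier
        Row j′ b′ = stay u κ′ b′ * jump p κ j′ * Σ+ i λ l n →
          stay u κ n * (λ a → weight D⁻¹ (n ℕ.+ j′) * jump p κ′ a * V′ a l) ⟨ n ℕ.+ j′ ⊖ b′ ⟩

        -- In `G` the d units are lifted to the right of the column, in `H` to its left. Here l is
        -- the lower right label after the lift and n = i - l.
        G : ℕ → ℕ → ℕ → ℕ → Carrier
        G b l d i′ = stay u κ′ i′ * (λ l₁ → weight D⁻¹ (i′ ℕ.+ j) * jump p κ l₁ * (A d * V′ (l₁ ℕ.+ d) l)) ⟨ i′ ℕ.+ j ⊖ b ⟩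

        H : ℕ → ℕ → ℕ → ℕ → ℕ → Carrier
        H b l n d j′ = (λ b′ → A d * (stay u κ′ b′ * jump p κ j′ * (stay u κ n *
          (λ a → weight D⁻¹ (n ℕ.+ j′) * jump p κ′ a * V′ a l) ⟨ n ℕ.+ j′ ⊖ b′ ⟩))) ⟨ b ⊖ d ⟩

        move : ∀ d n {j j′} → d ℕ.+ j′ ≡ j → d ℕ.+ (n ℕ.+ j′) ≡ n ℕ.+ j
        move d n {j′ = j′} ≡.refl = solve′ 3 (λ d n j → d :+′ (n :+′ j) :=′ n :+′ (d :+′ j)) ≡.refl d n j′

        -- Here b exceeds n + j, all that is available for it, so every term on either side
        -- vanishes.
        cell-0 : ∀ l n k → let b = suc (n ℕ.+ j ℕ.+ k) in
          stay u κ b * jump p κ′ j * Σ+ n (G b l) ≈ Σ+ j (H b l n)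
        cell-0 l n k = begin
          stay u κ b * jump p κ′ j * Σ+ n (G b l)
            ≈⟨ *-congˡ (trans (Σ+-cong n λ d i′ d+i′≡n → trans (*-congˡ (reflexive
                 (⊖-exceeds (i′ ℕ.+ j) b (ℕ.s≤s (ℕ.≤-trans (ℕ.+-monoˡ-≤ j (ℕ.≤-trans (ℕ.m≤n+m i′ d) (ℕ.≤-reflexive d+i′≡n))) (ℕ.m≤m+n _ k))) _))) (zeroʳ _)) (Σ+-0 n)) ⟩
          stay u κ b * jump p κ′ j * 0#
            ≈⟨ zeroʳ _ ⟩
          0#
            ≈⟨ trans (Σ+-cong j λ d j′ d+j′≡j → trans (⊖-cong b d λ b′ d+b′≡b → trans
                 (*-congˡ (*-congˡ (*-congˡ (reflexive (⊖-exceeds (n ℕ.+ j′) b′ (ℕ.+-cancelˡ-< d _ _ (ℕ.≤-trans (ℕ.s≤s (ℕ.≤-trans (ℕ.≤-reflexive (move d n d+j′≡j)) (ℕ.m≤m+n _ k))) (ℕ.≤-reflexive (≡.sym d+b′≡b)))) _)))))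
                 (solve 3 (λ x y z → x :* (y :* (z :* :0)) := :0) refl _ _ _)) (⊖-0 b d)) (Σ+-0 j) ⟨
          Σ+ j (H b l n) ∎
          where b = suc (n ℕ.+ j ℕ.+ k)

        -- Conservation makes the upper right label a in every term, so `V′ a l` factors out and
        -- `exchange` remains. `Σ+-truncate` passes between the totals n and j of the two sums and
        -- the common n + j.
        cell-1 : ∀ l n a b → n ℕ.+ j ≡ b ℕ.+ a →
          stay u κ b * jump p κ′ j * Σ+ n (G b l) ≈ Σ+ j (H b l n)
        cell-1 l n a b n+j≡b+a = begin
          stay u κ b * jump p κ′ j * Σ+ n (G b l)
            ≈⟨ *-congˡ (Σ+-cong n λ d i′ d+i′≡n → trans (*-congˡ (trans
                  (reflexive (⊖-complement _ d (i′ ℕ.+ j) b a (≡.trans (≡.sym (ℕ.+-assoc d i′ j)) (≡.trans (≡.cong (ℕ._+ j) d+i′≡n) n+j≡b+a))))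
                  (trans (⊖-cong a d λ l₁ d+l₁≡a → trans
                     (*-congˡ (*-congˡ (reflexive (≡.cong (λ x → V′ x l) (≡.trans (ℕ.+-comm l₁ d) d+l₁≡a)))))
                     (solve 4 (λ w y a v → w :* y :* (a :* v) := (v :* a :* w) :* y) refl _ _ _ _))
                   (sym (*-distribˡ-⊖ _ (jump p κ) a d)))))
                 (solve 5 (λ s v a w y → s :* (v :* a :* w :* y) := s :* (v :* (a :* w :* y))) refl _ _ _ _ _)) ⟩
          stay u κ b * jump p κ′ j * Σ+ n (λ d i′ → stay u κ′ i′ * (V′ a l * (A d * weight D⁻¹ (i′ ℕ.+ j) * jump p κ ⟨ a ⊖ d ⟩)))
            ≈⟨ *-congˡ (Σ+-truncate n j (stay u κ′) (λ d m → V′ a l * (A d * weight D⁻¹ m * jump p κ ⟨ a ⊖ d ⟩))) ⟨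
          stay u κ b * jump p κ′ j * Σ+ (n ℕ.+ j) (λ d m → stay u κ′ ⟨ n ⊖ d ⟩ * (V′ a l * (A d * weight D⁻¹ m * jump p κ ⟨ a ⊖ d ⟩)))
            ≈⟨ *-congˡ (trans (Σ+-cong (n ℕ.+ j) λ d m _ → solve 5 (λ s v a w y → s :* (v :* (a :* w :* y)) := v :* (a :* w :* (s :* y))) refl _ _ _ _ _)
                  (sym (*-distribˡ-Σ+ (n ℕ.+ j) _ _))) ⟩
          stay u κ b * jump p κ′ j * (V′ a l * exchangeSum κ κ′ (n ℕ.+ j) n a)
            ≈⟨ solve 4 (λ x y v e → x :* y :* (v :* e) := v :* (x :* y :* e)) refl _ _ _ _ ⟩
          V′ a l * (stay u κ b * jump p κ′ j * exchangeSum κ κ′ (n ℕ.+ j) n a)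
            ≈⟨ *-congˡ (exchange κ κ′ n j a b n+j≡b+a) ⟩
          V′ a l * (stay u κ n * jump p κ′ a * exchangeSum κ κ′ (n ℕ.+ j) b j)
            ≡⟨ ≡.cong (λ N → V′ a l * (stay u κ n * jump p κ′ a * exchangeSum κ κ′ N b j)) (ℕ.+-comm n j) ⟩
          V′ a l * (stay u κ n * jump p κ′ a * exchangeSum κ κ′ (j ℕ.+ n) b j)
            ≈⟨ *-assoc _ _ _ ⟨
          V′ a l * (stay u κ n * jump p κ′ a) * exchangeSum κ κ′ (j ℕ.+ n) b j
            ≈⟨ trans (*-distribˡ-Σ+ (j ℕ.+ n) _ _) (Σ+-cong (j ℕ.+ n) λ d m _ →
                 solve 5 (λ v a w s y → v :* (a :* w :* (s :* y)) := y :* (v :* (a :* w :* s))) refl _ _ _ _ _) ⟩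
          Σ+ (j ℕ.+ n) (λ d m → jump p κ ⟨ j ⊖ d ⟩ * (V′ a l * (stay u κ n * jump p κ′ a) * (A d * weight D⁻¹ m * stay u κ′ ⟨ b ⊖ d ⟩)))
            ≈⟨ Σ+-truncate j n (jump p κ) (λ d m → V′ a l * (stay u κ n * jump p κ′ a) * (A d * weight D⁻¹ m * stay u κ′ ⟨ b ⊖ d ⟩)) ⟩
          Σ+ j (λ d j′ → jump p κ j′ * (V′ a l * (stay u κ n * jump p κ′ a) * (A d * weight D⁻¹ (j′ ℕ.+ n) * stay u κ′ ⟨ b ⊖ d ⟩)))
            ≈⟨ (Σ+-cong j λ d j′ d+j′≡j → trans
                 (solve 7 (λ y v s y′ a w s′ → y :* (v :* (s :* y′) :* (a :* w :* s′)) := (y :* v :* s :* y′ :* a :* w) :* s′) refl _ _ _ _ _ _ _)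
                 (trans (*-distribˡ-⊖ _ (stay u κ′) b d) (⊖-cong b d λ b′ d+b′≡b → trans
                   (*-congʳ (*-congˡ (reflexive (≡.cong (weight D⁻¹) (ℕ.+-comm j′ n)))))
                   (trans (solve 7 (λ y v s y′ a w s′ → (y :* v :* s :* y′ :* a :* w) :* s′ := a :* (s′ :* y :* (s :* (w :* y′ :* v)))) refl _ _ _ _ _ _ _)
                     (*-congˡ (*-congˡ (*-congˡ (sym (reflexive (≡.trans
                        (≡.cong (λ x → (λ a → weight D⁻¹ (n ℕ.+ j′) * jump p κ′ a * V′ a l) ⟨ x ⊖ b′ ⟩) (ℕ.+-cancelˡ-≡ d _ _ (≡.trans (move d n d+j′≡j) (≡.trans n+j≡b+a (≡.trans (≡.cong (ℕ._+ a) (≡.sym d+b′≡b)) (ℕ.+-assoc d b′ a))))))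
                        (⊖-within _ b′ a))))))))))) ⟩
          Σ+ j (H b l n) ∎

        cell : ∀ b l n → stay u κ b * jump p κ′ j * Σ+ n (G b l) ≈ Σ+ j (H b l n)
        cell b l n = go b (n ℕ.+ j) ≡.refl
          where
          go : ∀ b N → N ≡ n ℕ.+ j → stay u κ b * jump p κ′ j * Σ+ n (G b l) ≈ Σ+ j (H b l n)
          go b N N≡ with compare b N
          ... | within .b a = cell-1 l n a b (≡.sym N≡)
          ... | beyond .N k with ≡.refl ← N≡ = cell-0 l n k

        slice : ∀ b → _ ≈ _
        slice b = begin
          stay u κ b * jump p κ′ j * Σ+ i (λ l₂ i′ → stay u κ′ i′ * (λ l₁ → weight D⁻¹ (i′ ℕ.+ j) * jump p κ l₁ * V l₁ l₂) ⟨ i′ ℕ.+ j ⊖ b ⟩)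
            ≈⟨ *-congˡ (Σ+-cong i λ l₂ i′ _ → trans
                 (*-congˡ (trans (⊖-cong (i′ ℕ.+ j) b λ l₁ _ → trans (*-congˡ (V≈ l₁ l₂)) (*-distribˡ-Σ+ l₂ _ _))
                   (sym (Σ+-⊖ l₂ (i′ ℕ.+ j) b (λ d l l₁ → weight D⁻¹ (i′ ℕ.+ j) * jump p κ l₁ * (A d * V′ (l₁ ℕ.+ d) l))))))
                 (trans (*-distribˡ-Σ+ l₂ _ _) (Σ+-flip l₂ (λ d l → G b l d i′)))) ⟩
          stay u κ b * jump p κ′ j * Σ+ i (λ l₂ i′ → Σ+ l₂ λ l d → G b l d i′)
            ≈⟨ *-congˡ (Σ+-assoc i (G b)) ⟩
          stay u κ b * jump p κ′ j * Σ+ i (λ l n → Σ+ n (G b l))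
            ≈⟨ *-distribˡ-Σ+ i _ _ ⟩
          Σ+ i (λ l n → stay u κ b * jump p κ′ j * Σ+ n (G b l))
            ≈⟨ Σ+-cong i (λ l n _ → cell b l n) ⟩
          Σ+ i (λ l n → Σ+ j (H b l n))
            ≈⟨ Σ+-comm i j (H b) ⟩
          Σ+ j (λ d j′ → Σ+ i λ l n → H b l n d j′)
            ≈⟨ (Σ+-cong j λ d j′ _ → trans
                 (Σ+-⊖ i b d (λ l n b′ → A d * (stay u κ′ b′ * jump p κ j′ * (stay u κ n *
                   (λ a → weight D⁻¹ (n ℕ.+ j′) * jump p κ′ a * V′ a l) ⟨ n ℕ.+ j′ ⊖ b′ ⟩))))
                 (⊖-cong b d λ b′ _ → trans (sym (*-distribˡ-Σ+ i _ _)) (*-congˡ (sym (*-distribˡ-Σ+ i _ _))))) ⟩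
          Σ+ j (λ d j′ → (λ b′ → A d * Row j′ b′) ⟨ b ⊖ d ⟩) ∎

-- Sums over the vertical labels of a row.

module VectorSums {c ℓ} (R : CommutativeRing c ℓ) where

  open CommutativeRing R
  open FiniteSums R

  Σᵛ : ℕ → (L : ℕ) → (Vec ℕ L → Carrier) → Carrier
  Σᵛ N = ΣVec (Σ< N)

  Σᵛ-cong : ∀ N L {f g} → (∀ v → f v ≈ g v) → Σᵛ N L f ≈ Σᵛ N L g
  Σᵛ-cong N zero    f≈g = f≈g []
  Σᵛ-cong N (suc L) f≈g = Σ<-cong N λ m _ → Σᵛ-cong N L λ v → f≈g (m ∷ v)

  Σᵛ-0 : ∀ N L → Σᵛ N L (λ _ → 0#) ≈ 0#
  Σᵛ-0 N zero    = refl
  Σᵛ-0 N (suc L) = trans (Σ<-cong N λ _ _ → Σᵛ-0 N L) (Σ<-0 N)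

  *-distribˡ-Σᵛ : ∀ N L a f → a * Σᵛ N L f ≈ Σᵛ N L (λ v → a * f v)
  *-distribˡ-Σᵛ N zero    a f = refl
  *-distribˡ-Σᵛ N (suc L) a f = trans (*-distribˡ-Σ< N a λ m → Σᵛ N L λ v → f (m ∷ v))
    (Σ<-cong N λ m _ → *-distribˡ-Σᵛ N L a λ v → f (m ∷ v))

  Σᵛ-Σ<-comm : ∀ N L n (f : Vec ℕ L → ℕ → Carrier) →
               Σᵛ N L (λ v → Σ< n (f v)) ≈ Σ< n (λ a → Σᵛ N L λ v → f v a)
  Σᵛ-Σ<-comm N zero    n f = refl
  Σᵛ-Σ<-comm N (suc L) n f = trans (Σ<-cong N λ m _ → Σᵛ-Σ<-comm N L n λ v → f (m ∷ v)) (Σ<-comm N n λ m a → Σᵛ N L λ v → f (m ∷ v) a)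

  Σᵛ-comm : ∀ N L M (f : Vec ℕ L → Vec ℕ M → Carrier) →
            Σᵛ N L (λ v → Σᵛ N M (f v)) ≈ Σᵛ N M (λ w → Σᵛ N L λ v → f v w)
  Σᵛ-comm N L zero    f = refl
  Σᵛ-comm N L (suc M) f = trans (Σᵛ-Σ<-comm N L N λ v m → Σᵛ N M λ w → f v (m ∷ w))
    (Σ<-cong N λ m _ → Σᵛ-comm N L M λ v w → f v (m ∷ w))

  Σᵛ-⊖ : ∀ N L n d (f : Vec ℕ L → ℕ → Carrier) →
         Σᵛ N L (λ v → f v ⟨ n ⊖ d ⟩) ≈ (λ i → Σᵛ N L λ v → f v i) ⟨ n ⊖ d ⟩
  Σᵛ-⊖ N L n       zero    f = refl
  Σᵛ-⊖ N L zero    (suc d) f = Σᵛ-0 N L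
  Σᵛ-⊖ N L (suc n) (suc d) f = Σᵛ-⊖ N L n d f

-- Exchange of the parameters of two consecutive rows.

module RowTransfer {c ℓ} (R : CommutativeRing c ℓ) where

  open CommutativeRing R
  open QBinomial R
  open FiniteSums R
  open VectorSums R
  open QFactorials R
  open RawSemiringDefinitions (Semiring.rawSemiring semiring) using (_^_)
  open SemiringExp semiring using (^-homo-*)
  open IntegerSolver R
  open SetoidReasoning setoid

  module Rows
    (q q⁻¹ : Carrier) (q⁻¹q≈1 : q⁻¹ * q ≈ 1#)
    (q!⁻¹ : ℕ → Carrier) (q!-inverse : ∀ n → shifted q 1# q n * q!⁻¹ n ≈ 1#)
    (p u : ℕ → Carrier) (D⁻¹ : ℕ → ℕ → ℕ → Carrier)
    (D-inverse : ∀ r c n → shifted q 1# (p (r ℕ.+ c) * u c) n * D⁻¹ r c n ≈ 1#) where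

    open Reciprocals q q⁻¹ q⁻¹q≈1 q!⁻¹ q!-inverse

    δ₀ : ℕ → Carrier
    δ₀ zero    = 1#
    δ₀ (suc _) = 0#

    vertex : (r c : ℕ) → Carrier → (m l : ℕ) → Carrier
    vertex r c κ m l = weight (D⁻¹ r c) m * (u c ^ l * jump (p (r ℕ.+ c)) κ l) * stay (u c) κ ⟨ m ⊖ l ⟩

    -- The partition function of the columns c, c + 1, … of row r, with
    -- a on the incoming horizontal edge and 0 on the outgoing one.
    row : (r c : ℕ) → Carrier → ∀ {L} → Vec ℕ L → Vec ℕ L → ℕ → Carrier
    row r c κ []      []      a = δ₀ a
    row r c κ (k ∷ t) (m ∷ v) a = (λ l → vertex r c κ m l * row r (suc c) κ t v l) ⟨ m ℕ.+ a ⊖ k ⟩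

    row-conservation : ∀ r c κ {L} (t v : Vec ℕ L) a →
                       ¬ a ℕ.+ Vec.sum v ≡ Vec.sum t → row r c κ t v a ≈ 0#
    row-conservation r c κ []      []      zero    0≢0 with () ← 0≢0 ≡.refl
    row-conservation r c κ []      []      (suc a) _   = refl
    row-conservation r c κ (k ∷ t) (m ∷ v) a       a≢  = trans
      (⊖-cong (m ℕ.+ a) k λ l k+l≡ → trans
        (*-congˡ (row-conservation r (suc c) κ t v l λ l+v≡ → a≢ (≡.trans
          (solve′ 3 (λ a m v → a :+′ (m :+′ v) :=′ m :+′ a :+′ v) ≡.refl a m (Vec.sum v))
          (≡.trans (≡.cong (ℕ._+ Vec.sum v) (≡.sym k+l≡)) (≡.trans (ℕ.+-assoc k l _) (≡.cong (k ℕ.+_) l+v≡))))))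
        (zeroʳ (vertex r c κ m l)))
      (⊖-0 (m ℕ.+ a) k)

    -- Two consecutive rows, the lower one with the factor (p/κ′;q)_{j₂} κ′^{j₂}/(q;q)_{j₂}
    -- of the preceding column; this factor makes the exchange of κ and κ′ denominator-free.
    twoRows : (r c : ℕ) → Carrier → Carrier → ∀ {L} → Vec ℕ L → Vec ℕ L → ℕ → ℕ → Carrier
    twoRows r c κ κ′ []      []      j₁ j₂ = δ₀ j₁ * δ₀ j₂
    twoRows r c κ κ′ (k ∷ t) (i ∷ b) j₁ j₂ = weight (D⁻¹ (suc r) c) i *
      Vertex.column (p (r ℕ.+ c)) (u c) (D⁻¹ r c) (D-inverse r c) κ κ′
        (λ l₁ l₂ → u c ^ (l₁ ℕ.+ l₂) * twoRows r (suc c) κ κ′ t b l₁ l₂) k i j₁ j₂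

    transfer-0 : ∀ κ κ′ → transfer κ κ′ 0 ≈ 1#
    transfer-0 κ κ′ = trans (*-comm _ _) (q!-inverse 0)

    -- Induction over the columns, starting from the right end, where both outgoing labels are 0.
    -- The power of `u c` depends on l₁ + l₂ only, which the lift preserves, so the statement for
    -- the remaining columns is the hypothesis of `column-exchange`.
    twoRows-exchange : ∀ r c κ κ′ {L} (t b : Vec ℕ L) j₁ j₂ →
      twoRows r c κ κ′ t b j₁ j₂ ≈ Σ+ j₂ λ d j → transfer κ κ′ d * twoRows r c κ′ κ t b (j₁ ℕ.+ d) j
    twoRows-exchange r c κ κ′ [] [] j₁ zero = begin
      δ₀ j₁ * 1#                                       ≈⟨ *-identityˡ _ ⟨
      1# * (δ₀ j₁ * 1#)                                ≈⟨ *-cong (sym (transfer-0 κ κ′)) (*-congʳ (reflexive (≡.cong δ₀ (≡.sym (ℕ.+-identityʳ j₁))))) ⟩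
      transfer κ κ′ 0 * (δ₀ (j₁ ℕ.+ 0) * 1#)           ∎
    twoRows-exchange r c κ κ′ [] [] j₁ (suc j₂) = begin
      δ₀ j₁ * 0#                                       ≈⟨ zeroʳ _ ⟩
      0#                                               ≈⟨ Σ+-0 (suc j₂) ⟨
      Σ+ (suc j₂) (λ _ _ → 0#)                         ≈⟨ Σ+-cong (suc j₂) vanishes ⟩
      Σ+ (suc j₂) (λ d j → transfer κ κ′ d * (δ₀ (j₁ ℕ.+ d) * δ₀ j)) ∎
      where
      vanishes : ∀ d j → d ℕ.+ j ≡ suc j₂ → 0# ≈ transfer κ κ′ d * (δ₀ (j₁ ℕ.+ d) * δ₀ j)
      vanishes d       (suc j) _ = sym (trans (*-congˡ (zeroʳ _)) (zeroʳ _))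
      vanishes (suc d) zero    _ rewrite ℕ.+-suc j₁ d = sym (trans (*-congˡ (zeroˡ _)) (zeroʳ _))
    twoRows-exchange r c κ κ′ (k ∷ t) (i ∷ b) j₁ j₂ = begin
      w * column κ κ′ V k i j₁ j₂
        ≈⟨ *-congˡ (column-exchange κ κ′ {V} {V′} V≈ k i j₁ j₂) ⟩
      w * Σ+ j₂ (λ d j → transfer κ κ′ d * column κ′ κ V′ k i (j₁ ℕ.+ d) j)
        ≈⟨ *-distribˡ-Σ+ j₂ w _ ⟩
      Σ+ j₂ (λ d j → w * (transfer κ κ′ d * column κ′ κ V′ k i (j₁ ℕ.+ d) j))
        ≈⟨ (Σ+-cong j₂ λ d j _ → solve 3 (λ w t c → w :* (t :* c) := t :* (w :* c)) refl _ _ _) ⟩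
      Σ+ j₂ (λ d j → transfer κ κ′ d * (w * column κ′ κ V′ k i (j₁ ℕ.+ d) j)) ∎
      where
      open Vertex (p (r ℕ.+ c)) (u c) (D⁻¹ r c) (D-inverse r c)
      w = weight (D⁻¹ (suc r) c) i
      V V′ : ℕ → ℕ → Carrier
      V  l₁ l₂ = u c ^ (l₁ ℕ.+ l₂) * twoRows r (suc c) κ κ′ t b l₁ l₂
      V′ l₁ l₂ = u c ^ (l₁ ℕ.+ l₂) * twoRows r (suc c) κ′ κ t b l₁ l₂
      V≈ : ∀ l₁ l₂ → V l₁ l₂ ≈ Σ+ l₂ λ d l → transfer κ κ′ d * V′ (l₁ ℕ.+ d) l
      V≈ l₁ l₂ = begin
        u c ^ (l₁ ℕ.+ l₂) * twoRows r (suc c) κ κ′ t b l₁ l₂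
          ≈⟨ *-congˡ (twoRows-exchange r (suc c) κ κ′ t b l₁ l₂) ⟩
        u c ^ (l₁ ℕ.+ l₂) * Σ+ l₂ (λ d l → transfer κ κ′ d * twoRows r (suc c) κ′ κ t b (l₁ ℕ.+ d) l)
          ≈⟨ *-distribˡ-Σ+ l₂ _ _ ⟩
        Σ+ l₂ (λ d l → u c ^ (l₁ ℕ.+ l₂) * (transfer κ κ′ d * twoRows r (suc c) κ′ κ t b (l₁ ℕ.+ d) l))
          ≈⟨ (Σ+-cong l₂ λ d l d+l≡l₂ → trans
               (*-congʳ (reflexive (≡.cong (u c ^_) (≡.trans (≡.cong (l₁ ℕ.+_) (≡.sym d+l≡l₂)) (≡.sym (ℕ.+-assoc l₁ d l))))))
               (solve 3 (λ w t c → w :* (t :* c) := t :* (w :* c)) refl _ _ _)) ⟩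
        Σ+ l₂ (λ d l → transfer κ κ′ d * V′ (l₁ ℕ.+ d) l) ∎

    -- The labels of the middle row are at most Σ t by conservation, so that cutting
    -- them off below N > Σ t is harmless.
    Σᵛ-row-row : ∀ N r c κ κ′ {L} (t b : Vec ℕ L) → Vec.sum t ℕ.< N → ∀ j₁ j₂ →
      Σᵛ N L (λ v → row r c κ t v j₁ * (jump (p (r ℕ.+ c)) κ′ j₂ * row (suc r) c κ′ v b j₂))
      ≈ twoRows r c κ κ′ t b j₁ j₂
    Σᵛ-row-row N r c κ κ′ [] [] t<N j₁ zero    = *-congˡ (trans (*-identityʳ _) (trans (*-comm _ _) (q!-inverse 0)))
    Σᵛ-row-row N r c κ κ′ [] [] t<N j₁ (suc _) = *-congˡ (zeroʳ _)
    Σᵛ-row-row N r c κ κ′ {suc L} (k ∷ t) (i ∷ b) t<N j₁ j₂ = begin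
      Σ< N (λ m → Σᵛ N L λ v →
          (λ l₁ → vertex r c κ m l₁ * row r (suc c) κ t v l₁) ⟨ m ℕ.+ j₁ ⊖ k ⟩
          * (y′ j₂ * (λ l₂ → vertex (suc r) c κ′ i l₂ * row (suc r) (suc c) κ′ v b l₂) ⟨ i ℕ.+ j₂ ⊖ m ⟩))
        ≈⟨ Σ<-cong N {g = λ m → (λ l₂ → stay (u c) κ′ ⟨ i ⊖ l₂ ⟩ * F m l₂) ⟨ i ℕ.+ j₂ ⊖ m ⟩} (λ m _ → merge m) ⟩
      Σ< N (λ m → (λ l₂ → stay (u c) κ′ ⟨ i ⊖ l₂ ⟩ * F m l₂) ⟨ i ℕ.+ j₂ ⊖ m ⟩)
        ≈⟨ Σ<-column N i j₂ (stay (u c) κ′) F (λ m l₂ N≤m _ → F≈0 m l₂ N≤m) ⟩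
      Σ+ i (λ l₂ i′ → stay (u c) κ′ i′ * F (i′ ℕ.+ j₂) l₂)
        ≈⟨ (Σ+-cong i λ l₂ i′ _ → split l₂ i′) ⟩
      Σ+ i (λ l₂ i′ → (λ b′ → w′ * (x b′ * y′ j₂ * (stay (u c) κ′ i′ * (λ l₁ → w (i′ ℕ.+ j₂) * y l₁ * V l₁ l₂) ⟨ i′ ℕ.+ j₂ ⊖ b′ ⟩))) ⟨ k ⊖ j₁ ⟩)
        ≈⟨ Σ+-⊖ i k j₁ (λ l₂ i′ b′ → w′ * (x b′ * y′ j₂ * (stay (u c) κ′ i′ * (λ l₁ → w (i′ ℕ.+ j₂) * y l₁ * V l₁ l₂) ⟨ i′ ℕ.+ j₂ ⊖ b′ ⟩))) ⟩
      (λ b′ → Σ+ i λ l₂ i′ → w′ * (x b′ * y′ j₂ * (stay (u c) κ′ i′ * (λ l₁ → w (i′ ℕ.+ j₂) * y l₁ * V l₁ l₂) ⟨ i′ ℕ.+ j₂ ⊖ b′ ⟩))) ⟨ k ⊖ j₁ ⟩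
        ≈⟨ trans (*-distribˡ-⊖ w′ _ k j₁) (⊖-cong k j₁ λ b′ _ → trans (*-congˡ (*-distribˡ-Σ+ i _ _)) (*-distribˡ-Σ+ i w′ _)) ⟨
      w′ * (λ b′ → x b′ * y′ j₂ * Σ+ i λ l₂ i′ → stay (u c) κ′ i′ * (λ l₁ → w (i′ ℕ.+ j₂) * y l₁ * V l₁ l₂) ⟨ i′ ℕ.+ j₂ ⊖ b′ ⟩) ⟨ k ⊖ j₁ ⟩ ∎
      where
      w  = weight (D⁻¹ r c)
      w′ = weight (D⁻¹ (suc r) c) i
      x  = stay (u c) κ
      y  = jump (p (r ℕ.+ c)) κ
      y′ = jump (p (r ℕ.+ c)) κ′
      y″ = jump (p (suc r ℕ.+ c)) κ′
      V : ℕ → ℕ → Carrier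
      V l₁ l₂ = u c ^ (l₁ ℕ.+ l₂) * twoRows r (suc c) κ κ′ t b l₁ l₂
      T : ℕ → ℕ → Carrier
      T l₁ l₂ = Σᵛ N L λ v → row r (suc c) κ t v l₁ * (y″ l₂ * row (suc r) (suc c) κ′ v b l₂)
      E : ℕ → ℕ → ℕ → Carrier
      E m l₁ l₂ = vertex r c κ m l₁ * T l₁ l₂
      F : ℕ → ℕ → Carrier
      F m l₂ = w′ * (u c ^ l₂ * y′ j₂) * (λ l₁ → E m l₁ l₂) ⟨ m ℕ.+ j₁ ⊖ k ⟩
      -- The jump factor of the lower row in column c has the parameter p_{(r+1)+c} = p_{r+(c+1)}:
      -- it is the very factor that `twoRows` takes over from the preceding column.
      T≈ : ∀ l₁ l₂ → T l₁ l₂ ≈ twoRows r (suc c) κ κ′ t b l₁ l₂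
      T≈ l₁ l₂ = trans
        (reflexive (≡.cong (λ n → Σᵛ N L λ v → row r (suc c) κ t v l₁ * (jump (p n) κ′ l₂ * row (suc r) (suc c) κ′ v b l₂))
          (≡.sym (ℕ.+-suc r c))))
        (Σᵛ-row-row N r (suc c) κ κ′ t b (ℕ.≤-<-trans (ℕ.m≤n+m _ k) t<N) l₁ l₂)

      upper : ℕ → Vec ℕ L → ℕ → Carrier
      upper m v l₁ = vertex r c κ m l₁ * row r (suc c) κ t v l₁
      lower : Vec ℕ L → ℕ → Carrier
      lower v l₂ = vertex (suc r) c κ′ i l₂ * row (suc r) (suc c) κ′ v b l₂

      gather : ∀ m l₂ → Σᵛ N L (λ v → upper m v ⟨ m ℕ.+ j₁ ⊖ k ⟩ * (y′ j₂ * lower v l₂))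
                      ≈ stay (u c) κ′ ⟨ i ⊖ l₂ ⟩ * F m l₂
      gather m l₂ = begin
        Σᵛ N L (λ v → upper m v ⟨ m ℕ.+ j₁ ⊖ k ⟩ * (y′ j₂ * lower v l₂))
          ≈⟨ Σᵛ-cong N L (λ v → trans (*-comm _ _) (*-distribˡ-⊖ _ (upper m v) _ k)) ⟩
        Σᵛ N L (λ v → (λ l₁ → y′ j₂ * lower v l₂ * upper m v l₁) ⟨ m ℕ.+ j₁ ⊖ k ⟩)
          ≈⟨ Σᵛ-⊖ N L (m ℕ.+ j₁) k (λ v l₁ → y′ j₂ * lower v l₂ * upper m v l₁) ⟩
        (λ l₁ → Σᵛ N L λ v → y′ j₂ * lower v l₂ * upper m v l₁) ⟨ m ℕ.+ j₁ ⊖ k ⟩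
          ≈⟨ ⊖-cong (m ℕ.+ j₁) k (λ l₁ _ → trans
               (Σᵛ-cong N L λ v → solve 8 (λ y w u j s r′ a r → y :* (w :* (u :* j) :* s :* r′) :* (a :* r)
                    := s :* (w :* (u :* y)) :* a :* (r :* (j :* r′))) refl _ _ _ _ _ _ _ _)
               (trans (sym (*-distribˡ-Σᵛ N L _ _)) (*-assoc _ _ _))) ⟩
        (λ l₁ → s * C * E m l₁ l₂) ⟨ m ℕ.+ j₁ ⊖ k ⟩
          ≈⟨ *-distribˡ-⊖ (s * C) (λ l₁ → E m l₁ l₂) (m ℕ.+ j₁) k ⟨
        s * C * (λ l₁ → E m l₁ l₂) ⟨ m ℕ.+ j₁ ⊖ k ⟩
          ≈⟨ *-assoc _ _ _ ⟩
        s * F m l₂ ∎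
        where
        s = stay (u c) κ′ ⟨ i ⊖ l₂ ⟩
        C = w′ * (u c ^ l₂ * y′ j₂)

      merge : ∀ m → Σᵛ N L (λ v → upper m v ⟨ m ℕ.+ j₁ ⊖ k ⟩ * (y′ j₂ * lower v ⟨ i ℕ.+ j₂ ⊖ m ⟩))
                  ≈ (λ l₂ → stay (u c) κ′ ⟨ i ⊖ l₂ ⟩ * F m l₂) ⟨ i ℕ.+ j₂ ⊖ m ⟩
      merge m = begin
        Σᵛ N L (λ v → upper m v ⟨ m ℕ.+ j₁ ⊖ k ⟩ * (y′ j₂ * lower v ⟨ i ℕ.+ j₂ ⊖ m ⟩))
          ≈⟨ Σᵛ-cong N L (λ v → trans (*-congˡ (*-distribˡ-⊖ (y′ j₂) (lower v) _ m)) (*-distribˡ-⊖ _ _ _ m)) ⟩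
        Σᵛ N L (λ v → (λ l₂ → upper m v ⟨ m ℕ.+ j₁ ⊖ k ⟩ * (y′ j₂ * lower v l₂)) ⟨ i ℕ.+ j₂ ⊖ m ⟩)
          ≈⟨ Σᵛ-⊖ N L (i ℕ.+ j₂) m (λ v l₂ → upper m v ⟨ m ℕ.+ j₁ ⊖ k ⟩ * (y′ j₂ * lower v l₂)) ⟩
        (λ l₂ → Σᵛ N L λ v → upper m v ⟨ m ℕ.+ j₁ ⊖ k ⟩ * (y′ j₂ * lower v l₂)) ⟨ i ℕ.+ j₂ ⊖ m ⟩
          ≈⟨ ⊖-cong (i ℕ.+ j₂) m (λ l₂ _ → gather m l₂) ⟩
        (λ l₂ → stay (u c) κ′ ⟨ i ⊖ l₂ ⟩ * F m l₂) ⟨ i ℕ.+ j₂ ⊖ m ⟩ ∎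

      F≈0 : ∀ m l₂ → N ℕ.≤ m → F m l₂ ≈ 0#
      F≈0 m l₂ N≤m = trans (*-congˡ (trans (⊖-cong (m ℕ.+ j₁) k λ l₁ k+l₁≡ → trans
        (*-congˡ (trans (Σᵛ-cong N L λ v → trans
          (*-congʳ (row-conservation r (suc c) κ t v l₁ λ l₁+v≡t → ℕ.<-irrefl ≡.refl (ℕ.≤-<-trans N≤m (ℕ.≤-<-trans
            (ℕ.≤-trans (ℕ.m≤m+n m j₁) (ℕ.m≤m+n (m ℕ.+ j₁) (Vec.sum v)))
            (ℕ.≤-<-trans (ℕ.≤-reflexive (≡.trans (≡.cong (ℕ._+ Vec.sum v) (≡.sym k+l₁≡))
              (≡.trans (ℕ.+-assoc k l₁ _) (≡.cong (k ℕ.+_) l₁+v≡t)))) t<N)))))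
          (zeroˡ _)) (Σᵛ-0 N L))) (zeroʳ _)) (⊖-0 (m ℕ.+ j₁) k))) (zeroʳ _)

      split : ∀ l₂ i′ → stay (u c) κ′ i′ * F (i′ ℕ.+ j₂) l₂ ≈
        (λ b′ → w′ * (x b′ * y′ j₂ * (stay (u c) κ′ i′ * (λ l₁ → w (i′ ℕ.+ j₂) * y l₁ * V l₁ l₂) ⟨ i′ ℕ.+ j₂ ⊖ b′ ⟩))) ⟨ k ⊖ j₁ ⟩
      split l₂ i′ = begin
        s * (C * (λ l₁ → E m l₁ l₂) ⟨ m ℕ.+ j₁ ⊖ k ⟩)
          ≈⟨ *-congˡ (*-congˡ (trans
               (⊖-cong (m ℕ.+ j₁) k λ l₁ _ → trans (*-congˡ (T≈ l₁ l₂))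
                 (solve 3 (λ a b c → a :* b :* c := b :* (a :* c)) refl _ _ _))
               (⊖-twist f x m j₁ k))) ⟩
        s * (C * (λ b′ → x b′ * f ⟨ m ⊖ b′ ⟩) ⟨ k ⊖ j₁ ⟩)
          ≈⟨ trans (*-congˡ (*-distribˡ-⊖ C _ k j₁)) (*-distribˡ-⊖ s _ k j₁) ⟩
        (λ b′ → s * (C * (x b′ * f ⟨ m ⊖ b′ ⟩))) ⟨ k ⊖ j₁ ⟩
          ≈⟨ ⊖-cong k j₁ (λ b′ _ → trans
               (solve 6 (λ s w u y x f → s :* (w :* (u :* y) :* (x :* f)) := w :* (x :* y :* (s :* (u :* f)))) refl _ _ _ _ _ _)
               (*-congˡ (*-congˡ (*-congˡ (trans (*-distribˡ-⊖ (u c ^ l₂) f m b′) (⊖-cong m b′ λ l₁ _ → trans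
                 (solve 5 (λ u₂ w u₁ y t → u₂ :* (w :* (u₁ :* y) :* t) := w :* y :* (u₁ :* u₂ :* t)) refl _ _ _ _ _)
                 (*-congˡ (*-congʳ (sym (^-homo-* (u c) l₁ l₂)))))))))) ⟩
        _ ∎
        where
        m = i′ ℕ.+ j₂
        s = stay (u c) κ′ i′
        C = w′ * (u c ^ l₂ * y′ j₂)
        f : ℕ → Carrier
        f l₁ = w m * (u c ^ l₁ * y l₁) * twoRows r (suc c) κ κ′ t b l₁ l₂

    -- The middle labels no longer occur in `twoRows`; going back through `Σᵛ-row-row` restores
    -- them, and one of the two single rows must violate conservation.
    twoRows-conservation : ∀ r κ κ′ {L} (t b : Vec ℕ L) j₁ j₂ →
      ¬ j₁ ℕ.+ j₂ ℕ.+ Vec.sum b ≡ Vec.sum t → twoRows r 1 κ κ′ t b j₁ j₂ ≈ 0#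
    twoRows-conservation r κ κ′ {L} t b j₁ j₂ j≢ = begin
      twoRows r 1 κ κ′ t b j₁ j₂
        ≈⟨ Σᵛ-row-row (suc (Vec.sum t)) r 1 κ κ′ t b ℕ.≤-refl j₁ j₂ ⟨
      Σᵛ (suc (Vec.sum t)) L (λ v → row r 1 κ t v j₁ * (jump (p (r ℕ.+ 1)) κ′ j₂ * row (suc r) 1 κ′ v b j₂))
        ≈⟨ Σᵛ-cong (suc (Vec.sum t)) L vanishes ⟩
      Σᵛ (suc (Vec.sum t)) L (λ _ → 0#)
        ≈⟨ Σᵛ-0 (suc (Vec.sum t)) L ⟩
      0# ∎
      where
      vanishes : ∀ v → row r 1 κ t v j₁ * (jump (p (r ℕ.+ 1)) κ′ j₂ * row (suc r) 1 κ′ v b j₂) ≈ 0#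
      vanishes v with j₂ ℕ.+ Vec.sum b ℕ.≟ Vec.sum v
      ... | no  b≢v = trans (*-congˡ (trans (*-congˡ (row-conservation (suc r) 1 κ′ v b j₂ b≢v)) (zeroʳ _))) (zeroʳ _)
      ... | yes b≡v = trans (*-congʳ (row-conservation r 1 κ t v j₁ λ v≡t → j≢
        (≡.trans (ℕ.+-assoc j₁ j₂ _) (≡.trans (≡.cong (j₁ ℕ.+_) b≡v) v≡t)))) (zeroˡ _)

    shifted-zero : ∀ {y} n → y ≈ 0# → shifted q 1# y n ≈ 1#
    shifted-zero zero    y≈0 = refl
    shifted-zero (suc n) y≈0 = trans (*-cong (shifted-zero n y≈0) (+-congˡ (-‿cong (*-congʳ y≈0))))
      (solve 1 (λ x → :1 :* (:1 :- :0 :* x) := :1) refl _)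

    -- Saalschütz at v = 0, where the two symbols containing v become 1. It says that the reservoir
    -- of the upper row absorbs the lift and changes its parameter from κ to κ′.
    jump-transfer : ∀ π κ κ′ k → Σ+ k (λ l d → jump π κ l * transfer κ κ′ d) ≈ jump π κ′ k
    jump-transfer π κ κ′ k = begin
      Σ+ k (λ l d → jump π κ l * transfer κ κ′ d)
        ≈⟨ Σ+-flip k _ ⟩
      Σ+ k (λ g e → jump π κ e * transfer κ κ′ g)
        ≈⟨ (Σ+-cong k λ g e _ → sym (trans
             (*-congˡ (*-congˡ (*-cong (shifted-zero e (zeroʳ _)) (shifted-zero g (trans (*-congʳ (zeroʳ _)) (zeroˡ _))))))
             (solve 4 (λ g e s t → g :* e :* (s :* t :* (:1 :* :1)) := e :* t :* (g :* s)) refl _ _ _ _))) ⟩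
      Σ+ k (λ g e → q!⁻¹ g * q!⁻¹ e * T g e)
        ≈⟨ trans (*-congʳ (trans (*-comm _ _) (q!-inverse k))) (*-identityˡ _) ⟨
      q!⁻¹ k * q! k * Σ+ k (λ g e → q!⁻¹ g * q!⁻¹ e * T g e)
        ≈⟨ trans (*-assoc _ _ _) (*-congˡ (sym (Bin≈Σ+ k T))) ⟩
      q!⁻¹ k * Bin q k T
        ≈⟨ *-congˡ (saalschütz q κ′ κ π 0# k) ⟩
      q!⁻¹ k * (shifted q κ′ π k * shifted q 1# (κ * 0#) k)
        ≈⟨ *-congˡ (trans (*-congˡ (shifted-zero k (zeroʳ _))) (*-identityʳ _)) ⟩
      jump π κ′ k ∎
      where
      T : ℕ → ℕ → Carrier
      T g e = shifted q κ′ κ g * shifted q κ π e * (shifted q 1# (κ′ * 0#) e * shifted q 1# (π * 0# * q ^ e) g)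

    -- Row r together with the reservoir to its left, which emits a with the weight
    -- (κu₀)^a (p_r/κ;q)_a/(q;q)_a.
    emission : ℕ → Carrier → ℕ → Carrier
    emission r κ a = u 0 ^ a * jump (p r) κ a

    fullRow : ∀ N r κ {L} → Vec ℕ L → Vec ℕ L → Carrier
    fullRow N r κ t v = Σ< N λ a → emission r κ a * row r 1 κ t v a

    fullRow-conservation : ∀ N r κ {L} (t v : Vec ℕ L) → Vec.sum t ℕ.< Vec.sum v → fullRow N r κ t v ≈ 0#
    fullRow-conservation N r κ t v t<v = trans
      (Σ<-cong N λ a _ → trans
        (*-congˡ (row-conservation r 1 κ t v a λ a+v≡t →
           ℕ.<-irrefl ≡.refl (ℕ.≤-trans t<v (ℕ.≤-trans (ℕ.m≤n+m _ a) (ℕ.≤-reflexive a+v≡t)))))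
        (zeroʳ (emission r κ a)))
      (Σ<-0 N)

    private
      reservoir : (r : ℕ) → Carrier → Carrier → ∀ {L} → Vec ℕ L → Vec ℕ L → ℕ → ℕ → Carrier
      reservoir r κ κ′ t b a₁ a₂ = u 0 ^ (a₁ ℕ.+ a₂) * (jump (p r) κ a₁ * twoRows r 1 κ κ′ t b a₁ a₂)

      Σᵛ-fullRow-fullRow : ∀ N r κ κ′ {L} (t b : Vec ℕ L) → Vec.sum t ℕ.< N →
        Σᵛ N L (λ v → fullRow N r κ t v * fullRow N (suc r) κ′ v b)
        ≈ Σ< N (λ a₁ → Σ< N (reservoir r κ κ′ t b a₁))
      Σᵛ-fullRow-fullRow N r κ κ′ {L} t b t<N = begin
        Σᵛ N L (λ v → fullRow N r κ t v * fullRow N (suc r) κ′ v b)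
          ≈⟨ (Σᵛ-cong N L λ v → trans (*-comm _ _) (trans (*-distribˡ-Σ< N _ (X v))
               (Σ<-cong N λ a₁ _ → trans (*-comm _ _) (*-distribˡ-Σ< N (X v a₁) (Y v))))) ⟩
        Σᵛ N L (λ v → Σ< N λ a₁ → Σ< N λ a₂ → X v a₁ * Y v a₂)
          ≈⟨ Σᵛ-Σ<-comm N L N (λ v a₁ → Σ< N λ a₂ → X v a₁ * Y v a₂) ⟩
        Σ< N (λ a₁ → Σᵛ N L λ v → Σ< N λ a₂ → X v a₁ * Y v a₂)
          ≈⟨ (Σ<-cong N λ a₁ _ → Σᵛ-Σ<-comm N L N λ v a₂ → X v a₁ * Y v a₂) ⟩
        Σ< N (λ a₁ → Σ< N λ a₂ → Σᵛ N L λ v → X v a₁ * Y v a₂)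
          ≈⟨ (Σ<-cong N λ a₁ _ → Σ<-cong N λ a₂ _ → inner-sum a₁ a₂) ⟩
        Σ< N (λ a₁ → Σ< N (reservoir r κ κ′ t b a₁)) ∎
        where
        X Y : Vec ℕ L → ℕ → Carrier
        X v a = emission r κ a * row r 1 κ t v a
        Y v a = emission (suc r) κ′ a * row (suc r) 1 κ′ v b a

        inner-sum : ∀ a₁ a₂ → Σᵛ N L (λ v → X v a₁ * Y v a₂) ≈ reservoir r κ κ′ t b a₁ a₂
        inner-sum a₁ a₂ = begin
          Σᵛ N L (λ v → X v a₁ * Y v a₂)
            ≈⟨ (Σᵛ-cong N L λ v → trans
                 -- The lower reservoir has the parameter p_{r+1}, which is also that of the upper
                 -- row in column 1; its jump factor is the one that `twoRows` expects there.
                 (*-congˡ (*-congʳ (*-congˡ (reflexive (≡.cong (λ n → jump (p n) κ′ a₂) (ℕ.+-comm 1 r))))))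
                 (solve 6 (λ u₁ j₁ r₁ u₂ j₂ r₂ → (u₁ :* j₁ :* r₁) :* (u₂ :* j₂ :* r₂)
                           := u₁ :* u₂ :* j₁ :* (r₁ :* (j₂ :* r₂))) refl _ _ _ _ _ _)) ⟩
          Σᵛ N L (λ v → C * (row r 1 κ t v a₁ * (jump (p (r ℕ.+ 1)) κ′ a₂ * row (suc r) 1 κ′ v b a₂)))
            ≈⟨ *-distribˡ-Σᵛ N L C _ ⟨
          C * Σᵛ N L (λ v → row r 1 κ t v a₁ * (jump (p (r ℕ.+ 1)) κ′ a₂ * row (suc r) 1 κ′ v b a₂))
            ≈⟨ *-congˡ (Σᵛ-row-row N r 1 κ κ′ t b t<N a₁ a₂) ⟩
          C * twoRows r 1 κ κ′ t b a₁ a₂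
            ≈⟨ trans (*-assoc _ _ _) (*-congʳ (sym (^-homo-* (u 0) a₁ a₂))) ⟩
          reservoir r κ κ′ t b a₁ a₂ ∎
          where C = u 0 ^ a₁ * u 0 ^ a₂ * jump (p r) κ a₁

      -- At fixed J the power of `u 0` is common to all terms. The d units lifted by
      -- `twoRows-exchange` are joined to a₁, and for fixed a = a₁ + d the sum is that of
      -- `jump-transfer`.
      reservoir-exchange : ∀ r κ κ′ {L} (t b : Vec ℕ L) J →
        Σ+ J (reservoir r κ κ′ t b) ≈ Σ+ J (reservoir r κ′ κ t b)
      reservoir-exchange r κ κ′ t b J = begin
        Σ+ J (reservoir r κ κ′ t b)
          ≈⟨ (Σ+-cong J λ a₁ a₂ a₁+a₂≡J → *-cong (reflexive (≡.cong (u 0 ^_) a₁+a₂≡J))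
               (trans (*-congˡ (twoRows-exchange r 1 κ κ′ t b a₁ a₂)) (*-distribˡ-Σ+ a₂ _ _))) ⟩
        Σ+ J (λ a₁ a₂ → u 0 ^ J * Σ+ a₂ (G a₁))
          ≈⟨ *-distribˡ-Σ+ J _ _ ⟨
        u 0 ^ J * Σ+ J (λ a₁ a₂ → Σ+ a₂ (G a₁))
          ≈⟨ *-congˡ (Σ+-assoc J G) ⟨
        u 0 ^ J * Σ+ J (λ a j → Σ+ a λ a₁ d → G a₁ d j)
          ≈⟨ *-distribˡ-Σ+ J _ _ ⟩
        Σ+ J (λ a j → u 0 ^ J * Σ+ a λ a₁ d → G a₁ d j)
          ≈⟨ (Σ+-cong J λ a j a+j≡J → *-cong (reflexive (≡.cong (u 0 ^_) (≡.sym a+j≡J))) (trans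
               (Σ+-cong a λ a₁ d a₁+d≡a → trans
                 (*-congˡ (*-congˡ (reflexive (≡.cong (λ n → twoRows r 1 κ′ κ t b n j) a₁+d≡a))))
                 (solve 3 (λ x y z → x :* (y :* z) := z :* (x :* y)) refl _ _ _))
               (trans (sym (*-distribˡ-Σ+ a _ _)) (trans (*-congˡ (jump-transfer (p r) κ κ′ a)) (*-comm _ _))))) ⟩
        Σ+ J (reservoir r κ′ κ t b) ∎
        where
        G : ℕ → ℕ → ℕ → Carrier
        G a₁ d j = jump (p r) κ a₁ * (transfer κ κ′ d * twoRows r 1 κ′ κ t b (a₁ ℕ.+ d) j)

    -- The lift does not respect the square a₁, a₂ < N. Conservation cuts the square down to the
    -- antidiagonal a₁ + a₂ = Σ t - Σ b, which it does respect, or to nothing when Σ b > Σ t.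
    fullRow-exchange : ∀ N r κ κ′ {L} (t b : Vec ℕ L) → Vec.sum t ℕ.< N →
      Σᵛ N L (λ v → fullRow N r κ t v * fullRow N (suc r) κ′ v b)
      ≈ Σᵛ N L (λ v → fullRow N r κ′ t v * fullRow N (suc r) κ v b)
    fullRow-exchange N r κ κ′ {L} t b t<N = trans (Σᵛ-fullRow-fullRow N r κ κ′ t b t<N)
      (trans (main (Vec.sum b ℕ.≤? Vec.sum t)) (sym (Σᵛ-fullRow-fullRow N r κ′ κ t b t<N)))
      where
      Total : Carrier → Carrier → Carrier
      Total κ κ′ = Σ< N (λ a₁ → Σ< N (reservoir r κ κ′ t b a₁))

      zero-outside : ∀ κ κ′ a₁ a₂ → ¬ a₁ ℕ.+ a₂ ℕ.+ Vec.sum b ≡ Vec.sum t → reservoir r κ κ′ t b a₁ a₂ ≈ 0#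
      zero-outside κ κ′ a₁ a₂ a≢ = trans
        (*-congˡ (trans (*-congˡ (twoRows-conservation r κ κ′ t b a₁ a₂ a≢)) (zeroʳ _))) (zeroʳ _)

      main : Dec (Vec.sum b ℕ.≤ Vec.sum t) → Total κ κ′ ≈ Total κ′ κ
      main (yes b≤t) = trans (square κ κ′) (trans (reservoir-exchange r κ κ′ t b J) (sym (square κ′ κ)))
        where
        J = Vec.sum t ∸ Vec.sum b
        square : ∀ κ κ′ → Total κ κ′ ≈ Σ+ J (reservoir r κ κ′ t b)
        square κ κ′ = Σ<-square N J (reservoir r κ κ′ t b) (ℕ.≤-<-trans (ℕ.m∸n≤m (Vec.sum t) (Vec.sum b)) t<N)
          λ a₁ a₂ a≢J → zero-outside κ κ′ a₁ a₂ λ a+b≡t →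
            a≢J (≡.trans (≡.sym (ℕ.m+n∸n≡m (a₁ ℕ.+ a₂) (Vec.sum b))) (≡.cong (_∸ Vec.sum b) a+b≡t))
      main (no b≰t) = trans (vanish κ κ′) (sym (vanish κ′ κ))
        where
        vanish : ∀ κ κ′ → Total κ κ′ ≈ 0#
        vanish κ κ′ = trans (Σ<-cong N λ a₁ _ → trans (Σ<-cong N λ a₂ _ →
          zero-outside κ κ′ a₁ a₂ λ a+b≡t → b≰t (ℕ.≤-trans (ℕ.m≤n+m _ (a₁ ℕ.+ a₂)) (ℕ.≤-reflexive a+b≡t)))
          (Σ<-0 N)) (Σ<-0 N)

    -- The row parameters form a list, so that symmetry becomes invariance under `_↭_`, for which
    -- exchanges of neighbours suffice; `f` is the weight of the bottom boundary.
    chain : ∀ N r → List Carrier → ∀ {L} → Vec ℕ L → (Vec ℕ L → Carrier) → Carrier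
    chain N r []           t f = f t
    chain N r (κ ∷ κs) {L} t f = Σᵛ N L λ v → fullRow N r κ t v * chain N (suc r) κs v f

    -- The hypothesis is available for Σ v < N only. This holds when Σ v ≤ Σ t, and otherwise the
    -- first row vanishes.
    chain-prep : ∀ N r κ κs κs′ {L} (t : Vec ℕ L) f → Vec.sum t ℕ.< N →
      (∀ v → Vec.sum v ℕ.< N → chain N (suc r) κs v f ≈ chain N (suc r) κs′ v f) →
      chain N r (κ ∷ κs) t f ≈ chain N r (κ ∷ κs′) t f
    chain-prep N r κ κs κs′ {L} t f t<N κs≈κs′ = Σᵛ-cong N L below
      where
      below : ∀ v → fullRow N r κ t v * chain N (suc r) κs v f ≈ fullRow N r κ t v * chain N (suc r) κs′ v f
      below v with Vec.sum v ℕ.≤? Vec.sum t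
      ... | yes v≤t = *-congˡ (κs≈κs′ v (ℕ.≤-<-trans v≤t t<N))
      ... | no  v≰t = trans (vanish _) (sym (vanish _))
        where
        vanish : ∀ x → fullRow N r κ t v * x ≈ 0#
        vanish x = trans (*-congʳ (fullRow-conservation N r κ t v (ℕ.≰⇒> v≰t))) (zeroˡ x)

    chain-↭ : ∀ N r {κs κs′} → κs ↭ κs′ → ∀ {L} (t : Vec ℕ L) f → Vec.sum t ℕ.< N →
              chain N r κs t f ≈ chain N r κs′ t f
    chain-↭ N r ↭-refl t f t<N = refl
    chain-↭ N r (prep {κs} {κs′} κ κs↭) t f t<N = chain-prep N r κ κs κs′ t f t<N λ v → chain-↭ N (suc r) κs↭ v f
    chain-↭ N r (swap {κs} {κs′} κ κ′ κs↭) {L} t f t<N = begin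
      chain N r (κ ∷ κ′ ∷ κs) t f    ≈⟨ regroup κ κ′ ⟩
      Σᵛ N L (λ w → Σᵛ N L (λ v → fullRow N r κ t v * fullRow N (suc r) κ′ v w) * chain N (suc (suc r)) κs w f)
        ≈⟨ (Σᵛ-cong N L λ w → *-congʳ (fullRow-exchange N r κ κ′ t w t<N)) ⟩
      Σᵛ N L (λ w → Σᵛ N L (λ v → fullRow N r κ′ t v * fullRow N (suc r) κ v w) * chain N (suc (suc r)) κs w f)
                                     ≈⟨ regroup κ′ κ ⟨
      chain N r (κ′ ∷ κ ∷ κs) t f    ≈⟨ (chain-prep N r κ′ (κ ∷ κs) (κ ∷ κs′) t f t<N λ v v<N →
                                        chain-prep N (suc r) κ κs κs′ v f v<N λ w → chain-↭ N (suc (suc r)) κs↭ w f) ⟩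
      chain N r (κ′ ∷ κ ∷ κs′) t f   ∎
      where
      regroup : ∀ κ κ′ → chain N r (κ ∷ κ′ ∷ κs) t f ≈
        Σᵛ N L (λ w → Σᵛ N L (λ v → fullRow N r κ t v * fullRow N (suc r) κ′ v w) * chain N (suc (suc r)) κs w f)
      regroup κ κ′ = begin
        Σᵛ N L (λ v → fullRow N r κ t v * Σᵛ N L λ w → fullRow N (suc r) κ′ v w * chain N (suc (suc r)) κs w f)
          ≈⟨ (Σᵛ-cong N L λ v → trans (*-distribˡ-Σᵛ N L _ _) (Σᵛ-cong N L λ w → trans (sym (*-assoc _ _ _)) (*-comm _ _))) ⟩
        Σᵛ N L (λ v → Σᵛ N L λ w → chain N (suc (suc r)) κs w f * (fullRow N r κ t v * fullRow N (suc r) κ′ v w))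
          ≈⟨ Σᵛ-comm N L L (λ v w → chain N (suc (suc r)) κs w f * (fullRow N r κ t v * fullRow N (suc r) κ′ v w)) ⟩
        Σᵛ N L (λ w → Σᵛ N L λ v → chain N (suc (suc r)) κs w f * (fullRow N r κ t v * fullRow N (suc r) κ′ v w))
          ≈⟨ (Σᵛ-cong N L λ w → trans (sym (*-distribˡ-Σᵛ N L _ _)) (*-comm _ _)) ⟩
        _ ∎
    chain-↭ N r (↭-trans κs↭ ↭κs″) t f t<N = trans (chain-↭ N r κs↭ t f t<N) (chain-↭ N r ↭κs″ t f t<N)

-- Indicators of decidable propositions.

module Indicators {c ℓ₁ ℓ₂} (K : HeytingField c ℓ₁ ℓ₂) where

  open FieldNotation K

  𝟙-yes : ∀ {p} {P : Set p} (P? : Dec P) → P → 𝟙 P? ≈ 1#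
  𝟙-yes (yes _) p = refl
  𝟙-yes (no ¬p) p = contradiction p ¬p

  𝟙-no : ∀ {p} {P : Set p} (P? : Dec P) → ¬ P → 𝟙 P? ≈ 0#
  𝟙-no (yes p) ¬p = contradiction p ¬p
  𝟙-no (no _)  ¬p = refl

  𝟙-⇔ : ∀ {p q} {P : Set p} {Q : Set q} (P? : Dec P) (Q? : Dec Q) → (P → Q) → (Q → P) → 𝟙 P? ≈ 𝟙 Q?
  𝟙-⇔ (yes p) Q? to from = sym (𝟙-yes Q? (to p))
  𝟙-⇔ (no ¬p) Q? to from = sym (𝟙-no Q? (¬p ∘ from))

  𝟙-× : ∀ {p q r} {P : Set p} {Q : Set q} {R : Set r} (P? : Dec P) (Q? : Dec Q) (R? : Dec R) →
        (P → Q × R) → (Q → R → P) → 𝟙 P? ≈ 𝟙 Q? * 𝟙 R?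
  𝟙-× P? (yes q) R? to from = trans (𝟙-⇔ P? R? (proj₂ ∘ to) (from q)) (sym (*-identityˡ _))
  𝟙-× P? (no ¬q) R? to from = trans (𝟙-no P? (¬q ∘ proj₁ ∘ to)) (sym (zeroˡ _))

-- Polynomial functions and the uniqueness of their coefficients.

module PolynomialFunctions {c ℓ₁ ℓ₂} (K : HeytingField c ℓ₁ ℓ₂) where

  open FieldNotation K
  open Polynomials K
  open Indicators K
  open CommutativeRing commutativeRing using (semiring; commutativeSemiring; *-commutativeMonoid)
  open FiniteSums commutativeRing
  open IntegerSolver commutativeRing hiding (Polynomial)
  open CommutativeSemiringExp commutativeSemiring using (^-distrib-*)
  open SemiringExp semiring using (^-homo-*)
  open SetoidReasoning setoid
  private module Π = CommutativeMonoidSum *-commutativeMonoid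

  monomial : ∀ {n} → Vec ℕ n → Vector Carrier n → Carrier
  monomial {n} e x = ∏[ i < n ] (x i ^ lookup e i)

  ⟦⟧-++ : ∀ {n} (P Q : Polynomial n) x → ⟦ P ++ Q ⟧ x ≈ ⟦ P ⟧ x + ⟦ Q ⟧ x
  ⟦⟧-++ []            Q x = sym (+-identityˡ _)
  ⟦⟧-++ ((a , e) ∷ P) Q x = trans (+-congˡ (⟦⟧-++ P Q x)) (sym (+-assoc _ _ _))

  scale : ∀ {n} → Carrier → Vec ℕ n → Polynomial n → Polynomial n
  scale a e = List.map λ (b , f) → a * b , Vec.zipWith ℕ._+_ e f

  monomial-+ : ∀ {n} (e f : Vec ℕ n) x → monomial (Vec.zipWith ℕ._+_ e f) x ≈ monomial e x * monomial f x
  monomial-+ {n} e f x = trans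
    (Π.sum-cong-≋ λ i → trans (reflexive (≡.cong (x i ^_) (Vec.lookup-zipWith ℕ._+_ i e f))) (^-homo-* (x i) (lookup e i) (lookup f i)))
    (Π.∑-distrib-+ (λ i → x i ^ lookup e i) (λ i → x i ^ lookup f i))

  ⟦⟧-scale : ∀ {n} a e (P : Polynomial n) x → ⟦ scale a e P ⟧ x ≈ a * monomial e x * ⟦ P ⟧ x
  ⟦⟧-scale a e []            x = sym (zeroʳ _)
  ⟦⟧-scale a e ((b , f) ∷ P) x = trans
    (+-cong (*-congˡ (monomial-+ e f x)) (⟦⟧-scale a e P x))
    (solve 5 (λ a b m n p → a :* b :* (m :* n) :+ a :* m :* p := a :* m :* (b :* n :+ p)) refl _ _ _ _ _)

  _⊠_ : ∀ {n} → Polynomial n → Polynomial n → Polynomial n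
  []            ⊠ Q = []
  ((a , e) ∷ P) ⊠ Q = scale a e Q ++ (P ⊠ Q)

  ⟦⟧-⊠ : ∀ {n} (P Q : Polynomial n) x → ⟦ P ⊠ Q ⟧ x ≈ ⟦ P ⟧ x * ⟦ Q ⟧ x
  ⟦⟧-⊠ []            Q x = sym (zeroˡ _)
  ⟦⟧-⊠ ((a , e) ∷ P) Q x = begin
    ⟦ scale a e Q ++ (P ⊠ Q) ⟧ x                           ≈⟨ ⟦⟧-++ (scale a e Q) (P ⊠ Q) x ⟩
    ⟦ scale a e Q ⟧ x + ⟦ P ⊠ Q ⟧ x                        ≈⟨ +-cong (⟦⟧-scale a e Q x) (⟦⟧-⊠ P Q x) ⟩
    a * monomial e x * ⟦ Q ⟧ x + ⟦ P ⟧ x * ⟦ Q ⟧ x         ≈⟨ distribʳ _ _ _ ⟨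
    (a * monomial e x + ⟦ P ⟧ x) * ⟦ Q ⟧ x                 ∎

  -- Agreement is demanded at all points, zero coordinates included; the chain of rows, free of
  -- division by κ, meets this.
  IsPolynomial : ∀ {n} → (Vector Carrier n → Carrier) → Set (c ⊔ ℓ₁)
  IsPolynomial {n} f = ∃[ P ] (∀ x → f x ≈ ⟦_⟧ {n} P x)

  module _ {n : ℕ} where

    constant : ∀ a → IsPolynomial {n} (λ _ → a)
    constant a = (a , Vec.replicate n 0) ∷ [] , λ x → sym (trans (+-identityʳ _) (trans
      (*-congˡ (trans (Π.sum-cong-≋ λ i → reflexive (≡.cong (x i ^_) (Vec.lookup-replicate i 0))) (Π.sum-replicate-zero n))) (*-identityʳ a)))

    coordinate : ∀ i → IsPolynomial {n} (λ x → x i)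
    coordinate i = (1# , unit i) ∷ [] , λ x → sym (trans (+-identityʳ _) (trans (*-identityˡ _) (monomial-unit i x)))
      where
      unit : ∀ {n} → Fin n → Vec ℕ n
      unit {suc n} zero    = 1 ∷ Vec.replicate n 0
      unit {suc n} (suc i) = 0 ∷ unit i
      monomial-unit : ∀ {n} i (x : Vector Carrier n) → monomial (unit i) x ≈ x i
      monomial-unit {suc n} zero    x = trans (*-cong (*-identityʳ (x zero))
        (trans (Π.sum-cong-≋ λ i → reflexive (≡.cong (x (suc i) ^_) (Vec.lookup-replicate i 0))) (Π.sum-replicate-zero n))) (*-identityʳ _)
      monomial-unit {suc n} (suc i) x = trans (*-identityˡ _) (monomial-unit i (x ∘ suc))

    infixl 6 _⊞_
    infixl 7 _⊡_
    _⊞_ : ∀ {f g} → IsPolynomial {n} f → IsPolynomial g → IsPolynomial (λ x → f x + g x)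
    (P , f≈) ⊞ (Q , g≈) = P ++ Q , λ x → trans (+-cong (f≈ x) (g≈ x)) (sym (⟦⟧-++ P Q x))

    _⊡_ : ∀ {f g} → IsPolynomial {n} f → IsPolynomial g → IsPolynomial (λ x → f x * g x)
    (P , f≈) ⊡ (Q , g≈) = P ⊠ Q , λ x → trans (*-cong (f≈ x) (g≈ x)) (sym (⟦⟧-⊠ P Q x))

    respects : ∀ {f g} → (∀ x → f x ≈ g x) → IsPolynomial {n} g → IsPolynomial f
    respects f≈g (P , g≈) = P , λ x → trans (f≈g x) (g≈ x)

    negate : ∀ {f} → IsPolynomial {n} f → IsPolynomial (λ x → - f x)
    negate {f} F = respects (λ x → solve 1 (λ a → :- a := (:- :1) :* a) refl (f x)) (constant (- 1#) ⊡ F)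

    Σ<-polynomial : ∀ k {f : Vector Carrier n → ℕ → Carrier} → (∀ m → IsPolynomial (λ x → f x m)) → IsPolynomial (λ x → Σ< k (f x))
    Σ<-polynomial zero    F = constant 0#
    Σ<-polynomial (suc k) F = F 0 ⊞ Σ<-polynomial k (λ m → F (suc m))

    ⊖-polynomial : ∀ {f : Vector Carrier n → ℕ → Carrier} → (∀ m → IsPolynomial (λ x → f x m)) → ∀ k d → IsPolynomial (λ x → f x ⟨ k ⊖ d ⟩)
    ⊖-polynomial F k       zero    = F k
    ⊖-polynomial F zero    (suc d) = constant 0#
    ⊖-polynomial F (suc k) (suc d) = ⊖-polynomial F k d

  coefficient-++ : ∀ {n} (P Q : Polynomial n) e → coefficient (P ++ Q) e ≈ coefficient P e + coefficient Q e
  coefficient-++ []            Q e = sym (+-identityˡ _)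
  coefficient-++ ((a , f) ∷ P) Q e = trans (+-congˡ (coefficient-++ P Q e)) (sym (+-assoc _ _ _))

  opposite : ∀ {n} → Polynomial n → Polynomial n
  opposite = List.map λ (a , e) → - a , e

  ⟦⟧-opposite : ∀ {n} (P : Polynomial n) x → ⟦ opposite P ⟧ x ≈ - ⟦ P ⟧ x
  ⟦⟧-opposite []            x = solve 0 (:0 := :- :0) refl
  ⟦⟧-opposite ((a , e) ∷ P) x = trans (+-congˡ (⟦⟧-opposite P x))
    (solve 3 (λ a m p → (:- a) :* m :+ (:- p) := :- (a :* m :+ p)) refl _ _ _)

  coefficient-opposite : ∀ {n} (P : Polynomial n) e → coefficient (opposite P) e ≈ - coefficient P e
  coefficient-opposite []            e = solve 0 (:0 := :- :0) refl
  coefficient-opposite ((a , f) ∷ P) e = trans (+-congˡ (coefficient-opposite P e))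
    (solve 3 (λ a m p → m :* (:- a) :+ (:- p) := :- (m :* a :+ p)) refl _ _ _)

  -- The polynomial in the remaining variables that multiplies x₀^d.
  slice : ∀ {n} → Polynomial (suc n) → ℕ → Polynomial n
  slice P d = List.map (λ { (a , k ∷ e) → 𝟙 (d ℕ.≟ k) * a , e }) P

  coefficient-slice : ∀ {n} (P : Polynomial (suc n)) d e → coefficient (slice P d) e ≈ coefficient P (d ∷ e)
  coefficient-slice []                d e = refl
  coefficient-slice ((a , k ∷ f) ∷ P) d e = +-cong
    (trans (sym (*-assoc _ _ _)) (*-congʳ (trans (*-comm _ _)
      (sym (𝟙-× (Vec.≡-dec ℕ._≟_ (d ∷ e) (k ∷ f)) (d ℕ.≟ k) (Vec.≡-dec ℕ._≟_ e f) Vec.∷-injective (≡.cong₂ _∷_))))))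
    (coefficient-slice P d e)

  -- One more than the largest exponent of x₀ that is listed, hence a strict bound, as `Σ<`
  -- requires.
  degree : ∀ {n} → Polynomial (suc n) → ℕ
  degree []                = 0
  degree ((a , k ∷ e) ∷ P) = suc k ℕ.⊔ degree P

  -- An arbitrary bound D serves the head and the tail of the list alike, and lets a later argument
  -- reach a coefficient beyond the degree.
  ⟦⟧-slices : ∀ {n} (P : Polynomial (suc n)) D → degree P ℕ.≤ D → ∀ x₀ x →
              ⟦ P ⟧ (x₀ Vector.∷ x) ≈ Σ< D (λ d → ⟦ slice P d ⟧ x * x₀ ^ d)
  ⟦⟧-slices []                D _   x₀ x = sym (trans (Σ<-cong D λ d _ → zeroˡ (x₀ ^ d)) (Σ<-0 D))
  ⟦⟧-slices ((a , k ∷ e) ∷ P) D P≤D x₀ x = begin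
    a * (x₀ ^ k * monomial e x) + ⟦ P ⟧ (x₀ Vector.∷ x)
      ≈⟨ +-cong first (⟦⟧-slices P D (ℕ.≤-trans (ℕ.m≤n⊔m (suc k) (degree P)) P≤D) x₀ x) ⟩
    Σ< D (λ d → 𝟙 (d ℕ.≟ k) * a * monomial e x * x₀ ^ d) + Σ< D (λ d → ⟦ slice P d ⟧ x * x₀ ^ d)
      ≈⟨ Σ<-distrib D _ _ ⟨
    Σ< D (λ d → 𝟙 (d ℕ.≟ k) * a * monomial e x * x₀ ^ d + ⟦ slice P d ⟧ x * x₀ ^ d)
      ≈⟨ Σ<-cong D (λ d _ → sym (distribʳ (x₀ ^ d) _ _)) ⟩
    Σ< D (λ d → (𝟙 (d ℕ.≟ k) * a * monomial e x + ⟦ slice P d ⟧ x) * x₀ ^ d) ∎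
    where
    first : a * (x₀ ^ k * monomial e x) ≈ Σ< D (λ d → 𝟙 (d ℕ.≟ k) * a * monomial e x * x₀ ^ d)
    first = sym (begin
      Σ< D (λ d → 𝟙 (d ℕ.≟ k) * a * monomial e x * x₀ ^ d)
        ≈⟨ Σ<-single D k _ (ℕ.≤-trans (ℕ.m≤m⊔n (suc k) (degree P)) P≤D)
             (λ d d≢k → trans (*-congʳ (*-congʳ (*-congʳ (𝟙-no (d ℕ.≟ k) d≢k))))
               (solve 3 (λ a m x → :0 :* a :* m :* x := :0) refl _ _ _)) ⟩
      𝟙 (k ℕ.≟ k) * a * monomial e x * x₀ ^ k
        ≈⟨ *-congʳ (*-congʳ (*-congʳ (𝟙-yes (k ℕ.≟ k) ≡.refl))) ⟩
      1# * a * monomial e x * x₀ ^ k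
        ≈⟨ solve 3 (λ a m x → :1 :* a :* m :* x := a :* (x :* m)) refl _ _ _ ⟩
      a * (x₀ ^ k * monomial e x) ∎)

  module Identity (q : Carrier) (q#0 : q # 0#) (1-q^ : ∀ n → (1# - q ^ suc n) # 0#) where

    cancel : ∀ {x y} → x # 0# → x * y ≈ 0# → y ≈ 0#
    cancel {x} {y} x#0 xy≈0 = begin
      y                         ≈⟨ *-identityˡ y ⟨
      1# * y                    ≈⟨ *-congʳ (inverseˡ x#0) ⟨
      inverse x x#0 * x * y     ≈⟨ *-assoc _ _ _ ⟩
      inverse x x#0 * (x * y)   ≈⟨ *-congˡ xy≈0 ⟩
      inverse x x#0 * 0#        ≈⟨ zeroʳ _ ⟩
      0#                        ∎

    -- p(x) − p(qx) has no constant term and the coefficients (1 − q^d) c_d.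
    vanishing-coefficients : ∀ D (a : ℕ → Carrier) → (∀ x → x # 0# → Σ< D (λ d → a d * x ^ d) ≈ 0#) →
                             ∀ d → d ℕ.< D → a d ≈ 0#
    vanishing-coefficients (suc D) a p≈0 = λ
      { zero    _           → constant≈0
      ; (suc d) (ℕ.s≤s d<D) → higher d d<D }
      where
      difference : ∀ x → x # 0# → Σ< D (λ d → (1# - q ^ suc d) * a (suc d) * x ^ d) ≈ 0#
      -- The constant terms of p(x) and p(qx) cancel, so x divides the difference and one term fewer
      -- remains. The point qx is again admissible because q is nonzero.
      difference x x#0 = cancel x#0 (begin
        x * Σ< D (λ d → (1# - q ^ suc d) * a (suc d) * x ^ d)
          ≈⟨ *-distribˡ-Σ< D x _ ⟩
        Σ< D (λ d → x * ((1# - q ^ suc d) * a (suc d) * x ^ d))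
          ≈⟨ (Σ<-cong D λ d _ → trans
               (solve 4 (λ x s a y → x :* ((:1 :- s) :* a :* y) := a :* (x :* y) :+ (:- :1) :* (a :* (s :* (x :* y)))) refl x (q ^ suc d) (a (suc d)) (x ^ d))
               (+-congˡ (*-congˡ (*-congˡ (sym (^-distrib-* q x (suc d))))))) ⟩
        Σ< D (λ d → a (suc d) * x ^ suc d + - 1# * (a (suc d) * (q * x) ^ suc d))
          ≈⟨ trans (Σ<-distrib D _ _) (+-congˡ (sym (*-distribˡ-Σ< D (- 1#) _))) ⟩
        tail x + - 1# * tail (q * x)
          ≈⟨ solve 3 (λ c s t → s :+ (:- :1) :* t := (c :* :1 :+ s) :- (c :* :1 :+ t)) refl (a 0) _ _ ⟩
        (a 0 * 1# + tail x) - (a 0 * 1# + tail (q * x))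
          ≈⟨ +-cong (p≈0 x x#0) (-‿cong (p≈0 (q * x) (x#0y#0→xy#0 q#0 x#0))) ⟩
        0# - 0#
          ≈⟨ -‿inverseʳ 0# ⟩
        0# ∎)
        where
        tail : Carrier → Carrier
        tail x = Σ< D (λ d → a (suc d) * x ^ suc d)

      higher : ∀ d → d ℕ.< D → a (suc d) ≈ 0#
      higher d d<D = cancel (1-q^ d)
        (vanishing-coefficients D (λ d → (1# - q ^ suc d) * a (suc d)) difference d d<D)

      constant≈0 : a 0 ≈ 0#
      constant≈0 = begin
        a 0                                            ≈⟨ trans (+-identityʳ _) (*-identityʳ _) ⟨
        a 0 * 1# + 0#                                  ≈⟨ +-congˡ (trans (Σ<-cong D λ d d<D → trans (*-congʳ (higher d d<D)) (zeroˡ _)) (Σ<-0 D)) ⟨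
        Σ< (suc D) (λ d → a d * 1# ^ d)                ≈⟨ p≈0 1# 1#0 ⟩
        0#                                             ∎

    -- With the other variables fixed, the value of each slice is a coefficient of a polynomial in
    -- x₀ alone and so vanishes. As this holds at every point, the slice is a zero function of one
    -- variable less.
    zero-function⇒zero-coefficients : ∀ {n} (P : Polynomial n) → (∀ x → ⟦ P ⟧ x ≈ 0#) → ∀ e → coefficient P e ≈ 0#
    zero-function⇒zero-coefficients {zero} P P≈0 [] = trans (evaluate P) (P≈0 λ ())
      where
      evaluate : ∀ (P : Polynomial 0) → coefficient P [] ≈ ⟦ P ⟧ λ ()
      evaluate []             = refl
      evaluate ((a , []) ∷ P) = +-cong (*-comm _ _) (evaluate P)
    zero-function⇒zero-coefficients {suc n} P P≈0 (d ∷ e) = trans (sym (coefficient-slice P d e))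
      (zero-function⇒zero-coefficients (slice P d) slice≈0 e)
      where
      D = suc d ℕ.⊔ degree P
      slice≈0 : ∀ x → ⟦ slice P d ⟧ x ≈ 0#
      slice≈0 x = vanishing-coefficients D (λ d → ⟦ slice P d ⟧ x)
        (λ x₀ _ → trans (sym (⟦⟧-slices P D (ℕ.m≤n⊔m (suc d) (degree P)) x₀ x)) (P≈0 (x₀ Vector.∷ x)))
        d (ℕ.m≤m⊔n (suc d) (degree P))

    coefficient-unique : ∀ {n} (P Q : Polynomial n) → (∀ x → ⟦ P ⟧ x ≈ ⟦ Q ⟧ x) → ∀ e → coefficient P e ≈ coefficient Q e
    coefficient-unique P Q P≈Q e = begin
      coefficient P e
        ≈⟨ solve 2 (λ a b → a := (a :+ (:- b)) :+ b) refl _ _ ⟩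
      coefficient P e + - coefficient Q e + coefficient Q e
        ≈⟨ +-congʳ (trans (+-congˡ (sym (coefficient-opposite Q e))) (sym (coefficient-++ P (opposite Q) e))) ⟩
      coefficient (P ++ opposite Q) e + coefficient Q e
        ≈⟨ +-congʳ (zero-function⇒zero-coefficients (P ++ opposite Q) difference≈0 e) ⟩
      0# + coefficient Q e
        ≈⟨ +-identityˡ _ ⟩
      coefficient Q e ∎
      where
      difference≈0 : ∀ x → ⟦ P ++ opposite Q ⟧ x ≈ 0#
      difference≈0 x = trans (⟦⟧-++ P (opposite Q) x) (trans (+-cong (P≈Q x) (⟦⟧-opposite Q x)) (-‿inverseʳ _))

    -- Permuting the exponents in P yields a representation of the same function, so the uniqueness
    -- of coefficients makes P itself symmetric.
    symmetric : ∀ {n} (f : Vector Carrier n → Carrier) → (∀ (π : Permutation′ n) x → f (x ∘ (π ⟨$⟩ʳ_)) ≈ f x) →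
                ((P , _) : IsPolynomial f) → Symmetric P
    symmetric {n} f f-symmetric (P , f≈) π e = begin
      coefficient P (permute e)                ≈⟨ coefficient-unique P (permuted P) agree (permute e) ⟩
      coefficient (permuted P) (permute e)     ≈⟨ coefficient-permuted P ⟩
      coefficient P e                          ∎
      where
      permute : Vec ℕ n → Vec ℕ n
      permute e = tabulate λ i → lookup e (π ⟨$⟩ʳ i)

      permuted : Polynomial n → Polynomial n
      permuted = List.map λ (a , e) → a , permute e

      permute-injective : ∀ e e′ → permute e ≡ permute e′ → e ≡ e′
      permute-injective e e′ eq = ≡.trans (≡.sym (Vec.tabulate∘lookup e)) (≡.trans (Vec.tabulate-cong λ i →
        ≡.trans (≡.cong (lookup e) (≡.sym (Permutation.inverseʳ π))) (≡.trans (pointwise (π ⟨$⟩ˡ i)) (≡.cong (lookup e′) (Permutation.inverseʳ π))))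
        (Vec.tabulate∘lookup e′))
        where
        pointwise : ∀ i → lookup e (π ⟨$⟩ʳ i) ≡ lookup e′ (π ⟨$⟩ʳ i)
        pointwise i = ≡.trans (≡.sym (Vec.lookup∘tabulate _ i)) (≡.trans (≡.cong (λ v → lookup v i) eq) (Vec.lookup∘tabulate _ i))

      coefficient-permuted : ∀ P → coefficient (permuted P) (permute e) ≈ coefficient P e
      coefficient-permuted []             = refl
      coefficient-permuted ((a , e′) ∷ P) = +-cong
        (*-congʳ (𝟙-⇔ (Vec.≡-dec ℕ._≟_ (permute e) (permute e′)) (Vec.≡-dec ℕ._≟_ e e′) (permute-injective e e′) (≡.cong permute)))
        (coefficient-permuted P)

      ⟦⟧-permuted : ∀ P x → ⟦ permuted P ⟧ (x ∘ (π ⟨$⟩ʳ_)) ≈ ⟦ P ⟧ x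
      ⟦⟧-permuted []             x = refl
      ⟦⟧-permuted ((a , e) ∷ P) x = +-cong
        (*-congˡ (trans (Π.sum-cong-≋ λ i → reflexive (≡.cong (x (π ⟨$⟩ʳ i) ^_) (Vec.lookup∘tabulate _ i)))
          (sym (Π.∑-permute (λ i → x i ^ lookup e i) π))))
        (⟦⟧-permuted P x)

      -- A permutation and its inverse cancel pointwise only; the evaluation of a polynomial
      -- respects pointwise equality, which is not assumed of `f`.
      ⟦⟧-cong : ∀ P {x y : Vector Carrier n} → (∀ i → x i ≡ y i) → ⟦ P ⟧ x ≈ ⟦ P ⟧ y
      ⟦⟧-cong []            x≡y = refl
      ⟦⟧-cong ((a , e) ∷ P) x≡y = +-cong
        (*-congˡ (Π.sum-cong-≋ λ i → reflexive (≡.cong (_^ lookup e i) (x≡y i)))) (⟦⟧-cong P x≡y)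

      agree : ∀ y → ⟦ P ⟧ y ≈ ⟦ permuted P ⟧ y
      agree y = begin
        ⟦ P ⟧ y                               ≈⟨ ⟦⟧-cong P (λ i → ≡.cong y (≡.sym (Permutation.inverseˡ π))) ⟩
        ⟦ P ⟧ (x ∘ (π ⟨$⟩ʳ_))                 ≈⟨ f≈ _ ⟨
        f (x ∘ (π ⟨$⟩ʳ_))                     ≈⟨ f-symmetric π x ⟩
        f x                                   ≈⟨ f≈ x ⟩
        ⟦ P ⟧ x                               ≈⟨ ⟦⟧-permuted P x ⟨
        ⟦ permuted P ⟧ (x ∘ (π ⟨$⟩ʳ_))        ≈⟨ ⟦⟧-cong (permuted P) (λ i → ≡.cong y (Permutation.inverseˡ π)) ⟩
        ⟦ permuted P ⟧ y                      ∎
        where x = y ∘ (π ⟨$⟩ˡ_)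

-- From lattice configurations to chains of rows, and their polynomiality.

module Configurations {c ℓ₁ ℓ₂} (K : HeytingField c ℓ₁ ℓ₂) where

  open FieldNotation K
  open Indicators K
  open PolynomialFunctions K
  open CommutativeRing commutativeRing using (*-commutativeMonoid)
  open QBinomial commutativeRing
  open FiniteSums commutativeRing
  open VectorSums commutativeRing
  open RowTransfer commutativeRing
  open IntegerSolver commutativeRing hiding (Polynomial)
  open SetoidReasoning setoid
  private module Π = CommutativeMonoidSum *-commutativeMonoid

  ∑≈Σ< : ∀ n (f : ℕ → Carrier) → ∑[ i < n ] f (toℕ i) ≈ Σ< n f
  ∑≈Σ< zero    f = refl
  ∑≈Σ< (suc n) f = +-congˡ (∑≈Σ< n (f ∘ suc))

  -- Sums over labels, over rows and over arrays of rows are iterates of `ΣVec`; the two properties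
  -- pass from a sum to its iterates, which treats all the nestings at once.
  record IsLinear {a} {A : Set a} (Σ : (A → Carrier) → Carrier) : Set (a ⊔ c ⊔ ℓ₁) where
    field
      Σ-cong : ∀ {f g} → (∀ x → f x ≈ g x) → Σ f ≈ Σ g
      Σ-*    : ∀ b f → b * Σ f ≈ Σ (λ x → b * f x)

  open IsLinear

  Σ<-linear : ∀ n → IsLinear (Σ< n)
  Σ<-linear n .Σ-cong f≈g = Σ<-cong n λ m _ → f≈g m
  Σ<-linear n .Σ-*    = *-distribˡ-Σ< n

  ΣVec-linear : ∀ {a} {A : Set a} {Σ : (A → Carrier) → Carrier} → IsLinear Σ → ∀ m → IsLinear (ΣVec Σ m)
  ΣVec-linear lin zero    .Σ-cong f≈g = f≈g []
  ΣVec-linear lin (suc m) .Σ-cong f≈g = lin .Σ-cong λ x → ΣVec-linear lin m .Σ-cong λ xs → f≈g (x ∷ xs)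
  ΣVec-linear lin zero    .Σ-* b f    = refl
  ΣVec-linear lin (suc m) .Σ-* b f    = trans (lin .Σ-* b _)
    (lin .Σ-cong λ x → ΣVec-linear lin m .Σ-* b λ xs → f (x ∷ xs))

  ΣVec-≈ : ∀ {a} {A : Set a} {Σ Σ′ : (A → Carrier) → Carrier} → IsLinear Σ′ → (∀ f → Σ f ≈ Σ′ f) →
           ∀ m f → ΣVec Σ m f ≈ ΣVec Σ′ m f
  ΣVec-≈ lin Σ≈ zero    f = refl
  ΣVec-≈ lin Σ≈ (suc m) f = trans (Σ≈ _) (lin .Σ-cong λ x → ΣVec-≈ lin Σ≈ m λ xs → f (x ∷ xs))

  product-of-sums : ∀ {a b} {A : Set a} {B : Set b} {Σ : (A → Carrier) → Carrier} {Σ′ : (B → Carrier) → Carrier} →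
    IsLinear Σ → IsLinear Σ′ → ∀ f g → Σ (λ x → Σ′ λ y → f x * g y) ≈ Σ f * Σ′ g
  product-of-sums {Σ = Σ} {Σ′} lin lin′ f g = begin
    Σ (λ x → Σ′ λ y → f x * g y)    ≈⟨ lin .Σ-cong (λ x → trans (sym (lin′ .Σ-* (f x) g)) (*-comm _ _)) ⟩
    Σ (λ x → Σ′ g * f x)            ≈⟨ lin .Σ-* (Σ′ g) f ⟨
    Σ′ g * Σ f                      ≈⟨ *-comm _ _ ⟩
    Σ f * Σ′ g                      ∎

  Bounded : ℕ → ∀ {L} → Vec ℕ L → Set
  Bounded N = All (ℕ._< N)

  Σᵛ-cong-bounded : ∀ N L {f g} → (∀ v → Bounded N v → f v ≈ g v) → Σᵛ N L f ≈ Σᵛ N L g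
  Σᵛ-cong-bounded N zero    f≈g = f≈g [] []
  Σᵛ-cong-bounded N (suc L) f≈g = Σ<-cong N λ m m<N → Σᵛ-cong-bounded N L λ v v<N → f≈g (m ∷ v) (m<N ∷ v<N)

  Σ<-pick : ∀ N x (f : ℕ → Carrier) → x ℕ.< N → Σ< N (λ y → 𝟙 (y ℕ.≟ x) * f y) ≈ f x
  Σ<-pick N x f x<N = trans
    (Σ<-single N x _ x<N λ y y≢x → trans (*-congʳ (𝟙-no (y ℕ.≟ x) y≢x)) (zeroˡ _))
    (trans (*-congʳ (𝟙-yes (x ℕ.≟ x) ≡.refl)) (*-identityˡ _))

  Σᵛ-pick : ∀ N L (t : Vec ℕ L) (f : Vec ℕ L → Carrier) → Bounded N t →
            Σᵛ N L (λ v → 𝟙 (all? λ i → lookup v i ℕ.≟ lookup t i) * f v) ≈ f t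
  Σᵛ-pick N zero    []      f []          = trans (*-congʳ (𝟙-yes (all? {n = 0} λ i → lookup [] i ℕ.≟ lookup [] i) λ ())) (*-identityˡ _)
  Σᵛ-pick N (suc L) (k ∷ t) f (k<N ∷ t<N) = begin
    Σ< N (λ m → Σᵛ N L λ v → 𝟙 (all? λ i → lookup (m ∷ v) i ℕ.≟ lookup (k ∷ t) i) * f (m ∷ v))
      ≈⟨ (Σ<-cong N λ m _ → trans (Σᵛ-cong N L λ v → trans
           (*-congʳ (𝟙-× (all? λ i → lookup (m ∷ v) i ℕ.≟ lookup (k ∷ t) i) (m ℕ.≟ k) (all? λ i → lookup v i ℕ.≟ lookup t i)
             (λ eq → eq zero , λ i → eq (suc i)) λ { m≡k eq zero → m≡k ; m≡k eq (suc i) → eq i }))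
           (*-assoc _ _ _)) (sym (*-distribˡ-Σᵛ N L _ _))) ⟩
    Σ< N (λ m → 𝟙 (m ℕ.≟ k) * Σᵛ N L λ v → 𝟙 (all? λ i → lookup v i ℕ.≟ lookup t i) * f (m ∷ v))
      ≈⟨ Σ<-pick N k (λ m → Σᵛ N L λ v → 𝟙 (all? λ i → lookup v i ℕ.≟ lookup t i) * f (m ∷ v)) k<N ⟩
    Σᵛ N L (λ v → 𝟙 (all? λ i → lookup v i ℕ.≟ lookup t i) * f (k ∷ v))
      ≈⟨ Σᵛ-pick N L t (λ v → f (k ∷ v)) t<N ⟩
    f (k ∷ t) ∎

  -- Conservation leaves at most one right label l. If it lies beyond the cut-off, `f` vanishes
  -- there, so nothing is lost.
  Σ<-conserved : ∀ N n k (f : ℕ → Carrier) → (∀ l → N ℕ.≤ l → f l ≈ 0#) →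
                 Σ< N (λ l → 𝟙 (n ℕ.≟ k ℕ.+ l) * f l) ≈ f ⟨ n ⊖ k ⟩
  Σ<-conserved N n k f f≈0 with compare k n
  ... | beyond .n i = trans
    (Σ<-cong N λ l _ → trans (*-congʳ (𝟙-no (n ℕ.≟ suc (n ℕ.+ i) ℕ.+ l) λ eq →
       ℕ.<-irrefl eq (ℕ.s≤s (ℕ.≤-trans (ℕ.m≤m+n n i) (ℕ.m≤m+n (n ℕ.+ i) l))))) (zeroˡ (f l)))
    (trans (Σ<-0 N) (sym (reflexive (⊖-beyond f n i))))
  ... | within .k x = begin
    Σ< N (λ l → 𝟙 (k ℕ.+ x ℕ.≟ k ℕ.+ l) * f l)
      ≈⟨ Σ<-cong N (λ l _ → *-congʳ (𝟙-⇔ (k ℕ.+ x ℕ.≟ k ℕ.+ l) (l ℕ.≟ x)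
           (λ eq → ≡.sym (ℕ.+-cancelˡ-≡ k x l eq)) (λ eq → ≡.cong (k ℕ.+_) (≡.sym eq)))) ⟩
    Σ< N (λ l → 𝟙 (l ℕ.≟ x) * f l)
      ≈⟨ pick ⟩
    f x
      ≡⟨ ⊖-within f k x ⟨
    f ⟨ k ℕ.+ x ⊖ k ⟩ ∎
    where
    pick : Σ< N (λ l → 𝟙 (l ℕ.≟ x) * f l) ≈ f x
    pick with x ℕ.<? N
    ... | yes x<N = Σ<-pick N x f x<N
    ... | no  x≮N = trans (Σ<-cong N λ l l<N → trans
      (*-congʳ (𝟙-no (l ℕ.≟ x) λ l≡x → x≮N (ℕ.≤-<-trans (ℕ.≤-reflexive (≡.sym l≡x)) l<N))) (zeroˡ (f l)))
      (trans (Σ<-0 N) (sym (f≈0 x (ℕ.≮⇒≥ x≮N))))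

  module Lattice
    (q q⁻¹ : Carrier) (q⁻¹q≈1 : q⁻¹ * q ≈ 1#)
    (q!⁻¹ : ℕ → Carrier) (q!-inverse : ∀ n → shifted q 1# q n * q!⁻¹ n ≈ 1#)
    (p u : ℕ → Carrier) (D⁻¹ : ℕ → ℕ → ℕ → Carrier)
    (D-inverse : ∀ r c n → shifted q 1# (p (r ℕ.+ c) * u c) n * D⁻¹ r c n ≈ 1#) where

    open Rows q q⁻¹ q⁻¹q≈1 q!⁻¹ q!-inverse p u D⁻¹ D-inverse

    vertex-0 : ∀ r c κ m l → m ℕ.< l → vertex r c κ m l ≈ 0#
    vertex-0 r c κ m l m<l = trans (*-congˡ (reflexive (⊖-exceeds m l m<l _))) (zeroʳ _)

    module _ (N r : ℕ) (κ : Carrier) where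

      -- The left weight `φ` is arbitrary so that the induction can carry the first vertex, as a
      -- function of the edge it shares with the rest, into the remaining columns.
      Σ-row : ∀ c₀ {L} (w : Fin L → (i j k l : ℕ) → Carrier) →
        (∀ c i j k l → w c i j k l ≈ 𝟙 (i ℕ.+ j ℕ.≟ k ℕ.+ l) * vertex r (c₀ ℕ.+ toℕ c) κ i l) →
        ∀ (t v : Vec ℕ L) → Bounded N v → ∀ (φ : ℕ → Carrier) →
        Σᵛ N (suc L) (λ h → φ (lookup h zero) * (𝟙 (lookup h (fromℕ L) ℕ.≟ 0)
          * ∏[ c < L ] w c (lookup v c) (lookup h (inject₁ c)) (lookup t c) (lookup h (suc c))))
        ≈ Σ< N (λ x → φ x * row r c₀ κ t v x)
      Σ-row c₀ w w≈ [] [] [] φ = Σ<-cong N λ x _ → *-congˡ (trans (*-identityʳ _) (δ x))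
        where
        δ : ∀ x → 𝟙 (x ℕ.≟ 0) ≈ δ₀ x
        δ zero    = refl
        δ (suc x) = refl
      Σ-row c₀ {suc L} w w≈ (k ∷ t) (m ∷ v) (m<N ∷ v<N) φ = begin
        Σ< N (λ x → Σᵛ N (suc L) λ h → φ x * (last h * (w zero m x k (lookup h zero) * rest h)))
          ≈⟨ (Σ<-cong N λ x _ → trans
               (sym (*-distribˡ-Σᵛ N (suc L) (φ x) λ h → last h * (w zero m x k (lookup h zero) * rest h)))
               (*-congˡ (Σᵛ-cong N (suc L) λ h → solve 3 (λ a b c → a :* (b :* c) := b :* (a :* c)) refl
                 (last h) (w zero m x k (lookup h zero)) (rest h)))) ⟩
        Σ< N (λ x → φ x * Σᵛ N (suc L) λ h → w zero m x k (lookup h zero) * (last h * rest h))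
          ≈⟨ (Σ<-cong N λ x _ → *-congˡ (Σ-row (suc c₀) (w ∘ suc) w-suc≈ t v v<N (w zero m x k))) ⟩
        Σ< N (λ x → φ x * Σ< N λ l → w zero m x k l * row r (suc c₀) κ t v l)
          ≈⟨ (Σ<-cong N λ x _ → *-congˡ (Σ<-cong N λ l _ → trans (*-congʳ (w-zero≈ x l)) (*-assoc _ _ _))) ⟩
        Σ< N (λ x → φ x * Σ< N λ l → 𝟙 (m ℕ.+ x ℕ.≟ k ℕ.+ l) * (vertex r c₀ κ m l * row r (suc c₀) κ t v l))
          ≈⟨ (Σ<-cong N λ x _ → *-congˡ (Σ<-conserved N (m ℕ.+ x) k (λ l → vertex r c₀ κ m l * row r (suc c₀) κ t v l)
               λ l N≤l → trans (*-congʳ (vertex-0 r c₀ κ m l (ℕ.≤-trans m<N N≤l))) (zeroˡ _))) ⟩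
        Σ< N (λ x → φ x * row r c₀ κ (k ∷ t) (m ∷ v) x) ∎
        where
        last rest : Vec ℕ (suc L) → Carrier
        last h = 𝟙 (lookup h (fromℕ L) ℕ.≟ 0)
        rest h = ∏[ c < L ] w (suc c) (lookup v c) (lookup h (inject₁ c)) (lookup t c) (lookup h (suc c))
        w-zero≈ : ∀ x l → w zero m x k l ≈ 𝟙 (m ℕ.+ x ℕ.≟ k ℕ.+ l) * vertex r c₀ κ m l
        w-zero≈ x l = trans (w≈ zero m x k l) (*-congˡ (reflexive (≡.cong (λ c → vertex r c κ m l) (ℕ.+-identityʳ c₀))))
        w-suc≈ : ∀ c i j k l → w (suc c) i j k l ≈ 𝟙 (i ℕ.+ j ℕ.≟ k ℕ.+ l) * vertex r (suc c₀ ℕ.+ toℕ c) κ i l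
        w-suc≈ c i j k l = trans (w≈ (suc c) i j k l)
          (*-congˡ (reflexive (≡.cong (λ c → vertex r c κ i l) (ℕ.+-suc c₀ (toℕ c)))))

    Weighting : ℕ → ℕ → Set c
    Weighting n L = Fin n → Fin L → (i j k l : ℕ) → Carrier

    -- The configurations with prescribed top row and left edges, the bottom row weighted by f.
    configurations : ∀ N {n L} → Weighting n L → (Vec ℕ L → Carrier) → Vec ℕ L → Vec ℕ n → Carrier
    configurations N {n} {L} w f t a =
      ΣVec (Σᵛ N L) n λ v → ΣVec (Σᵛ N (suc L)) n λ h →
        f (lookup (t ∷ v) (fromℕ n))
          * (𝟙 (all? λ r → lookup (lookup h r) zero ℕ.≟ lookup a r)
             * 𝟙 (all? λ r → lookup (lookup h r) (fromℕ L) ℕ.≟ 0))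
          * ∏[ r < n ] ∏[ c < L ] w r c (lookup (lookup (t ∷ v) (suc r)) c) (lookup (lookup h r) (inject₁ c))
                                        (lookup (lookup (t ∷ v) (inject₁ r)) c) (lookup (lookup h r) (suc c))

    paths : ∀ N r → ∀ {n L} → Vector Carrier n → (Vec ℕ L → Carrier) → Vec ℕ L → Vec ℕ n → Carrier
    paths N r     κ f t []      = f t
    paths N r {L = L} κ f t (a ∷ as) = Σᵛ N L λ v → row r 1 (κ zero) t v a * paths N (suc r) (κ ∘ suc) f v as

    -- Once the vertical labels are fixed, the horizontal edges of different rows are summed
    -- independently: the first row splits off and is evaluated by `Σ-row`.
    configurations≈paths : ∀ N r {n L} (κ : Vector Carrier n) (w : Weighting n L) →
      (∀ r′ c i j k l → w r′ c i j k l ≈ 𝟙 (i ℕ.+ j ℕ.≟ k ℕ.+ l) * vertex (r ℕ.+ toℕ r′) (suc (toℕ c)) (κ r′) i l) →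
      ∀ f t (a : Vec ℕ n) → Bounded N a → configurations N w f t a ≈ paths N r κ f t a
    configurations≈paths N r {zero}  {L} κ w w≈ f t []      []          = begin
      f t * (1# * 1#) * 1#
        ≈⟨ solve 1 (λ x → x :* (:1 :* :1) :* :1 := x) refl (f t) ⟩
      f t ∎
    configurations≈paths N r {suc n} {L} κ w w≈ f t (a ∷ as) (a<N ∷ as<N) = begin
      configurations N w f t (a ∷ as)
        ≈⟨ Σᵛ-cong-bounded N L split ⟩
      Σᵛ N L (λ v₁ → row r 1 (κ zero) t v₁ a * configurations N (w ∘ suc) f v₁ as)
        ≈⟨ (Σᵛ-cong N L λ v₁ → *-congˡ (configurations≈paths N (suc r) (κ ∘ suc) (w ∘ suc) w-suc≈ f v₁ as as<N)) ⟩
      paths N r κ f t (a ∷ as) ∎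
      where
      w-zero≈ : ∀ c i j k l → w zero c i j k l ≈ 𝟙 (i ℕ.+ j ℕ.≟ k ℕ.+ l) * vertex r (1 ℕ.+ toℕ c) (κ zero) i l
      w-zero≈ c i j k l = trans (w≈ zero c i j k l)
        (*-congˡ (reflexive (≡.cong (λ r → vertex r (suc (toℕ c)) (κ zero) i l) (ℕ.+-identityʳ r))))
      w-suc≈ : ∀ r′ c i j k l → w (suc r′) c i j k l ≈ 𝟙 (i ℕ.+ j ℕ.≟ k ℕ.+ l) * vertex (suc r ℕ.+ toℕ r′) (suc (toℕ c)) (κ (suc r′)) i l
      w-suc≈ r′ c i j k l = trans (w≈ (suc r′) c i j k l)
        (*-congˡ (reflexive (≡.cong (λ r → vertex r (suc (toℕ c)) (κ (suc r′)) i l) (ℕ.+-suc r (toℕ r′)))))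

      split : ∀ v₁ → Bounded N v₁ → _ ≈ row r 1 (κ zero) t v₁ a * configurations N (w ∘ suc) f v₁ as
      split v₁ v₁<N = begin
        ΣVec (Σᵛ N L) n (λ v → Σᵛ N (suc L) λ h₁ → ΣVec (Σᵛ N (suc L)) n λ h → G v h₁ h)
          ≈⟨ lin-v .Σ-cong (λ v → lin-h₁ .Σ-cong λ h₁ → lin-h .Σ-cong λ h → separate v h₁ h) ⟩
        ΣVec (Σᵛ N L) n (λ v → Σᵛ N (suc L) λ h₁ → ΣVec (Σᵛ N (suc L)) n λ h → first h₁ * remaining v h)
          ≈⟨ lin-v .Σ-cong (λ v → product-of-sums lin-h₁ lin-h first (remaining v)) ⟩
        ΣVec (Σᵛ N L) n (λ v → Σᵛ N (suc L) first * ΣVec (Σᵛ N (suc L)) n (remaining v))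
          ≈⟨ lin-v .Σ-* _ _ ⟨
        Σᵛ N (suc L) first * configurations N (w ∘ suc) f v₁ as
          ≈⟨ *-congʳ (trans (Σ-row N r (κ zero) 1 (w zero) w-zero≈ t v₁ v₁<N (λ x → 𝟙 (x ℕ.≟ a)))
               (Σ<-pick N a (row r 1 (κ zero) t v₁) a<N)) ⟩
        row r 1 (κ zero) t v₁ a * configurations N (w ∘ suc) f v₁ as ∎
        where
        lin-v  = ΣVec-linear (ΣVec-linear (Σ<-linear N) L) n
        lin-h₁ = ΣVec-linear (Σ<-linear N) (suc L)
        lin-h  = ΣVec-linear (ΣVec-linear (Σ<-linear N) (suc L)) n

        first : Vec ℕ (suc L) → Carrier
        first h = 𝟙 (lookup h zero ℕ.≟ a) * (𝟙 (lookup h (fromℕ L) ℕ.≟ 0)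
          * ∏[ c < L ] w zero c (lookup v₁ c) (lookup h (inject₁ c)) (lookup t c) (lookup h (suc c)))

        remaining : Vec (Vec ℕ L) n → Vec (Vec ℕ (suc L)) n → Carrier
        remaining v h = f (lookup (v₁ ∷ v) (fromℕ n))
          * (𝟙 (all? λ r → lookup (lookup h r) zero ℕ.≟ lookup as r)
             * 𝟙 (all? λ r → lookup (lookup h r) (fromℕ L) ℕ.≟ 0))
          * ∏[ r < n ] ∏[ c < L ] w (suc r) c (lookup (lookup (v₁ ∷ v) (suc r)) c) (lookup (lookup h r) (inject₁ c))
                                              (lookup (lookup (v₁ ∷ v) (inject₁ r)) c) (lookup (lookup h r) (suc c))

        G : Vec (Vec ℕ L) n → Vec ℕ (suc L) → Vec (Vec ℕ (suc L)) n → Carrier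
        G v h₁ h = f (lookup (v₁ ∷ v) (fromℕ n))
          * (𝟙 (all? λ r → lookup (lookup (h₁ ∷ h) r) zero ℕ.≟ lookup (a ∷ as) r)
             * 𝟙 (all? λ r → lookup (lookup (h₁ ∷ h) r) (fromℕ L) ℕ.≟ 0))
          * (∏[ c < L ] w zero c (lookup v₁ c) (lookup h₁ (inject₁ c)) (lookup t c) (lookup h₁ (suc c))
            * ∏[ r < n ] ∏[ c < L ] w (suc r) c (lookup (lookup (v₁ ∷ v) (suc r)) c) (lookup (lookup h r) (inject₁ c))
                                                (lookup (lookup (v₁ ∷ v) (inject₁ r)) c) (lookup (lookup h r) (suc c)))

        separate : ∀ v h₁ h → G v h₁ h ≈ first h₁ * remaining v h
        separate v h₁ h = trans
          (*-congʳ (*-congˡ (*-cong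
            (𝟙-× (all? λ r → lookup (lookup (h₁ ∷ h) r) zero ℕ.≟ lookup (a ∷ as) r)
                 (lookup h₁ zero ℕ.≟ a) (all? λ r → lookup (lookup h r) zero ℕ.≟ lookup as r)
                 (λ eq → eq zero , eq ∘ suc) λ { eq eqs zero → eq ; eq eqs (suc r) → eqs r })
            (𝟙-× (all? λ r → lookup (lookup (h₁ ∷ h) r) (fromℕ L) ℕ.≟ 0)
                 (lookup h₁ (fromℕ L) ℕ.≟ 0) (all? λ r → lookup (lookup h r) (fromℕ L) ℕ.≟ 0)
                 (λ eq → eq zero , eq ∘ suc) λ { eq eqs zero → eq ; eq eqs (suc r) → eqs r }))))
          (solve 7 (λ F a b c d P Q → F :* (a :* b :* (c :* d)) :* (P :* Q) := (a :* (c :* P)) :* (F :* (b :* d) :* Q))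
            refl _ _ _ _ _ _ _)

    paths-conservation : ∀ N r {n L} (κ : Vector Carrier n) (f : Vec ℕ L → Carrier) β →
      (∀ v → ¬ Vec.sum v ≡ β → f v ≈ 0#) → ∀ t (a : Vec ℕ n) → ¬ Vec.sum a ℕ.+ β ≡ Vec.sum t →
      paths N r κ f t a ≈ 0#
    paths-conservation N r κ f β f≈0 t []       a≢ = f≈0 t (λ t≡β → a≢ (≡.sym t≡β))
    paths-conservation N r {L = L} κ f β f≈0 t (a ∷ as) a≢ = trans (Σᵛ-cong N L vanishes) (Σᵛ-0 N L)
      where
      vanishes : ∀ v → row r 1 (κ zero) t v a * paths N (suc r) (κ ∘ suc) f v as ≈ 0#
      vanishes v = cases (Vec.sum as ℕ.+ β ℕ.≟ Vec.sum v)
        where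
        cases : Dec (Vec.sum as ℕ.+ β ≡ Vec.sum v) → row r 1 (κ zero) t v a * paths N (suc r) (κ ∘ suc) f v as ≈ 0#
        cases (no  as≢v) = trans (*-congˡ (paths-conservation N (suc r) (κ ∘ suc) f β f≈0 v as as≢v)) (zeroʳ _)
        cases (yes as≡v) = trans (*-congʳ (row-conservation r 1 (κ zero) t v a λ a+v≡t → a≢
          (≡.trans (ℕ.+-assoc a _ β) (≡.trans (≡.cong (a ℕ.+_) as≡v) a+v≡t)))) (zeroˡ _)

    -- Each aᵢ enters one row and one emission only, so its sum can be moved into that row.
    Σ-paths≈chain : ∀ N r {n L} (κ : Vector Carrier n) (f : Vec ℕ L → Carrier) t →
      Σᵛ N n (λ a → ∏[ i < n ] emission (r ℕ.+ toℕ i) (κ i) (lookup a i) * paths N r κ f t a)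
      ≈ chain N r (List.tabulate κ) t f
    Σ-paths≈chain N r {zero}  κ f t = *-identityˡ _
    Σ-paths≈chain N r {suc n} {L} κ f t = begin
      Σᵛ N (suc n) (λ a → E a * paths N r κ f t a)
        ≈⟨ Σᵛ-cong N (suc n) {λ a → E a * paths N r κ f t a} {λ a → Σᵛ N L (G a)} (λ { (a ∷ as) → trans
             (*-congʳ (*-cong (reflexive (≡.cong (λ r → emission r (κ zero) a) (ℕ.+-identityʳ r)))
                (Π.sum-cong-≋ {n} λ i → reflexive (≡.cong (λ r → emission r (κ (suc i)) (lookup as i)) (ℕ.+-suc r (toℕ i))))))
             (*-distribˡ-Σᵛ N L _ _) }) ⟩
      Σᵛ N (suc n) (λ a → Σᵛ N L (G a))
        ≈⟨ Σᵛ-comm N (suc n) L G ⟩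
      Σᵛ N L (λ v → Σᵛ N (suc n) λ a → G a v)
        ≈⟨ Σᵛ-cong N L each ⟩
      Σᵛ N L (λ v → fullRow N r (κ zero) t v * chain N (suc r) (List.tabulate (κ ∘ suc)) v f) ∎
      where
      E : Vec ℕ (suc n) → Carrier
      E a = ∏[ i < suc n ] emission (r ℕ.+ toℕ i) (κ i) (lookup a i)
      E′ : Vec ℕ n → Carrier
      E′ as = ∏[ i < n ] emission (suc r ℕ.+ toℕ i) (κ (suc i)) (lookup as i)
      G : Vec ℕ (suc n) → Vec ℕ L → Carrier
      G (a ∷ as) v = emission r (κ zero) a * E′ as * (row r 1 (κ zero) t v a * paths N (suc r) (κ ∘ suc) f v as)
      each : ∀ v → Σᵛ N (suc n) (λ a → G a v) ≈ fullRow N r (κ zero) t v * chain N (suc r) (List.tabulate (κ ∘ suc)) v f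
      each v = begin
        Σ< N (λ a → Σᵛ N n λ as → G (a ∷ as) v)
          ≈⟨ (Σ<-linear N .Σ-cong λ a → Σᵛ-cong N n λ as →
               solve 4 (λ e E r p → e :* E :* (r :* p) := (e :* r) :* (E :* p)) refl _ _ _ _) ⟩
        Σ< N (λ a → Σᵛ N n λ as → (emission r (κ zero) a * row r 1 (κ zero) t v a) * (E′ as * paths N (suc r) (κ ∘ suc) f v as))
          ≈⟨ product-of-sums (Σ<-linear N) (ΣVec-linear (Σ<-linear N) n) _ _ ⟩
        fullRow N r (κ zero) t v * Σᵛ N n (λ as → E′ as * paths N (suc r) (κ ∘ suc) f v as)
          ≈⟨ *-congˡ (Σ-paths≈chain N (suc r) (κ ∘ suc) f v) ⟩
        fullRow N r (κ zero) t v * chain N (suc r) (List.tabulate (κ ∘ suc)) v f ∎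

    module _ {n : ℕ} where

      shifted-polynomial : ∀ {f g} → IsPolynomial {n} f → IsPolynomial g → ∀ k → IsPolynomial (λ x → shifted q (f x) (g x) k)
      shifted-polynomial F G zero    = constant 1#
      shifted-polynomial F G (suc k) = shifted-polynomial F G k ⊡ (F ⊞ negate (G ⊡ constant (q ^ k)))

      vertex-polynomial : ∀ {f} → IsPolynomial {n} f → ∀ r c m l → IsPolynomial (λ x → vertex r c (f x) m l)
      vertex-polynomial F r c m l = constant _ ⊡ (constant _ ⊡ (constant _ ⊡ shifted-polynomial F (constant _) l))
        ⊡ ⊖-polynomial (λ i → constant _ ⊡ shifted-polynomial (constant 1#) (F ⊡ constant _) i) m l

      row-polynomial : ∀ {f} → IsPolynomial {n} f → ∀ r c {L} (t v : Vec ℕ L) a → IsPolynomial (λ x → row r c (f x) t v a)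
      row-polynomial F r c []      []      a = constant _
      row-polynomial F r c (k ∷ t) (m ∷ v) a =
        ⊖-polynomial (λ l → vertex-polynomial F r c m l ⊡ row-polynomial F r (suc c) t v l) (m ℕ.+ a) k

      Σᵛ-polynomial : ∀ N L {f : Vector Carrier n → Vec ℕ L → Carrier} →
        (∀ v → IsPolynomial (λ x → f x v)) → IsPolynomial (λ x → Σᵛ N L (f x))
      Σᵛ-polynomial N zero    F = F []
      Σᵛ-polynomial N (suc L) F = Σ<-polynomial N λ m → Σᵛ-polynomial N L λ v → F (m ∷ v)

      -- The list consists of functions of x, not of values, so that polynomiality can be carried
      -- entry by entry through the recursion over the rows.
      chain-polynomial : ∀ N r {fs : List (Vector Carrier n → Carrier)} → ListAll.All IsPolynomial fs →
        ∀ {L} (t : Vec ℕ L) end → IsPolynomial (λ x → chain N r (List.map (λ f → f x) fs) t end)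
      chain-polynomial N r ListAll.[]        t end = constant _
      chain-polynomial N r (F ListAll.∷ Fs) {L} t end = Σᵛ-polynomial N L λ v →
        Σ<-polynomial N (λ a → constant _ ⊡ (constant _ ⊡ shifted-polynomial F (constant _) a) ⊡ row-polynomial F r 1 t v a)
        ⊡ chain-polynomial N (suc r) Fs v end

-- The given weights in denominator-free form.

module Weights {c ℓ₁ ℓ₂} (K : HeytingField c ℓ₁ ℓ₂) (Θ : Parameters K) where

  open FieldNotation K
  open Indicators K
  open Parameters Θ
  open Functions K Θ using (W)
  open CommutativeRing commutativeRing using (*-commutativeMonoid)
  open QBinomial commutativeRing
  open FiniteSums commutativeRing
  open IntegerSolver commutativeRing
  open SetoidReasoning setoid
  private module Π = CommutativeMonoidSum *-commutativeMonoid

  inverseʳ : ∀ {x} (x#0 : x # 0#) → x * inverse x x#0 ≈ 1#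
  inverseʳ x#0 = trans (*-comm _ _) (inverseˡ x#0)

  inverse-unique : ∀ {x y} (x#0 : x # 0#) → x * y ≈ 1# → inverse x x#0 ≈ y
  inverse-unique {x} {y} x#0 xy≈1 = begin
    inverse x x#0               ≈⟨ *-identityʳ _ ⟨
    inverse x x#0 * 1#          ≈⟨ *-congˡ xy≈1 ⟨
    inverse x x#0 * (x * y)     ≈⟨ *-assoc _ _ _ ⟨
    inverse x x#0 * x * y       ≈⟨ *-congʳ (inverseˡ x#0) ⟩
    1# * y                      ≈⟨ *-identityˡ y ⟩
    y                           ∎

  inverse-* : ∀ {x y} (x#0 : x # 0#) (y#0 : y # 0#) (xy#0 : x * y # 0#) →
              inverse (x * y) xy#0 ≈ inverse x x#0 * inverse y y#0
  inverse-* {x} {y} x#0 y#0 xy#0 = inverse-unique xy#0 (begin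
    x * y * (inverse x x#0 * inverse y y#0)
      ≈⟨ solve 4 (λ a b c d → a :* b :* (c :* d) := (a :* c) :* (b :* d)) refl _ _ _ _ ⟩
    x * inverse x x#0 * (y * inverse y y#0)
      ≈⟨ *-cong (inverseʳ x#0) (inverseʳ y#0) ⟩
    1# * 1#
      ≈⟨ *-identityˡ 1# ⟩
    1# ∎)

  poch≈shifted : ∀ x n → poch x n ≈ shifted q 1# x n
  poch≈shifted x zero    = refl
  poch≈shifted x (suc n) = begin
    (1# - x * 1#) * ∏[ i < n ] (1# - x * (q * q ^ toℕ i))
      ≈⟨ *-cong (+-congˡ (-‿cong (*-identityʳ x)))
                (Π.sum-cong-≋ {n} λ i → +-congˡ (-‿cong (sym (*-assoc x q _)))) ⟩
    (1# - x) * poch (x * q) n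
      ≈⟨ *-congˡ (poch≈shifted (x * q) n) ⟩
    (1# - x) * shifted q 1# (x * q) n
      ≈⟨ shifted-head q 1# x n ⟨
    shifted q 1# x (suc n) ∎

  q⁻¹ : Carrier
  q⁻¹ = inverse q q#0

  q!⁻¹ : ℕ → Carrier
  q!⁻¹ n = inverse (poch q n) (poch-q#0 n)

  q!-inverse : ∀ n → shifted q 1# q n * q!⁻¹ n ≈ 1#
  q!-inverse n = trans (*-congʳ (sym (poch≈shifted q n))) (inverseʳ (poch-q#0 n))

  p u : ℕ → Carrier
  p i = s i * ξ i
  u i = s i / ξ i [ ξ#0 i ]

  D⁻¹ : ℕ → ℕ → ℕ → Carrier
  D⁻¹ r c n = inverse (poch (τs r c * τs r c) n) (poch-τs#0 r c n)

  -- Squaring removes the roots and splits the parameter into a part that depends on r + c and a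
  -- part that depends on c, the factorisation on which the exchange rests.
  τs² : ∀ r c → τs r c * τs r c ≈ p (r ℕ.+ c) * u c
  τs² r c = begin
    τs r c * τs r c
      ≈⟨ solve 4 (λ a b c d → (a :* b :* c :* d) :* (a :* b :* c :* d) := a :* a :* (b :* b) :* (c :* c :* (d :* d))) refl _ _ _ _ ⟩
    p (c ℕ.+ r) * (s c * (inverse (√ξ c) (√ξ#0 c) * inverse (√ξ c) (√ξ#0 c)))
      ≈⟨ *-cong (reflexive (≡.cong p (ℕ.+-comm c r))) (*-congˡ (sym (inverse-* (√ξ#0 c) (√ξ#0 c) (ξ#0 c)))) ⟩
    p (r ℕ.+ c) * u c ∎

  D-inverse : ∀ r c n → shifted q 1# (p (r ℕ.+ c) * u c) n * D⁻¹ r c n ≈ 1#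
  D-inverse r c n = begin
    shifted q 1# (p (r ℕ.+ c) * u c) n * D⁻¹ r c n  ≈⟨ *-congʳ (shifted-cong q n refl (τs² r c)) ⟨
    shifted q 1# (τs r c * τs r c) n * D⁻¹ r c n    ≈⟨ *-congʳ (poch≈shifted _ n) ⟨
    poch (τs r c * τs r c) n * D⁻¹ r c n            ≈⟨ inverseʳ (poch-τs#0 r c n) ⟩
    1#                                              ∎

  open QFactorials commutativeRing
  open Reciprocals q q⁻¹ (inverseˡ q#0) q!⁻¹ q!-inverse using (jump; stay; weight; q!)
  open RowTransfer commutativeRing
  open Rows q q⁻¹ (inverseˡ q#0) q!⁻¹ q!-inverse p u D⁻¹ D-inverse public

  module _ (r c : ℕ) {κ} (κ#0 : κ # 0#) (T#0 : (ξ (r ℕ.+ c) * s (r ℕ.+ c)) / κ [ κ#0 ] # 0#) where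

    private
      T S ρ : Carrier
      T = (ξ (r ℕ.+ c) * s (r ℕ.+ c)) / κ [ κ#0 ]
      S = τs r c * τs r c
      ρ = S / T [ T#0 ]

      κT≈p : κ * T ≈ p (r ℕ.+ c)
      κT≈p = trans (solve 4 (λ k a b i → k :* (a :* b :* i) := b :* a :* (k :* i)) refl _ _ _ _)
               (trans (*-congˡ (inverseʳ κ#0)) (*-identityʳ _))

      -- The parameter p cancels between s² and t².
      ρ≈κu : ρ ≈ κ * u c
      ρ≈κu = begin
        S * inverse T T#0                   ≈⟨ *-congʳ (trans (τs² r c) (*-congʳ (sym κT≈p))) ⟩
        κ * T * u c * inverse T T#0         ≈⟨ solve 4 (λ k t u i → k :* t :* u :* i := k :* u :* (t :* i)) refl _ _ _ _ ⟩
        κ * u c * (T * inverse T T#0)       ≈⟨ trans (*-congˡ (inverseʳ T#0)) (*-identityʳ _) ⟩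
        κ * u c                             ∎

      -- The power of ρ homogenises (t²;q)_l: since ρ contains κ and t² contains 1/κ, the
      -- denominator disappears.
      ρ^-poch : ∀ l → ρ ^ l * poch T l ≈ u c ^ l * shifted q κ (p (r ℕ.+ c)) l
      ρ^-poch l = begin
        ρ ^ l * poch T l                            ≈⟨ *-congˡ (poch≈shifted T l) ⟩
        ρ ^ l * shifted q 1# T l                    ≈⟨ shifted-scale q ρ 1# T l ⟨
        shifted q (ρ * 1#) (ρ * T) l
          ≈⟨ shifted-cong q l (trans (*-identityʳ ρ) (trans ρ≈κu (*-comm _ _)))
               (trans (*-congʳ ρ≈κu) (trans (solve 3 (λ k u t → k :* u :* t := u :* (k :* t)) refl _ _ _) (*-congˡ κT≈p))) ⟩
        shifted q (u c * κ) (u c * p (r ℕ.+ c)) l   ≈⟨ shifted-scale q (u c) κ (p (r ℕ.+ c)) l ⟩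
        u c ^ l * shifted q κ (p (r ℕ.+ c)) l       ∎

      stay-cut : ∀ i l → 𝟙 (l ℕ.≤? i) * stay (u c) κ (i ∸ l) ≈ stay (u c) κ ⟨ i ⊖ l ⟩
      stay-cut i l with l ℕ.≤? i
      ... | no  l≰i = trans (zeroˡ _) (sym (reflexive (⊖-exceeds i l (ℕ.≰⇒> l≰i) (stay (u c) κ))))
      ... | yes l≤i with d , ≡.refl ← ℕ.m≤n⇒∃[o]m+o≡n l≤i = trans (*-identityˡ _) (reflexive
            (≡.trans (≡.cong (stay (u c) κ) (ℕ.m+n∸m≡n l d)) (≡.sym (⊖-within (stay (u c) κ) l d))))

    W≈vertex : ∀ i j k l → W T S T#0 (poch-τs#0 r c) i j k l ≈ 𝟙 (i ℕ.+ j ℕ.≟ k ℕ.+ l) * vertex r c κ i l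
    W≈vertex i j k l = begin
      W T S T#0 (poch-τs#0 r c) i j k l
        ≈⟨ *-congˡ (inverse-* (poch-q#0 (i ∸ l)) (poch-q#0 l) _) ⟩
      𝟙 (i ℕ.+ j ℕ.≟ k ℕ.+ l) * 𝟙 (l ℕ.≤? i) * ρ ^ l * (poch ρ (i ∸ l) * poch T l) * D⁻¹ r c i
        * poch q i * (q!⁻¹ (i ∸ l) * q!⁻¹ l)
        ≈⟨ solve 9 (λ δ c ρˡ P Q d qi x y → δ :* c :* ρˡ :* (P :* Q) :* d :* qi :* (x :* y)
             := δ :* (qi :* d :* (ρˡ :* Q :* y) :* (c :* (x :* P)))) refl _ _ _ _ _ _ _ _ _ ⟩
      𝟙 (i ℕ.+ j ℕ.≟ k ℕ.+ l) * (poch q i * D⁻¹ r c i * (ρ ^ l * poch T l * q!⁻¹ l)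
        * (𝟙 (l ℕ.≤? i) * (q!⁻¹ (i ∸ l) * poch ρ (i ∸ l))))
        ≈⟨ *-congˡ (*-cong (*-cong (*-congʳ (poch≈shifted q i))
             (trans (*-congʳ (ρ^-poch l)) (trans (*-assoc _ _ _) (*-congˡ (*-comm _ _)))))
             (trans (*-congˡ (*-congˡ (trans (poch≈shifted ρ (i ∸ l)) (shifted-cong q (i ∸ l) refl ρ≈κu)))) (stay-cut i l))) ⟩
      𝟙 (i ℕ.+ j ℕ.≟ k ℕ.+ l) * vertex r c κ i l ∎

  emission≈ : ∀ r {κ} (κ#0 : κ # 0#) a →
    (κ * s 0 / ξ 0 [ ξ#0 0 ]) ^ a * poch (s r * ξ r / κ [ κ#0 ]) a / poch q a [ poch-q#0 a ] ≈ emission r κ a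
  emission≈ r {κ} κ#0 a = begin
    ρ ^ a * poch T a * q!⁻¹ a
      ≈⟨ *-congʳ (*-congˡ (poch≈shifted T a)) ⟩
    ρ ^ a * shifted q 1# T a * q!⁻¹ a
      ≈⟨ *-congʳ (shifted-scale q ρ 1# T a) ⟨
    shifted q (ρ * 1#) (ρ * T) a * q!⁻¹ a
      ≈⟨ *-congʳ (shifted-cong q a
           (solve 3 (λ k s i → k :* s :* i :* :1 := s :* i :* k) refl _ _ _)
           (trans (solve 6 (λ k s i t x j → k :* s :* i :* (t :* x :* j) := s :* i :* (t :* x) :* (k :* j)) refl _ _ _ _ _ _)
             (trans (*-congˡ (inverseʳ κ#0)) (*-identityʳ _)))) ⟩
    shifted q (u 0 * κ) (u 0 * p r) a * q!⁻¹ a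
      ≈⟨ *-congʳ (shifted-scale q (u 0) κ (p r) a) ⟩
    u 0 ^ a * shifted q κ (p r) a * q!⁻¹ a
      ≈⟨ trans (*-assoc _ _ _) (*-congˡ (*-comm _ _)) ⟩
    emission r κ a ∎
    where
    ρ = κ * s 0 / ξ 0 [ ξ#0 0 ]
    T = s r * ξ r / κ [ κ#0 ]

-- Permutations of `Fin n` as rearrangements of lists.

tabulate-remove : ∀ {a} {A : Set a} {n} (x : Fin (suc n) → A) i →
                  List.tabulate x ↭ x i ∷ List.tabulate (x ∘ punchIn i)
tabulate-remove x zero = ↭-refl
tabulate-remove {n = suc n} x (suc i) = ↭-trans (prep (x zero) (tabulate-remove (x ∘ suc) i)) (swap _ _ ↭-refl)

-- Induction on n: the entry selected by π at zero is brought to the front, and the others are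
-- permuted by `Permutation.remove zero π`.
tabulate-permute : ∀ {a} {A : Set a} {n} (π : Permutation′ n) (x : Fin n → A) →
                   List.tabulate (x ∘ (π ⟨$⟩ʳ_)) ↭ List.tabulate x
tabulate-permute {n = zero}  π x = ↭-refl
tabulate-permute {n = suc n} π x = ↭-trans
  (prep (x π₀) (↭-trans
    (↭-reflexive (List.tabulate-cong λ i → ≡.cong x (Permutation.punchIn-permute π zero i)))
    (tabulate-permute (Permutation.remove zero π) (x ∘ punchIn π₀))))
  (↭-sym (tabulate-remove x π₀))
  where π₀ = π ⟨$⟩ʳ zero

-- Symmetry and polynomiality of 𝔽.

module Symmetry {c ℓ₁ ℓ₂} (K : HeytingField c ℓ₁ ℓ₂) (Θ : Parameters K) where

  open FieldNotation K
  open Polynomials K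
  open Indicators K
  open Parameters Θ
  open Functions K Θ
  open Weights K Θ
  open Configurations K
  open Lattice q q⁻¹ (inverseˡ q#0) q!⁻¹ q!-inverse p u D⁻¹ D-inverse
  open PolynomialFunctions K
  open Partition
  open CommutativeRing commutativeRing using (*-commutativeMonoid)
  open QBinomial commutativeRing
  open FiniteSums commutativeRing
  open VectorSums commutativeRing
  open IsLinear
  open SetoidReasoning setoid
  private module Π = CommutativeMonoidSum *-commutativeMonoid

  steps : Partition → (L : ℕ) → Vec ℕ L
  steps ν L = tabulate λ c → step ν (toℕ c)

  part-antitone : ∀ ν i k → part ν (i ℕ.+ k) ℕ.≤ part ν i
  part-antitone ν i zero    = ℕ.≤-reflexive (≡.cong (part ν) (ℕ.+-identityʳ i))
  part-antitone ν i (suc k) = ℕ.≤-trans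
    (ℕ.≤-trans (ℕ.≤-reflexive (≡.cong (part ν) (ℕ.+-suc i k))) (decreasing ν (i ℕ.+ k))) (part-antitone ν i k)

  -- The sum telescopes to ν₁ - ν_{L+1}, and ν_{L+1} = 0 because L exceeds the length.
  sum-steps : ∀ ν L → Partition.length ν ℕ.< L → Vec.sum (steps ν L) ≡ part ν 0
  sum-steps ν L ν<L = ≡.trans (≡.sym (≡.trans (≡.cong (Vec.sum (steps ν L) ℕ.+_) (vanishing ν (ℕ.<⇒≤ ν<L))) (ℕ.+-identityʳ _)))
    (telescope L 0)
    where
    telescope : ∀ L i → Vec.sum (tabulate {n = L} λ c → step ν (i ℕ.+ toℕ c)) ℕ.+ part ν (i ℕ.+ L) ≡ part ν i
    telescope zero    i = ≡.cong (part ν) (ℕ.+-identityʳ i)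
    telescope (suc L) i = ≡.trans (≡.cong₂ ℕ._+_
        (≡.cong₂ ℕ._+_ (≡.cong (step ν) (ℕ.+-identityʳ i))
           (≡.cong Vec.sum (Vec.tabulate-cong {n = L} λ c → ≡.cong (step ν) (ℕ.+-suc i (toℕ c)))))
        (≡.cong (part ν) (ℕ.+-suc i L)))
      (≡.trans (ℕ.+-assoc (step ν i) _ _) (≡.trans (≡.cong (step ν i ℕ.+_) (telescope L (suc i)))
        (ℕ.m∸n+n≡m (decreasing ν i))))

  bounded-steps : ∀ ν L → Bounded (suc (part ν 0)) (steps ν L)
  bounded-steps ν L = All.tabulate⁺ λ c → ℕ.s≤s (ℕ.≤-trans (ℕ.m∸n≤m (part ν (toℕ c)) (part ν (suc (toℕ c)))) (part-antitone ν 0 (toℕ c)))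

  ends-at : Partition → ∀ L → Vec ℕ L → Carrier
  ends-at μ L v = 𝟙 (all? λ c → lookup v c ℕ.≟ step μ (toℕ c))

  ends-at-0 : ∀ μ L → Partition.length μ ℕ.< L → ∀ v → ¬ Vec.sum v ≡ part μ 0 → ends-at μ L v ≈ 0#
  ends-at-0 μ L μ<L v v≢ = 𝟙-no (all? λ c → lookup v c ℕ.≟ step μ (toℕ c)) λ v≡ → v≢ (≡.trans
    (≡.cong Vec.sum (≡.trans (≡.sym (Vec.tabulate∘lookup v)) (Vec.tabulate-cong v≡))) (sum-steps μ L μ<L))

  -- N is a variable tied to ν by an equation; with `suc (part ν 0)` in its place every `Σ< N` would
  -- unfold by one term.
  module _ {n} (κ : Vector Carrier n) (κ#0 : ∀ r → κ r # 0#) (L : ℕ) (ν μ : Partition)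
           (ν<L : Partition.length ν ℕ.< L) (μ<L : Partition.length μ ℕ.< L)
           (N : ℕ) (N≡ : N ≡ suc (part ν 0)) where

    private
      t = steps ν L

      weighting : Weighting n L
      weighting r c = W (t² κ κ#0 L r (suc (toℕ c))) (τs (suc (toℕ r)) (suc (toℕ c)) * τs (suc (toℕ r)) (suc (toℕ c)))
                        (t²#0 κ κ#0 L r (suc (toℕ c))) (poch-τs#0 (suc (toℕ r)) (suc (toℕ c)))

      Σ≤≈Σ< : ∀ f → Σ≤ (part ν 0) f ≈ Σ< N f
      Σ≤≈Σ< f = trans (∑≈Σ< (suc (part ν 0)) f) (reflexive (≡.cong (λ k → Σ< k f) (≡.sym N≡)))

    ZW≈paths : ∀ a → Bounded N a → ZW κ κ#0 L ν μ a ≈ paths N 1 κ (ends-at μ L) t a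
    ZW≈paths a a<N = begin
      ZW κ κ#0 L ν μ a
        ≈⟨ trans
             (ΣVec-≈ lin-v (ΣVec-≈ (Σ<-linear N) Σ≤≈Σ< L) (suc n) λ v → ΣVec (ΣVec (Σ≤ (part ν 0)) (suc L)) n (summand v))
             (lin-vs .Σ-cong {λ v → ΣVec (ΣVec (Σ≤ (part ν 0)) (suc L)) n (summand v)}
                             {λ v → ΣVec (Σᵛ N (suc L)) n (summand v)}
               λ v → ΣVec-≈ lin-h (ΣVec-≈ (Σ<-linear N) Σ≤≈Σ< (suc L)) n (summand v)) ⟩
      ΣVec (Σᵛ N L) (suc n) (λ v → ΣVec (Σᵛ N (suc L)) n (summand v))
        ≈⟨ lin-v .Σ-cong (λ v₀ → trans
             (ΣVec-linear lin-v n .Σ-cong λ v → trans (ΣVec-linear lin-h n .Σ-cong λ h → separate v₀ v h)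
               (sym (ΣVec-linear lin-h n .Σ-* _ _)))
             (sym (ΣVec-linear lin-v n .Σ-* _ _))) ⟩
      Σᵛ N L (λ v₀ → 𝟙 (all? λ c → lookup v₀ c ℕ.≟ lookup t c) * configurations N weighting (ends-at μ L) v₀ a)
        ≈⟨ Σᵛ-pick N L t (λ v₀ → configurations N weighting (ends-at μ L) v₀ a) (≡.subst (λ k → Bounded k t) (≡.sym N≡) (bounded-steps ν L)) ⟩
      configurations N weighting (ends-at μ L) t a
        ≈⟨ configurations≈paths N 1 κ weighting
             (λ r c → W≈vertex (suc (toℕ r)) (suc (toℕ c)) (κ#0 r) (t²#0 κ κ#0 L r (suc (toℕ c))))
             (ends-at μ L) t a a<N ⟩
      paths N 1 κ (ends-at μ L) t a ∎
      where
      summand : Vec (Vec ℕ L) (suc n) → Vec (Vec ℕ (suc L)) n → Carrier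
      summand v h = 𝟙 (boundary? κ κ#0 L ν μ a v h) * ∏[ r < n ] ∏[ c < L ] vertexWeight κ κ#0 L v h r c

      lin-v  = ΣVec-linear (Σ<-linear N) L
      lin-vs = ΣVec-linear lin-v (suc n)
      lin-h  = ΣVec-linear (Σ<-linear N) (suc L)

      separate : ∀ v₀ v h →
        𝟙 (boundary? κ κ#0 L ν μ a (v₀ ∷ v) h) * (∏[ r < n ] ∏[ c < L ] vertexWeight κ κ#0 L (v₀ ∷ v) h r c)
        ≈ 𝟙 (all? λ c → lookup v₀ c ℕ.≟ lookup t c)
          * (ends-at μ L (lookup (v₀ ∷ v) (fromℕ n))
            * (𝟙 (all? λ r → lookup (lookup h r) zero ℕ.≟ lookup a r)
               * 𝟙 (all? λ r → lookup (lookup h r) (fromℕ L) ℕ.≟ 0))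
            * ∏[ r < n ] ∏[ c < L ] vertexWeight κ κ#0 L (v₀ ∷ v) h r c)
      separate v₀ v h = trans (*-congʳ (trans
          (𝟙-× (boundary? κ κ#0 L ν μ a (v₀ ∷ v) h) (top? ×-dec bottom?) (left? ×-dec right?) (λ x → x) _,_)
          (*-cong (trans (𝟙-× (top? ×-dec bottom?) top? bottom? (λ x → x) _,_)
                    (*-congʳ (𝟙-⇔ top? (all? λ c → lookup v₀ c ℕ.≟ lookup t c)
                      (λ eq c → ≡.trans (eq c) (≡.sym (Vec.lookup∘tabulate _ c)))
                      (λ eq c → ≡.trans (eq c) (Vec.lookup∘tabulate _ c)))))
                  (𝟙-× (left? ×-dec right?) left? right? (λ x → x) _,_))))
        (trans (*-congʳ (*-assoc _ _ _)) (*-assoc _ _ _))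
        where
        top?    = all? λ c → lookup v₀ c ℕ.≟ step ν (toℕ c)
        bottom? = all? λ c → lookup (lookup (v₀ ∷ v) (fromℕ n)) c ℕ.≟ step μ (toℕ c)
        left?   = all? λ r → lookup (lookup h r) zero ℕ.≟ lookup a r
        right?  = all? λ r → lookup (lookup h r) (fromℕ L) ℕ.≟ 0

    -- Outside Σ a + μ₁ = ν₁ the paths vanish by conservation. This frees the sum over a, which is
    -- then distributed over the rows.
    𝔽ˢ≈chain : 𝔽ˢ κ κ#0 L ν μ ≈ chain N 1 (List.tabulate κ) t (ends-at μ L)
    𝔽ˢ≈chain = begin
      𝔽ˢ κ κ#0 L ν μ
        ≈⟨ ΣVec-≈ (Σ<-linear N) Σ≤≈Σ< n _ ⟩
      Σᵛ N n _
        ≈⟨ Σᵛ-cong-bounded N n (λ a a<N → trans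
             (*-cong (*-congˡ (Π.sum-cong-≋ {n} λ i → emission≈ (suc (toℕ i)) (κ#0 i) (lookup a i))) (ZW≈paths a a<N))
             (constrained a)) ⟩
      Σᵛ N n (λ a → ∏[ i < n ] emission (suc (toℕ i)) (κ i) (lookup a i) * paths N 1 κ (ends-at μ L) t a)
        ≈⟨ Σ-paths≈chain N 1 κ (ends-at μ L) t ⟩
      chain N 1 (List.tabulate κ) t (ends-at μ L) ∎
      where
      constrained : ∀ a → 𝟙 (Vec.sum a ℕ.+ part μ 0 ℕ.≟ part ν 0) * (∏[ i < n ] emission (suc (toℕ i)) (κ i) (lookup a i))
          * paths N 1 κ (ends-at μ L) t a
        ≈ ∏[ i < n ] emission (suc (toℕ i)) (κ i) (lookup a i) * paths N 1 κ (ends-at μ L) t a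
      constrained a = cases (Vec.sum a ℕ.+ part μ 0 ℕ.≟ part ν 0)
        where
        cases : (sum? : Dec (Vec.sum a ℕ.+ part μ 0 ≡ part ν 0)) →
          𝟙 sum? * (∏[ i < n ] emission (suc (toℕ i)) (κ i) (lookup a i)) * paths N 1 κ (ends-at μ L) t a
          ≈ ∏[ i < n ] emission (suc (toℕ i)) (κ i) (lookup a i) * paths N 1 κ (ends-at μ L) t a
        cases (yes _)  = *-congʳ (*-identityˡ _)
        cases (no  a≢) = trans (*-congˡ paths≈0) (trans (zeroʳ _) (sym (trans (*-congˡ paths≈0) (zeroʳ _))))
          where
          paths≈0 = paths-conservation N 1 κ (ends-at μ L) (part μ 0) (ends-at-0 μ L μ<L) t a
            λ eq → a≢ (≡.trans eq (sum-steps ν L ν<L))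

  1-q^ : ∀ k → (1# - q ^ suc k) # 0#
  1-q^ k = leftInverse⇒#0 (q!⁻¹ (suc k) * shifted q 1# q k)
    (trans (*-assoc _ _ _) (trans (*-comm _ _) (q!-inverse (suc k))))

  open Identity q q#0 1-q^ using (symmetric)

  -- The prefactor `A` is free of κ and `Z` is defined at every point. The polynomial and its
  -- symmetry belong to `A * Z`, which agrees with 𝔽 at the points with nonzero coordinates.
  𝔽-symmetric : ∀ n ν μ L → Partition.length ν ℕ.< L → Partition.length μ ℕ.< L →
    IsSymmetricPolynomial {n} (λ κ κ#0 → 𝔽 κ κ#0 L ν μ)
  𝔽-symmetric n ν μ L ν<L μ<L =
      proj₁ F
    , symmetric (λ x → A * Z x) (λ π x → *-congˡ (chain-↭ N 1 (tabulate-permute π x) (steps ν L) (ends-at μ L) t<N)) F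
    , λ κ κ#0 → trans (*-congˡ (𝔽ˢ≈chain κ κ#0 L ν μ ν<L μ<L N ≡.refl)) (proj₂ F κ)
    where
    N = suc (part ν 0)
    t<N : Vec.sum (steps ν L) ℕ.< N
    t<N = ℕ.s≤s (ℕ.≤-reflexive (sum-steps ν L ν<L))
    A : Carrier
    A = ([- τs n ]^ μ) / ([- s ]^ ν) [ [-]^-#0 s s#0 ν ] * (𝖼 (τs n) μ / 𝖼 s ν [ 𝖼#0 s poch-s#0 ν ])
    Z : Vector Carrier n → Carrier
    Z x = chain N 1 (List.tabulate x) (steps ν L) (ends-at μ L)

    F : IsPolynomial (λ x → A * Z x)
    F = constant A ⊡ respects
      (λ x → reflexive (≡.cong (λ κs → chain N 1 κs (steps ν L) (ends-at μ L)) (≡.sym (List.map-tabulate (λ i y → y i) (λ f → f x)))))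
      (chain-polynomial N 1 (ListAll.tabulate⁺ coordinate) (steps ν L) (ends-at μ L))

theorem5p9 : ∀ {c ℓ₁ ℓ₂} (K : HeytingField c ℓ₁ ℓ₂) (Θ : Parameters K) →
    (n : ℕ) → 1 ≤ n →
    (ν μ : Partition) →
    (L : ℕ) → Partition.length ν < L → Partition.length μ < L →
    Polynomials.IsSymmetricPolynomial K {n}
    (λ κ κ#0 → Functions.𝔽 K Θ κ κ#0 L ν μ)
theorem5p9 K Θ n 1≤n ν μ L ν<L μ<L = Symmetry.𝔽-symmetric K Θ n ν μ L ν<L μ<L
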